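{- Fix $r\ge1$, indeterminates $x=(x_0,\dots,x_r)$, and let $G$ and $F$ be the power series defined below. Let $y=(y_0,\dots,y_r)$ be the formal power series in $x_0,\dots,x_r$ with zero constant terms uniquely determined by $$x_j=\frac{y_j(1+y_j)}{E(y)^2}\quad(0\le j\le r),\qquad E(y)=\prod_{i=0}^r(1+y_i),$$ let $t=zE(y)^2$, let $E(y,u)=\prod_{i=0}^r(1+y_iu)$, and let $c(t)=\frac{1-\sqrt{1-4t}}{2t}$. Then $$G=\frac{c(t)E(y)}{E(y,c(t))},\qquad F=\frac{E(y)}{t}\left(E(y)-\frac{E(y,c(t))}{c(t)}\right).$$
   Context: An $r$-permutation of a finite set $A$ of positive integers is a word in which each element of $A$ appears exactly $r$ times such that whenever $i<j<k$ and $a_i=a_k$ we have $a_j\le a_i$. A $k$-tuple $r$-permutation of $[n]$ is a tuple $(\alpha_1,\dots,\alpha_k)$ of words whose concatenation is an $r$-permutation of $[n]$ and in which every letter appears in only one $\alpha_i$. Stack sorting $S$: on words with distinct letters, $S(\emptyset)=\emptyset$ and $S(\pi_lm\pi_r)=S(\pi_l)S(\pi_r)m$ with $m$ the largest letter; on a nonempty $r$-permutation with largest letter $m$, written $\alpha_1m\alpha_2m\cdots m\alpha_{r+1}$, $S(\pi)=S(\alpha_1)\cdots S(\alpha_{r+1})m$. The tuple is two-stack-sortable if $S(S(\alpha_1)\cdots S(\alpha_k))=12\cdots n$. A letter $a$ of an $r$-permutation is a type $i$ descent ($1\le i\le r$) if its $i$th occurrence is immediately followed by a smaller letter, and a type $0$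 descent if its first occurrence immediately follows a smaller letter; for a tuple, descent sets are unions over the components, and its weight is $\prod_i x_i^{(\#\text{type } i \text{ descents})}$. $g_n^{(k)}$ is the sum of the weights of all two-stack-sortable $k$-tuple $r$-permutations of $[n]$ with all components nonempty, $g_k=\sum_n g_n^{(k)}$, $G=\sum_{k\ge0}g_kz^k$, $f_k=\sum_{j\ge0}g_{k+j}e_j(x)$ with $e_j$ the $j$th elementary symmetric polynomial in $x_0,\dots,x_r$, and $F=\sum_{k\ge0}f_kz^k$. -}

module Defs where

open import Data.Bool using (Bool; true; false; if_then_else_; _∧_; _∨_; not)
open import Data.Nat as ℕ using (ℕ; zero; suc; _+_; _*_; _∸_; _⊔_; _≤ᵇ_; _<ᵇ_; _≡ᵇ_; _≤_)
open import Data.Integer as ℤ using (ℤ)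
open import Data.Fin as Fin using (Fin; toℕ)
open import Data.List as L using (List; []; _∷_; _++_; map; concatMap; upTo; allFin; length; take; drop; concat; foldr)
open import Data.Nat.ListAction using (sum)
open import Data.Bool.ListAction using (all)
open import Data.Vec as V using (Vec; []; _∷_; replicate; tabulate)
open import Data.Vec.Properties as VP using ()
open import Data.List.Properties as LP using ()
open import Data.Maybe using (Maybe; just; nothing; maybe)
open import Data.Product using (_×_; _,_; proj₁; proj₂; ∃-syntax)
open import Relation.Nullary using (does)
open import Relation.Binary.PropositionalEquality using (_≡_)

-- Formal power series in z, x₀, …, x_r with integer coefficients.
-- A monomial z^k x^a is the pair (k , a).

Mono : ℕ → Set
Mono r = ℕ × Vec ℕ (suc r)

Series : ℕ → Set
Series r = Mono r → ℤ

infix 4 _≈_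
_≈_ : ∀ {r} → Series r → Series r → Set
f ≈ g = ∀ m → f m ≡ g m

sumℤ : List ℤ → ℤ
sumℤ = foldr ℤ._+_ (ℤ.+ 0)

splitsℕ : ℕ → List (ℕ × ℕ)
splitsℕ n = map (λ i → i , n ∸ i) (upTo (suc n))

splitsV : ∀ {m} → Vec ℕ m → List (Vec ℕ m × Vec ℕ m)
splitsV [] = ([] , []) ∷ []
splitsV (e ∷ es) =
  concatMap (λ p → map (λ uv → (proj₁ p ∷ proj₁ uv , proj₂ p ∷ proj₂ uv)) (splitsV es))
            (splitsℕ e)

splitsM : ∀ {r} → Mono r → List (Mono r × Mono r)
splitsM (k , a) =
  concatMap (λ kk → map (λ aa → ((proj₁ kk , proj₁ aa) , (proj₂ kk , proj₂ aa))) (splitsV a))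
            (splitsℕ k)

eqMono : ∀ {r} → Mono r → Mono r → Bool
eqMono (k , a) (l , b) = (k ≡ᵇ l) ∧ does (VP.≡-dec ℕ._≟_ a b)

infixl 6 _+S_ _-S_
infixl 7 _*S_

_+S_ : ∀ {r} → Series r → Series r → Series r
(f +S g) m = f m ℤ.+ g m

_-S_ : ∀ {r} → Series r → Series r → Series r
(f -S g) m = f m ℤ.- g m

_*S_ : ∀ {r} → Series r → Series r → Series r
(f *S g) m = sumℤ (map (λ pq → f (proj₁ pq) ℤ.* g (proj₂ pq)) (splitsM m))

monoS : ∀ {r} → Mono r → Series r
monoS m₀ m = if eqMono m₀ m then ℤ.+ 1 else ℤ.+ 0

zeroS : ∀ {r} → Series r
zeroS _ = ℤ.+ 0

oneS : ∀ {r} → Series r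
oneS {r} = monoS (0 , replicate (suc r) 0)

zS : ∀ {r} → Series r
zS {r} = monoS (1 , replicate (suc r) 0)

xS : ∀ {r} → Fin (suc r) → Series r
xS {r} j = monoS (0 , tabulate (λ i → if does (i Fin.≟ j) then 1 else 0))

constTerm : ∀ {r} → Series r → ℤ
constTerm {r} f = f (0 , replicate (suc r) 0)

sumS : ∀ {r} → List (Series r) → Series r
sumS = foldr _+S_ zeroS

prodS : ∀ {r} → List (Series r) → Series r
prodS = foldr _*S_ oneS

Ey : ∀ {r} → (Fin (suc r) → Series r) → Series r
Ey {r} y = prodS (map (λ i → oneS +S y i) (allFin (suc r)))

Eyu : ∀ {r} → (Fin (suc r) → Series r) → Series r → Series r
Eyu {r} y u = prodS (map (λ i → oneS +S y i *S u) (allFin (suc r)))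

allBool : (m : ℕ) → List (Vec Bool m)
allBool zero = [] ∷ []
allBool (suc m) = concatMap (λ v → (true ∷ v) ∷ (false ∷ v) ∷ []) (allBool m)

countTrue : ∀ {m} → Vec Bool m → ℕ
countTrue [] = 0
countTrue (b ∷ v) = (if b then 1 else 0) + countTrue v

esym : (r : ℕ) → ℕ → Series r
esym r j = sumS (map (λ S → monoS (0 , V.map (λ b → if b then 1 else 0) S))
                     (L.filterᵇ (λ S → countTrue S ≡ᵇ j) (allBool (suc r))))

shiftZ : ∀ {r} → ℕ → Series r → Series r
shiftZ j G (k , a) = G (k + j , a)

-- F = Σ_k f_k z^k with f_k = Σ_{j≥0} g_{k+j} e_j(x)   (e_j = 0 for j > r+1)
Fseries : (r : ℕ) → Series r → Series r
Fseries r G = sumS (map (λ j → esym r j *S shiftZ j G) (upTo (suc (suc r))))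

occ : ℕ → List ℕ → ℕ
occ a [] = 0
occ a (b ∷ w) = (if b ≡ᵇ a then 1 else 0) + occ a w

maxL : List ℕ → ℕ
maxL = foldr _⊔_ 0

consHead : ℕ → List (List ℕ) → List (List ℕ)
consHead a [] = (a ∷ []) ∷ []
consHead a (p ∷ ps) = (a ∷ p) ∷ ps

splitBy : ℕ → List ℕ → List (List ℕ)
splitBy m [] = [] ∷ []
splitBy m (a ∷ w) = if a ≡ᵇ m then [] ∷ splitBy m w else consHead a (splitBy m w)

-- stack sorting with fuel (fuel = length is always enough, every part is shorter)
sortF : ℕ → List ℕ → List ℕ
sortF zero w = []
sortF (suc f) [] = []
sortF (suc f) (a ∷ w) =
  let m = maxL (a ∷ w) in concatMap (sortF f) (splitBy m (a ∷ w)) ++ (m ∷ [])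

stackSort : List ℕ → List ℕ
stackSort w = sortF (length w) w

-- i < j < k, a_i = a_k ⇒ a_j ≤ a_i : for a letter a, `chk a true rest` checks that every
-- letter of rest lying before a later occurrence of a is ≤ a
chk : ℕ → Bool → List ℕ → Bool
chk a good [] = true
chk a good (b ∷ rest) = (not (b ≡ᵇ a) ∨ good) ∧ chk a (good ∧ (b ≤ᵇ a)) rest

patternOK : List ℕ → Bool
patternOK [] = true
patternOK (a ∷ rest) = chk a true rest ∧ patternOK rest

letters : ℕ → List ℕ
letters n = map suc (upTo n)

-- w is an r-permutation of [n] (letters of w are assumed to be in [n])
isRPerm : ℕ → ℕ → List ℕ → Bool
isRPerm r n w = all (λ m → occ m w ≡ᵇ r) (letters n) ∧ patternOK w

descType : ℕ → List ℕ → ℕ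
descType j w = go nothing [] w
  where
  nextLess : ℕ → List ℕ → Bool
  nextLess a [] = false
  nextLess a (b ∷ _) = b <ᵇ a
  cond : ℕ → Maybe ℕ → List ℕ → ℕ → List ℕ → Bool
  cond zero prev seen a rest = maybe (λ p → p <ᵇ a) false prev ∧ (occ a seen ≡ᵇ 0)
  cond (suc i) prev seen a rest = nextLess a rest ∧ (occ a seen ≡ᵇ i)
  go : Maybe ℕ → List ℕ → List ℕ → ℕ
  go prev seen [] = 0
  go prev seen (a ∷ rest) =
    (if cond j prev seen a rest then 1 else 0) + go (just a) (a ∷ seen) rest

weightVec : (r : ℕ) → List (List ℕ) → Vec ℕ (suc r)
weightVec r tup = tabulate (λ j → sum (map (descType (toℕ j)) tup))

disjointComps : ℕ → List (List ℕ) → Bool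
disjointComps n tup =
  all (λ m → length (L.filterᵇ (λ c → 1 ≤ᵇ occ m c) tup) ≤ᵇ 1) (letters n)

twoStackSortable : ℕ → List (List ℕ) → Bool
twoStackSortable n tup =
  does (LP.≡-dec ℕ._≟_ (stackSort (concatMap stackSort tup)) (letters n))

wordsOver : ℕ → ℕ → List (List ℕ)
wordsOver n zero = [] ∷ []
wordsOver n (suc L) = concatMap (λ a → map (a ∷_) (wordsOver n L)) (letters n)

cuts : ℕ → List ℕ → List (List (List ℕ))
cuts zero [] = [] ∷ []
cuts zero (_ ∷ _) = []
cuts (suc k) w =
  concatMap (λ i → map (take (suc i) w ∷_) (cuts k (drop (suc i) w))) (upTo (length w))

countTSS : (r n k : ℕ) → Vec ℕ (suc r) → ℕ
countTSS r n k a =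
  length (L.filterᵇ
    (λ tup → isRPerm r n (concat tup) ∧ disjointComps n tup ∧ twoStackSortable n tup
             ∧ does (VP.≡-dec ℕ._≟_ (weightVec r tup) a))
    (concatMap (cuts k) (wordsOver n (n * r))))

partialG : (r N : ℕ) → Series r
partialG r N (k , a) = ℤ.+ (sum (map (λ n → countTSS r n k a) (upTo (suc N))))

-- G = Σ_k g_k z^k = Σ_n Σ_k g_n^{(k)} z^k : each coefficient is the eventual value of the partial sums
IsG : (r : ℕ) → Series r → Set
IsG r G = ∀ m → ∃[ N ] (∀ N′ → N ≤ N′ → partialG r N′ m ≡ G m)

{-# OPTIONS --safe #-}
module Submission where

-- Removing the copies of the largest letter from a two-stack-sortable tuple leaves a
-- two-stack-sortable tuple to its left (the earlier components together with the nonempty ones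
-- of the r + 1 factors of the component that was cut) and one to its right, and all letters of
-- the former are smaller than those of the latter.  The nonempty factors are exactly the descents
-- that are lost, so G = 1 + z F G, and F is obtained from G by applying all the
-- commuting operators T_i f = f + x_i Δ f, where Δ f = (f - f(0)) / z.
--
-- This equation has only one solution, since the coefficient of z^k x^a involves only
-- coefficients of smaller total degree.  To see that G = c E(y) / E(y, c) solves it, the product
-- of the T_i is evaluated by induction on the set I of indices:  with P_I(u) = Π_{i ∈ I} (1 + y_i u)
-- one finds  T_I (1 / P_I(c)) = 2 - P_I(c)  and  t T_I (c / P_I(c)) = P_I(1) - P_I(c) / c.

open import Algebra.Bundles using (CommutativeRing)
open import Algebra.Solver.Ring.AlmostCommutativeRing using (fromCommutativeRing; _-Raw-AlmostCommutative⟶_)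
import Algebra.Solver.Ring as RingSolver
import Algebra.Properties.Ring as RingProperties
import Algebra.Properties.AbelianGroup as AbelianGroupProperties
import Algebra.Properties.Semiring.Mult.TCOptimised as Multiples
import Relation.Binary.Reasoning.Setoid as SetoidReasoning
open import Data.Nat as ℕ using (zero; suc)
open import Data.Integer as ℤ using (ℤ; +_; -[1+_])
import Data.Nat.Properties as ℕP
import Data.Integer.Properties as ℤP
open import Data.List as L using (List; []; _∷_)
open import Data.Maybe using (Maybe; just; nothing)
open import Relation.Nullary using (yes; no)
open import Relation.Binary.PropositionalEquality as ≡ using (_≡_)

-- In `G = 1 + z F G` the `z` stands for the component that contains the largest letter and `G` for
-- the right tuple. If `i` components precede that one and `S` is the set of positions of its
-- nonempty factors, the left tuple has `i + |S|` components and the lost descents weigh `x^S`; the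
-- sum over `S` is what the `e_j` collect in `f_i`, and it is also the expansion of the product of
-- the operators `1 + x_i Δ`.
--
-- `G` is given only as a limit over the number of letters. A count of descents shows that this
-- number is the number of components plus the degree of the weight, so every coefficient is one
-- finite count and the bijection can be made between finite lists.
--
-- On the algebraic side the `y_i` have to commute with `Δ`, hence must not involve `z`; this is not
-- assumed but follows from the uniqueness of the solution of the system for `y`. Since `t` has no
-- inverse among power series, the identities are proved after multiplication by `t`, which can be
-- cancelled because `z` can and `E(y)^2` is invertible. Each `T_i` is multiplication by
-- `1 + x_i / z` followed by deletion of the negative powers of `z`; this is the source of the
-- closed forms.

-- Ring solver with integer coefficients for an arbitrary commutative ring

module IntegerSolver {a ℓ} (R : CommutativeRing a ℓ) where
  open CommutativeRing R
  open RingProperties ring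
  open AbelianGroupProperties +-abelianGroup using (⁻¹-∙-comm)
  open Multiples semiring using (1+×; ×-homo-+; ×1-homo-*) renaming (_×_ to _·_)
  open SetoidReasoning setoid

  fromℤ : ℤ → Carrier
  fromℤ (+ n) = n · 1#
  fromℤ -[1+ n ] = - (suc n · 1#)

  fromℤ-⊖ : ∀ m n → fromℤ (m ℤ.⊖ n) ≈ m · 1# - n · 1#
  fromℤ-⊖ m zero = sym (trans (+-congˡ -0#≈0#) (+-identityʳ _))
  fromℤ-⊖ zero (suc n) = sym (+-identityˡ _)
  fromℤ-⊖ (suc m) (suc n) = begin
    fromℤ (suc m ℤ.⊖ suc n)             ≡⟨ ≡.cong fromℤ (ℤP.[1+m]⊖[1+n]≡m⊖n m n) ⟩
    fromℤ (m ℤ.⊖ n)                     ≈⟨ fromℤ-⊖ m n ⟩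
    m · 1# - n · 1#                     ≈⟨ +-congˡ (sym (+-identityˡ _)) ⟩
    m · 1# + (0# - n · 1#)              ≈⟨ +-congˡ (+-congʳ (sym (-‿inverseʳ 1#))) ⟩
    m · 1# + ((1# - 1#) - n · 1#)       ≈⟨ +-congˡ (+-assoc _ _ _) ⟩
    m · 1# + (1# + (- 1# - n · 1#))     ≈⟨ +-assoc _ _ _ ⟨
    (m · 1# + 1#) + (- 1# - n · 1#)     ≈⟨ +-cong (+-comm _ _) (⁻¹-∙-comm _ _) ⟩
    (1# + m · 1#) - (1# + n · 1#)       ≈⟨ +-cong (1+× m 1#) (-‿cong (1+× n 1#)) ⟨
    suc m · 1# - suc n · 1#             ∎

  fromℤ-+ : ∀ i j → fromℤ (i ℤ.+ j) ≈ fromℤ i + fromℤ j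
  fromℤ-+ (+ m) (+ n) = ×-homo-+ 1# m n
  fromℤ-+ (+ m) -[1+ n ] = fromℤ-⊖ m (suc n)
  fromℤ-+ -[1+ m ] (+ n) = trans (fromℤ-⊖ n (suc m)) (+-comm _ _)
  fromℤ-+ -[1+ m ] -[1+ n ] = begin
    - (suc (suc (m ℕ.+ n)) · 1#)     ≡⟨ ≡.cong (λ k → - (suc k · 1#)) (≡.sym (ℕP.+-suc m n)) ⟩
    - ((suc m ℕ.+ suc n) · 1#)       ≈⟨ -‿cong (×-homo-+ 1# (suc m) (suc n)) ⟩
    - (suc m · 1# + suc n · 1#)      ≈⟨ ⁻¹-∙-comm _ _ ⟨
    - (suc m · 1#) - (suc n · 1#)    ∎

  fromℤ-neg : ∀ i → fromℤ (ℤ.- i) ≈ - fromℤ i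
  fromℤ-neg (+ zero) = sym -0#≈0#
  fromℤ-neg (+ suc n) = refl
  fromℤ-neg -[1+ n ] = sym (-‿involutive _)

  fromℤ-*⁺ : ∀ m n → fromℤ (+ m ℤ.* + n) ≈ m · 1# * (n · 1#)
  fromℤ-*⁺ m n = trans (reflexive (≡.cong fromℤ (≡.sym (ℤP.pos-* m n)))) (×1-homo-* m n)

  fromℤ-* : ∀ i j → fromℤ (i ℤ.* j) ≈ fromℤ i * fromℤ j
  fromℤ-* (+ m) (+ n) = fromℤ-*⁺ m n
  fromℤ-* (+ m) -[1+ n ] = begin
    fromℤ (+ m ℤ.* -[1+ n ])         ≡⟨ ≡.cong fromℤ (≡.sym (ℤP.neg-distribʳ-* (+ m) (+ suc n))) ⟩
    fromℤ (ℤ.- (+ m ℤ.* + suc n))    ≈⟨ fromℤ-neg (+ m ℤ.* + suc n) ⟩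
    - fromℤ (+ m ℤ.* + suc n)        ≈⟨ -‿cong (fromℤ-*⁺ m (suc n)) ⟩
    - (m · 1# * (suc n · 1#))        ≈⟨ -‿distribʳ-* _ _ ⟩
    m · 1# * - (suc n · 1#)          ∎
  fromℤ-* -[1+ m ] (+ n) = begin
    fromℤ (-[1+ m ] ℤ.* + n)         ≡⟨ ≡.cong fromℤ (≡.sym (ℤP.neg-distribˡ-* (+ suc m) (+ n))) ⟩
    fromℤ (ℤ.- (+ suc m ℤ.* + n))    ≈⟨ fromℤ-neg (+ suc m ℤ.* + n) ⟩
    - fromℤ (+ suc m ℤ.* + n)        ≈⟨ -‿cong (fromℤ-*⁺ (suc m) n) ⟩
    - (suc m · 1# * (n · 1#))        ≈⟨ -‿distribˡ-* _ _ ⟩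
    - (suc m · 1#) * (n · 1#)        ∎
  fromℤ-* -[1+ m ] -[1+ n ] = begin
    fromℤ (+ suc m ℤ.* + suc n)          ≈⟨ fromℤ-*⁺ (suc m) (suc n) ⟩
    suc m · 1# * (suc n · 1#)            ≈⟨ -‿involutive _ ⟨
    - - (suc m · 1# * (suc n · 1#))      ≈⟨ -‿cong (-‿distribʳ-* _ _) ⟩
    - (suc m · 1# * - (suc n · 1#))      ≈⟨ -‿distribˡ-* _ _ ⟩
    - (suc m · 1#) * - (suc n · 1#)      ∎

  private
    hom : ℤ.+-*-rawRing -Raw-AlmostCommutative⟶ fromCommutativeRing R
    hom = record
      { ⟦_⟧ = fromℤ ; +-homo = fromℤ-+ ; *-homo = fromℤ-* ; -‿homo = fromℤ-neg
      ; 0-homo = refl ; 1-homo = refl }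

    -- Only integers are compared, because equality in the ring itself, which will consist of
    -- infinite series, cannot be decided.
    coefficient≟ : ∀ i j → Maybe (fromℤ i ≈ fromℤ j)
    coefficient≟ i j with i ℤ.≟ j
    ... | yes ≡.refl = just refl
    ... | no _ = nothing

  open RingSolver ℤ.+-*-rawRing (fromCommutativeRing R) hom coefficient≟ public
    using (solve; _:=_; _:+_; _:*_; _:-_; :-_; con; Polynomial)

  :1 : ∀ {n} → Polynomial n
  :1 = con (+ 1)

-- The operators `T_i` and the kernel identities over an abstract ring

module Kernel {a ℓ} (R : CommutativeRing a ℓ) where
  open CommutativeRing R

  -- No coefficient is inspected in this module: `ev₀` acts as the substitution `z = 0`, and
  -- `decompose` together with `z-cancel` pins down `Δ`.
  module Shift
    (z : Carrier) (Δ ev₀ : Carrier → Carrier)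
    (ev₀-cong : ∀ {f g} → f ≈ g → ev₀ f ≈ ev₀ g)
    (ev₀-+ : ∀ f g → ev₀ (f + g) ≈ ev₀ f + ev₀ g)
    (ev₀-* : ∀ f g → ev₀ (f * g) ≈ ev₀ f * ev₀ g)
    (ev₀-1 : ev₀ 1# ≈ 1#)
    (ev₀-z : ev₀ z ≈ 0#)
    (decompose : ∀ f → f ≈ ev₀ f + z * Δ f)
    (z-cancel : ∀ {f g} → z * f ≈ z * g → f ≈ g)
    where

    open IntegerSolver R
    open RingProperties ring
    open SetoidReasoning setoid

    zΔ : ∀ f → z * Δ f ≈ f - ev₀ f
    zΔ f = trans (solve 2 (λ e d → d := (e :+ d) :- e) refl (ev₀ f) (z * Δ f))
                 (+-congʳ (sym (decompose f)))

    -- Since `z` can be cancelled, `Δ f` is the only quotient of `f - ev₀ f` by `z`; the rules for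
    -- `Δ` are all checked after multiplication by `z`.
    Δ-unique : ∀ {f g} → z * g ≈ f - ev₀ f → Δ f ≈ g
    Δ-unique eq = z-cancel (trans (zΔ _) (sym eq))

    Δ-cong : ∀ {f g} → f ≈ g → Δ f ≈ Δ g
    Δ-cong {f} {g} eq = Δ-unique (trans (zΔ g) (+-cong (sym eq) (-‿cong (ev₀-cong (sym eq)))))

    Δ-+ : ∀ f g → Δ (f + g) ≈ Δ f + Δ g
    Δ-+ f g = Δ-unique (begin
      z * (Δ f + Δ g)                ≈⟨ distribˡ z _ _ ⟩
      z * Δ f + z * Δ g              ≈⟨ +-cong (zΔ f) (zΔ g) ⟩
      (f - ev₀ f) + (g - ev₀ g)      ≈⟨ solve 4 (λ f e g e′ → (f :- e) :+ (g :- e′) := (f :+ g) :- (e :+ e′)) refl _ _ _ _ ⟩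
      (f + g) - (ev₀ f + ev₀ g)      ≈⟨ +-congˡ (-‿cong (sym (ev₀-+ f g))) ⟩
      (f + g) - ev₀ (f + g)          ∎)

    -- These are the series free of `z`, the scalars over which `Δ` is linear.
    Constant : Carrier → Set ℓ
    Constant k = ev₀ k ≈ k

    Δ-const : ∀ {k} f → Constant k → Δ (k * f) ≈ k * Δ f
    Δ-const {k} f k₀ = Δ-unique (begin
      z * (k * Δ f)          ≈⟨ solve 3 (λ z k d → z :* (k :* d) := k :* (z :* d)) refl _ _ _ ⟩
      k * (z * Δ f)          ≈⟨ *-congˡ (zΔ f) ⟩
      k * (f - ev₀ f)        ≈⟨ solve 3 (λ k f e → k :* (f :- e) := k :* f :- k :* e) refl _ _ _ ⟩
      k * f - k * ev₀ f      ≈⟨ +-congˡ (-‿cong (trans (*-congʳ (sym k₀)) (sym (ev₀-* k f)))) ⟩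
      k * f - ev₀ (k * f)    ∎)

    constant-* : ∀ {k l} → Constant k → Constant l → Constant (k * l)
    constant-* k₀ l₀ = trans (ev₀-* _ _) (*-cong k₀ l₀)

    module Operators {I : Set} (x : I → Carrier) (x₀ : ∀ i → Constant (x i)) where

      T : I → Carrier → Carrier
      T i f = f + x i * Δ f

      -- The head of the list acts first: applied to `q i * Q is`, the operator `T i` meets the
      -- factor `q i` before the others act on what is left.
      Ts : List I → Carrier → Carrier
      Ts [] f = f
      Ts (i ∷ is) f = Ts is (T i f)

      T-cong : ∀ i {f g} → f ≈ g → T i f ≈ T i g
      T-cong i eq = +-cong eq (*-congˡ (Δ-cong eq))

      Ts-cong : ∀ is {f g} → f ≈ g → Ts is f ≈ Ts is g
      Ts-cong [] eq = eq
      Ts-cong (i ∷ is) eq = Ts-cong is (T-cong i eq)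

      Ts-+ : ∀ is f g → Ts is (f + g) ≈ Ts is f + Ts is g
      Ts-+ [] f g = refl
      Ts-+ (i ∷ is) f g = trans (Ts-cong is (begin
        (f + g) + x i * Δ (f + g)            ≈⟨ +-congˡ (*-congˡ (Δ-+ f g)) ⟩
        (f + g) + x i * (Δ f + Δ g)          ≈⟨ solve 5 (λ f g x d e → (f :+ g) :+ x :* (d :+ e) := (f :+ x :* d) :+ (g :+ x :* e)) refl _ _ _ _ _ ⟩
        T i f + T i g                        ∎)) (Ts-+ is _ _)

      Ts-const : ∀ is {k} f → Constant k → Ts is (k * f) ≈ k * Ts is f
      Ts-const [] f k₀ = refl
      Ts-const (i ∷ is) {k} f k₀ = trans (Ts-cong is (begin
        k * f + x i * Δ (k * f)    ≈⟨ +-congˡ (*-congˡ (Δ-const f k₀)) ⟩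
        k * f + x i * (k * Δ f)    ≈⟨ solve 4 (λ k f x d → k :* f :+ x :* (k :* d) := k :* (f :+ x :* d)) refl _ _ _ _ ⟩
        k * T i f                  ∎)) (Ts-const is (T i f) k₀)

      Ts-Δ : ∀ is f → Ts is (Δ f) ≈ Δ (Ts is f)
      Ts-Δ [] f = refl
      Ts-Δ (i ∷ is) f = trans (Ts-cong is (begin
        Δ f + x i * Δ (Δ f)        ≈⟨ +-congˡ (sym (Δ-const (Δ f) (x₀ i))) ⟩
        Δ f + Δ (x i * Δ f)        ≈⟨ Δ-+ _ _ ⟨
        Δ (T i f)                  ∎)) (Ts-Δ is (T i f))

      -- `V` and `W` are to be `E(y)^2` and its inverse, and `q i` is the inverse of `1 + y_i c`.
      -- The equation for `c` is the quadratic equation of the Catalan series at `t = z V`, and `xV`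
      -- is the definition of `y` with the denominator cleared.
      module Solution
        (y q : I → Carrier) (c V W : Carrier)
        (y₀ : ∀ i → Constant (y i)) (W₀ : Constant W) (VW : V * W ≈ 1#)
        (xV : ∀ i → x i * V ≈ y i * (1# + y i))
        (cq : c ≈ 1# + (z * V) * (c * c))
        (qq : ∀ i → (1# + y i * c) * q i ≈ 1#)
        where

        P : Carrier → List I → Carrier
        P u [] = 1#
        P u (i ∷ is) = (1# + y i * u) * P u is

        Q : List I → Carrier
        Q [] = 1#
        Q (i ∷ is) = q i * Q is

        PQ : ∀ is → P c is * Q is ≈ 1#
        PQ [] = *-identityˡ 1#
        PQ (i ∷ is) = begin
          ((1# + y i * c) * P c is) * (q i * Q is)   ≈⟨ solve 4 (λ a b q r → (a :* b) :* (q :* r) := (a :* q) :* (b :* r)) refl _ _ _ _ ⟩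
          ((1# + y i * c) * q i) * (P c is * Q is)   ≈⟨ *-cong (qq i) (PQ is) ⟩
          1# * 1#                                    ≈⟨ *-identityˡ 1# ⟩
          1#                                         ∎

        t : Carrier
        t = z * V

        -- `t` is not invertible, but it is the cancellable `z` times the invertible `V`.
        t-cancel : ∀ {f g} → t * f ≈ t * g → f ≈ g
        t-cancel {f} {g} eq = z-cancel (begin
          z * f                ≈⟨ unW f ⟨
          W * (t * f)          ≈⟨ *-congˡ eq ⟩
          W * (t * g)          ≈⟨ unW g ⟩
          z * g                ∎)
          where
          unW : ∀ h → W * (t * h) ≈ z * h
          unW h = begin
            W * (z * V * h)    ≈⟨ solve 4 (λ w z v h → w :* (z :* v :* h) := (v :* w) :* (z :* h)) refl _ _ _ _ ⟩
            (V * W) * (z * h)  ≈⟨ *-congʳ VW ⟩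
            1# * (z * h)       ≈⟨ *-identityˡ _ ⟩
            z * h              ∎

        -- `W * Δ` is the difference quotient with respect to `t` in place of `z`.
        tWΔ : ∀ f → t * (W * Δ f) ≈ f - ev₀ f
        tWΔ f = begin
          z * V * (W * Δ f)      ≈⟨ solve 4 (λ z v w d → z :* v :* (w :* d) := (v :* w) :* (z :* d)) refl _ _ _ _ ⟩
          (V * W) * (z * Δ f)    ≈⟨ *-congʳ VW ⟩
          1# * (z * Δ f)         ≈⟨ *-identityˡ _ ⟩
          z * Δ f                ≈⟨ zΔ f ⟩
          f - ev₀ f              ∎

        txΔ : ∀ i f → t * (x i * Δ f) ≈ (y i * (1# + y i)) * (f - ev₀ f)
        txΔ i f = begin
          z * V * (x i * Δ f)                   ≈⟨ solve 4 (λ z v x d → z :* v :* (x :* d) := (x :* v) :* (z :* d)) refl _ _ _ _ ⟩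
          (x i * V) * (z * Δ f)                 ≈⟨ *-cong (xV i) (zΔ f) ⟩
          (y i * (1# + y i)) * (f - ev₀ f)      ∎

        ev₀-t : ev₀ t ≈ 0#
        ev₀-t = trans (ev₀-* z V) (trans (*-congʳ ev₀-z) (zeroˡ _))

        ev₀-c : ev₀ c ≈ 1#
        ev₀-c = begin
          ev₀ c                              ≈⟨ ev₀-cong cq ⟩
          ev₀ (1# + t * (c * c))             ≈⟨ ev₀-+ _ _ ⟩
          ev₀ 1# + ev₀ (t * (c * c))         ≈⟨ +-cong ev₀-1 (trans (ev₀-* _ _) (trans (*-congʳ ev₀-t) (zeroˡ _))) ⟩
          1# + 0#                            ≈⟨ +-identityʳ _ ⟩
          1#                                 ∎

        ev₀-1+yc : ∀ i → ev₀ (1# + y i * c) ≈ 1# + y i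
        ev₀-1+yc i = begin
          ev₀ (1# + y i * c)          ≈⟨ ev₀-+ _ _ ⟩
          ev₀ 1# + ev₀ (y i * c)      ≈⟨ +-cong ev₀-1 (trans (ev₀-* _ _) (*-cong (y₀ i) ev₀-c)) ⟩
          1# + y i * 1#               ≈⟨ +-congˡ (*-identityʳ _) ⟩
          1# + y i                    ∎

        ev₀-P : ∀ is → ev₀ (P c is) ≈ P 1# is
        ev₀-P [] = ev₀-1
        ev₀-P (i ∷ is) = trans (ev₀-* _ _)
          (*-cong (trans (ev₀-1+yc i) (+-congˡ (sym (*-identityʳ _)))) (ev₀-P is))

        -- At `z = 0` the root `c` has the value 1, so `1 + y_i c` becomes `1 + y_i` there and `q i`
        -- becomes its inverse.
        1+y-ev₀q : ∀ i → (1# + y i) * ev₀ (q i) ≈ 1#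
        1+y-ev₀q i = begin
          (1# + y i) * ev₀ (q i)              ≈⟨ *-congʳ (ev₀-1+yc i) ⟨
          ev₀ (1# + y i * c) * ev₀ (q i)      ≈⟨ ev₀-* _ _ ⟨
          ev₀ ((1# + y i * c) * q i)          ≈⟨ ev₀-cong (qq i) ⟩
          ev₀ 1#                              ≈⟨ ev₀-1 ⟩
          1#                                  ∎

        absorb : ∀ i Q → Q ≈ (1# + y i * c) * (q i * Q)
        absorb i Q = begin
          Q                                 ≈⟨ *-identityˡ Q ⟨
          1# * Q                            ≈⟨ *-congʳ (qq i) ⟨
          ((1# + y i * c) * q i) * Q        ≈⟨ *-assoc _ _ _ ⟩
          (1# + y i * c) * (q i * Q)        ∎

        -- The solver knows only the laws of commutative rings. The relation `c = 1 + t c^2`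
        -- therefore enters as an explicit multiple `k` of the difference of its two sides, which is
        -- dropped here.
        vanish : ∀ b k {r s} → r ≈ s → b + k * (r - s) ≈ b
        vanish b k {r} {s} eq = begin
          b + k * (r - s)     ≈⟨ +-congˡ (*-congˡ (+-congʳ eq)) ⟩
          b + k * (s - s)     ≈⟨ solve 3 (λ b k s → b :+ k :* (s :- s) := b) refl b k s ⟩
          b                   ∎

        1+y-ev₀qQ : ∀ i Q → (1# + y i) * ev₀ (q i * Q) ≈ ev₀ Q
        1+y-ev₀qQ i Q = begin
          (1# + y i) * ev₀ (q i * Q)          ≈⟨ *-congˡ (ev₀-* _ _) ⟩
          (1# + y i) * (ev₀ (q i) * ev₀ Q)    ≈⟨ *-assoc _ _ _ ⟨
          (1# + y i) * ev₀ (q i) * ev₀ Q      ≈⟨ *-congʳ (1+y-ev₀q i) ⟩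
          1# * ev₀ Q                          ≈⟨ *-identityˡ _ ⟩
          ev₀ Q                               ∎

        t-T : ∀ i f → t * T i f ≈ (t + y i * (1# + y i)) * f - y i * ((1# + y i) * ev₀ f)
        t-T i f = begin
          t * (f + x i * Δ f)
            ≈⟨ distribˡ t _ _ ⟩
          t * f + t * (x i * Δ f)
            ≈⟨ +-congˡ (txΔ i f) ⟩
          t * f + y i * (1# + y i) * (f - ev₀ f)
            ≈⟨ solve 4 (λ t h y e → t :* h :+ y :* (:1 :+ y) :* (h :- e) := (t :+ y :* (:1 :+ y)) :* h :- y :* ((:1 :+ y) :* e)) refl t f (y i) (ev₀ f) ⟩
          (t + y i * (1# + y i)) * f - y i * ((1# + y i) * ev₀ f) ∎

        -- In terms of the conjugate root c̄ = 1/t - c one has 1 + x/z = (1 + y c)(1 + y c̄);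
        -- T-qQ and T-cqQ are this identity applied to Q/(1 + y c) and to c Q/(1 + y c).
        T-qQ : ∀ i Q → T i (q i * Q) ≈ (Q - y i * (c * Q)) + y i * (W * Δ Q)
        T-qQ i Q = t-cancel (begin
          t * T i h
            ≈⟨ t-T i h ⟩
          (t + y i * (1# + y i)) * h - y i * ((1# + y i) * ev₀ h)
            ≈⟨ +-congˡ (-‿cong (*-congˡ (1+y-ev₀qQ i Q))) ⟩
          (t + y i * (1# + y i)) * h - y i * ev₀ Q
            -- With `Q` replaced by `(1 + y c) h` both sides are polynomials in `h`; they differ by
            -- `y^2 h` times the quadratic relation for `c`.
            ≈⟨ solve 5 (λ t h y c e → (t :+ y :* (:1 :+ y)) :* h :- y :* e
                 := (t :* ((:1 :+ y :* c) :* h :- y :* (c :* ((:1 :+ y :* c) :* h))) :+ y :* ((:1 :+ y :* c) :* h :- e))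
                    :+ y :* y :* h :* ((:1 :+ t :* (c :* c)) :- c)) refl t h (y i) c (ev₀ Q) ⟩
          (t * ((1# + y i * c) * h - y i * (c * ((1# + y i * c) * h))) + y i * ((1# + y i * c) * h - ev₀ Q))
            + y i * y i * h * ((1# + t * (c * c)) - c)
            ≈⟨ vanish _ _ (sym cq) ⟩
          t * ((1# + y i * c) * h - y i * (c * ((1# + y i * c) * h))) + y i * ((1# + y i * c) * h - ev₀ Q)
            ≈⟨ +-cong (*-congˡ (+-cong (sym (absorb i Q)) (-‿cong (*-congˡ (*-congˡ (sym (absorb i Q)))))))
                      (*-congˡ (trans (+-congʳ (sym (absorb i Q))) (sym (tWΔ Q)))) ⟩
          t * (Q - y i * (c * Q)) + y i * (t * (W * Δ Q))
            ≈⟨ solve 4 (λ t a y b → t :* a :+ y :* (t :* b) := t :* (a :+ y :* b)) refl _ _ _ _ ⟩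
          t * ((Q - y i * (c * Q)) + y i * (W * Δ Q)) ∎)
          where h = q i * Q

        T-cqQ : ∀ i Q → T i (c * (q i * Q)) ≈ c * Q + y i * (W * Δ Q)
        T-cqQ i Q = t-cancel (begin
          t * T i (c * h)
            ≈⟨ t-T i (c * h) ⟩
          (t + y i * (1# + y i)) * (c * h) - y i * ((1# + y i) * ev₀ (c * h))
            ≈⟨ +-congˡ (-‿cong (*-congˡ (trans (*-congˡ (trans (ev₀-* c h) (trans (*-congʳ ev₀-c) (*-identityˡ _)))) (1+y-ev₀qQ i Q)))) ⟩
          (t + y i * (1# + y i)) * (c * h) - y i * ev₀ Q
            ≈⟨ solve 5 (λ t h y c e → (t :+ y :* (:1 :+ y)) :* (c :* h) :- y :* e
                 := (t :* (c :* ((:1 :+ y :* c) :* h)) :+ y :* ((:1 :+ y :* c) :* h :- e))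
                    :+ (:- y) :* h :* ((:1 :+ t :* (c :* c)) :- c)) refl t h (y i) c (ev₀ Q) ⟩
          (t * (c * ((1# + y i * c) * h)) + y i * ((1# + y i * c) * h - ev₀ Q)) + (- y i) * h * ((1# + t * (c * c)) - c)
            ≈⟨ vanish _ _ (sym cq) ⟩
          t * (c * ((1# + y i * c) * h)) + y i * ((1# + y i * c) * h - ev₀ Q)
            ≈⟨ +-cong (*-congˡ (*-congˡ (sym (absorb i Q)))) (*-congˡ (trans (+-congʳ (sym (absorb i Q))) (sym (tWΔ Q)))) ⟩
          t * (c * Q) + y i * (t * (W * Δ Q))
            ≈⟨ solve 4 (λ t a y b → t :* a :+ y :* (t :* b) := t :* (a :+ y :* b)) refl _ _ _ _ ⟩
          t * (c * Q + y i * (W * Δ Q)) ∎)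
          where h = q i * Q

        Ts-WΔ : ∀ is i f → Ts is (y i * (W * Δ f)) ≈ y i * (W * Δ (Ts is f))
        Ts-WΔ is i f = trans (Ts-const is _ (y₀ i)) (*-congˡ (trans (Ts-const is _ W₀) (*-congˡ (Ts-Δ is f))))

        -- `T-qQ` produces a term `c Q` besides `Q`, which is why the values of `Ts` at `Q` and at
        -- `c Q` have to be found by one common induction.
        Ts-qQ : ∀ is i → Ts is (T i (Q (i ∷ is))) + y i * Ts is (c * Q is)
                         ≈ Ts is (Q is) + y i * (W * Δ (Ts is (Q is)))
        Ts-qQ is i = begin
          Ts is (T i (Q (i ∷ is))) + y i * Ts is (c * Q is)
            ≈⟨ trans (Ts-+ is _ _) (+-congˡ (Ts-const is _ (y₀ i))) ⟨
          Ts is (T i (Q (i ∷ is)) + y i * (c * Q is))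
            ≈⟨ Ts-cong is (+-congʳ (T-qQ i (Q is))) ⟩
          Ts is (((Q is - y i * (c * Q is)) + y i * (W * Δ (Q is))) + y i * (c * Q is))
            ≈⟨ Ts-cong is (solve 3 (λ q a b → ((q :- a) :+ b) :+ a := q :+ b) refl _ _ _) ⟩
          Ts is (Q is + y i * (W * Δ (Q is)))
            ≈⟨ trans (Ts-+ is _ _) (+-congˡ (Ts-WΔ is i (Q is))) ⟩
          Ts is (Q is) + y i * (W * Δ (Ts is (Q is))) ∎

        mutual
          -- Origin of the 2: `Ts is` multiplies by `P(c) P(c̄)` and deletes negative powers of `z`,
          -- so `1 / P(c)` is sent to what remains of `P(c̄)`. As `c + c̄` and `c c̄` both equal
          -- `1 / t`, the symmetric expression `P(c) + P(c̄)` is a polynomial in `1 / t`, and its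
          -- constant term is 2. The induction reaches the same result without Laurent series.
          Ts-Q : ∀ is → Ts is (Q is) + P c is ≈ 1# + 1#
          Ts-Q [] = refl
          Ts-Q (i ∷ is) = t-cancel (begin
            t * (B′ + (1# + y i * c) * P c is)
              -- `y_i t A` is added and subtracted, because `Ts-qQ` evaluates `B′` only together
              -- with `y_i A`.
              ≈⟨ solve 6 (λ t b p y a c → t :* (b :+ (:1 :+ y :* c) :* p) := t :* (b :+ y :* a) :+ (t :* ((:1 :+ y :* c) :* p) :- y :* (t :* a)))
                   refl t B′ (P c is) (y i) A c ⟩
            t * (B′ + y i * A) + (t * ((1# + y i * c) * P c is) - y i * (t * A))
              ≈⟨ +-congʳ (*-congˡ (Ts-qQ is i)) ⟩
            t * (B + y i * (W * Δ B)) + (t * ((1# + y i * c) * P c is) - y i * (t * A))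
              ≈⟨ solve 7 (λ t b d p y a c → t :* (b :+ y :* d) :+ (t :* ((:1 :+ y :* c) :* p) :- y :* a)
                    := t :* (b :+ p) :+ y :* (t :* d) :+ t :* (y :* c :* p) :- y :* a)
                   refl t B (W * Δ B) (P c is) (y i) (t * A) c ⟩
            t * (B + P c is) + y i * (t * (W * Δ B)) + t * (y i * c * P c is) - y i * (t * A)
              ≈⟨ +-cong (+-congʳ (+-cong (*-congˡ (Ts-Q is)) (*-congˡ (tWΔ-Ts-Q is)))) (-‿cong (*-congˡ (tTs-cQ is))) ⟩
            t * (1# + 1#) + y i * (P 1# is - P c is) + t * (y i * c * P c is) - y i * (P 1# is - P c is * (1# - t * c))
              ≈⟨ solve 5 (λ t y p₁ p c → t :* (:1 :+ :1) :+ y :* (p₁ :- p) :+ t :* (y :* c :* p) :- y :* (p₁ :- p :* (:1 :- t :* c))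
                    := t :* (:1 :+ :1)) refl t (y i) (P 1# is) (P c is) c ⟩
            t * (1# + 1#) ∎)
            where
            A = Ts is (c * Q is)
            B = Ts is (Q is)
            B′ = Ts is (T i (Q (i ∷ is)))

          -- The constant 2 of `Ts-Q` disappears in the difference `B - ev₀ B`, and `P(c)` takes the
          -- value `P(1)` at `z = 0`.
          tWΔ-Ts-Q : ∀ is → t * (W * Δ (Ts is (Q is))) ≈ P 1# is - P c is
          tWΔ-Ts-Q is = begin
            t * (W * Δ B)
              ≈⟨ tWΔ B ⟩
            B - ev₀ B
              ≈⟨ solve 4 (λ b e p p₁ → b :- e := ((b :+ p) :- (e :+ p₁)) :+ (p₁ :- p)) refl B (ev₀ B) (P c is) (P 1# is) ⟩
            ((B + P c is) - (ev₀ B + P 1# is)) + (P 1# is - P c is)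
              ≈⟨ +-congʳ (+-cong (Ts-Q is) (-‿cong ev₀B)) ⟩
            ((1# + 1#) - (1# + 1#)) + (P 1# is - P c is)
              ≈⟨ solve 2 (λ a b → (a :- a) :+ b := b) refl _ _ ⟩
            P 1# is - P c is ∎
            where
            B = Ts is (Q is)
            ev₀B : ev₀ B + P 1# is ≈ 1# + 1#
            ev₀B = begin
              ev₀ B + P 1# is          ≈⟨ +-congˡ (sym (ev₀-P is)) ⟩
              ev₀ B + ev₀ (P c is)     ≈⟨ ev₀-+ _ _ ⟨
              ev₀ (B + P c is)         ≈⟨ ev₀-cong (Ts-Q is) ⟩
              ev₀ (1# + 1#)            ≈⟨ trans (ev₀-+ _ _) (+-cong ev₀-1 ev₀-1) ⟩
              1# + 1#                  ∎

          -- Here `c P(c̄) + c̄ P(c)` is a polynomial in `1 / t` without constant term, so the power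
          -- series part of `c P(c̄)` is minus that of `(1 / t - c) P(c)`. The factor `1 - t c`
          -- stands for `1 / c`.
          tTs-cQ : ∀ is → t * Ts is (c * Q is) ≈ P 1# is - P c is * (1# - t * c)
          tTs-cQ [] = begin
            t * (c * 1#)                     ≈⟨ solve 2 (λ t c → t :* (c :* :1) := :1 :- :1 :* (:1 :- t :* c)) refl t c ⟩
            1# - 1# * (1# - t * c)           ∎
          tTs-cQ (i ∷ is) = begin
            t * Ts is (T i (c * (q i * Q is)))
              ≈⟨ *-congˡ (trans (Ts-cong is (T-cqQ i (Q is))) (trans (Ts-+ is _ _) (+-congˡ (Ts-WΔ is i (Q is))))) ⟩
            t * (Ts is (c * Q is) + y i * (W * Δ (Ts is (Q is))))
              ≈⟨ solve 4 (λ t a y b → t :* (a :+ y :* b) := t :* a :+ y :* (t :* b)) refl _ _ _ _ ⟩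
            t * Ts is (c * Q is) + y i * (t * (W * Δ (Ts is (Q is))))
              ≈⟨ +-cong (tTs-cQ is) (*-congˡ (tWΔ-Ts-Q is)) ⟩
            (P 1# is - P c is * (1# - t * c)) + y i * (P 1# is - P c is)
              ≈⟨ solve 5 (λ t y p₁ p c → (p₁ :- p :* (:1 :- t :* c)) :+ y :* (p₁ :- p)
                    := ((:1 :+ y :* :1) :* p₁ :- ((:1 :+ y :* c) :* p) :* (:1 :- t :* c)) :+ (:- y :* p) :* ((:1 :+ t :* (c :* c)) :- c))
                   refl t (y i) (P 1# is) (P c is) c ⟩
            ((1# + y i * 1#) * P 1# is - ((1# + y i * c) * P c is) * (1# - t * c)) + (- y i * P c is) * ((1# + t * (c * c)) - c)
              ≈⟨ vanish _ _ (sym cq) ⟩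
            (1# + y i * 1#) * P 1# is - ((1# + y i * c) * P c is) * (1# - t * c) ∎

        module Verify (is : List I) (E : Carrier) (E₀ : Constant E) (E≈P : E ≈ P 1# is) (V≈EE : V ≈ E * E) where

          G* F* : Carrier
          G* = (c * E) * Q is
          F* = Ts is G*

          G*-product : G* * P c is ≈ c * E
          G*-product = begin
            (c * E) * Q is * P c is         ≈⟨ solve 3 (λ a q p → a :* q :* p := a :* (p :* q)) refl _ _ _ ⟩
            (c * E) * (P c is * Q is)       ≈⟨ *-congˡ (PQ is) ⟩
            (c * E) * 1#                    ≈⟨ *-identityʳ _ ⟩
            c * E                           ∎

          tF* : t * F* ≈ E * (E - P c is * (1# - t * c))
          tF* = begin
            t * Ts is ((c * E) * Q is)      ≈⟨ *-congˡ (Ts-cong is (solve 3 (λ c e q → (c :* e) :* q := e :* (c :* q)) refl _ _ _)) ⟩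
            t * Ts is (E * (c * Q is))      ≈⟨ *-congˡ (Ts-const is _ E₀) ⟩
            t * (E * Ts is (c * Q is))      ≈⟨ solve 3 (λ t e a → t :* (e :* a) := e :* (t :* a)) refl _ _ _ ⟩
            E * (t * Ts is (c * Q is))      ≈⟨ *-congˡ (tTs-cQ is) ⟩
            E * (P 1# is - P c is * (1# - t * c))  ≈⟨ *-congˡ (+-congʳ (sym E≈P)) ⟩
            E * (E - P c is * (1# - t * c))  ∎

          tcF* : t * c * F* ≈ E * (c * E - P c is)
          tcF* = begin
            t * c * F*
              ≈⟨ solve 3 (λ t c f → t :* c :* f := c :* (t :* f)) refl _ _ _ ⟩
            c * (t * F*)
              ≈⟨ *-congˡ tF* ⟩
            c * (E * (E - P c is * (1# - t * c)))
              ≈⟨ solve 4 (λ c e p t → c :* (e :* (e :- p :* (:1 :- t :* c)))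
                   := e :* (c :* e :- p) :+ (e :* p) :* ((:1 :+ t :* (c :* c)) :- c)) refl c E (P c is) t ⟩
            E * (c * E - P c is) + (E * P c is) * ((1# + t * (c * c)) - c)
              ≈⟨ vanish _ _ (sym cq) ⟩
            E * (c * E - P c is) ∎

          -- Because `t = z V` and `V = E^2`, the formula `tcF*` makes `z F* G*` equal to
          -- `(c E - P(c)) / P(c)`, and `c E / P(c)` is `G*`.
          functional-equation : G* ≈ 1# + z * (F* * G*)
          functional-equation = begin
            G*
              ≈⟨ solve 1 (λ g → g := :1 :+ (g :- :1)) refl G* ⟩
            1# + (G* - 1#)
              ≈⟨ +-congˡ (sym zFG) ⟩
            1# + z * (F* * G*) ∎
            where
            zFG : z * (F* * G*) ≈ G* - 1#
            zFG = begin
              z * (F* * ((c * E) * Q is))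
                ≈⟨ *-identityˡ _ ⟨
              1# * (z * (F* * ((c * E) * Q is)))
                ≈⟨ *-congʳ (trans (*-comm W V) VW) ⟨
              (W * V) * (z * (F* * ((c * E) * Q is)))
                ≈⟨ solve 7 (λ w v z f c e q → (w :* v) :* (z :* (f :* ((c :* e) :* q))) := w :* e :* (((z :* v) :* c :* f) :* q))
                     refl W V z F* c E (Q is) ⟩
              W * E * ((t * c * F*) * Q is)
                ≈⟨ *-congˡ (*-congʳ tcF*) ⟩
              W * E * ((E * (c * E - P c is)) * Q is)
                ≈⟨ solve 5 (λ w e c p q → w :* e :* ((e :* (c :* e :- p)) :* q) := (w :* (e :* e)) :* ((c :* e) :* q :- p :* q))
                     refl W E c (P c is) (Q is) ⟩
              (W * (E * E)) * (G* - P c is * Q is)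
                ≈⟨ *-cong (trans (*-congˡ (sym V≈EE)) (trans (*-comm W V) VW)) (+-congˡ (-‿cong (PQ is))) ⟩
              1# * (G* - 1#)
                ≈⟨ *-identityˡ _ ⟩
              G* - 1# ∎

open import Defs
open import Level using (0ℓ)
open import Data.Bool using (Bool; true; false; if_then_else_; _∧_; _∨_; not)
open import Data.Bool.ListAction using (all)
open import Data.Bool.Properties using (T-≡; ∧-zeroʳ)
open import Data.Nat using (ℕ; _+_; _*_; _∸_; _⊔_; _≤_; _<_; z≤n; s≤s; _≡ᵇ_; _≤ᵇ_; _<ᵇ_)
open import Data.Nat.Induction using (<-rec)
open import Data.Nat.ListAction using (sum)
import Data.Nat.ListAction.Properties as SumP
open import Data.Integer using () renaming (_+_ to _+ℤ_; _*_ to _*ℤ_)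
import Algebra.Properties.CommutativeSemigroup ℕP.+-commutativeSemigroup as ℕ+
import Algebra.Properties.CommutativeSemigroup ℤP.+-commutativeSemigroup as ℤ+
import Algebra.Properties.CommutativeSemigroup ℤP.*-commutativeSemigroup as ℤ*
open import Data.Fin as Fin using (Fin; zero; suc; toℕ)
import Data.Fin.Properties as FinP
open import Data.List using (_++_; _ʳ++_; concat; concatMap; length; map; take; drop; upTo; applyUpTo; allFin)
import Data.List.Properties as LP
open import Data.List.Membership.Propositional using (_∈_; _∉_; find)
open import Data.List.Membership.Propositional.Properties using (∈-++⁻; ∈-++⁺ˡ; ∈-++⁺ʳ; ∈-map⁻; ∈-map⁺; ∈-concatMap⁺; ∈-concatMap⁻; ∈-filter⁺; ∈-filter⁻; ∈-upTo⁺; ∈-upTo⁻)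
open import Data.List.Membership.Propositional.Properties.WithK using (unique∧set⇒bag)
open import Data.List.Relation.Binary.BagAndSetEquality using (∼bag⇒↭)
open import Data.List.Relation.Binary.Permutation.Propositional as Perm using (_↭_)
open import Data.List.Relation.Binary.Sublist.Propositional using (_⊆_; []; _∷_; _∷ʳ_; from∈; to∈; ⊆-trans; ⊆-refl)
import Data.List.Relation.Binary.Sublist.Propositional.Properties as SP
open import Data.List.Relation.Unary.All as All using (All; []; _∷_)
import Data.List.Relation.Unary.All.Properties as AllP
open import Data.List.Relation.Unary.AllPairs using ([]; _∷_)
open import Data.List.Relation.Unary.Any as Any using (Any; here; there; toSum)
open import Data.List.Relation.Unary.Unique.Propositional using (Unique)
import Data.List.Relation.Unary.Unique.Propositional.Properties as UP
open import Data.Maybe as Maybe using (maybe)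
open import Data.Vec as V using (Vec; []; _∷_; replicate; tabulate; lookup)
import Data.Vec.Properties as VP
open import Data.Product using (_×_; _,_; proj₁; proj₂; ∃-syntax)
open import Data.Sum using (_⊎_; inj₁; inj₂; [_,_]′; map₂)
open import Data.Empty using (⊥; ⊥-elim)
open import Data.Unit using (⊤; tt)
open import Function using (_∘_; id; case_of_)
open import Function.Bundles using (Equivalence; mk⇔)
open import Relation.Nullary using (Dec; does)
open import Relation.Binary.PropositionalEquality using (_≢_; refl; sym; trans; cong; cong₂; subst; module ≡-Reasoning)

-- Convolution over finitely many splittings

Sum : {A : Set} → List A → (A → ℤ) → ℤ
Sum xs f = sumℤ (L.map f xs)

Sum-cong : ∀ {A : Set} (xs : List A) {f g : A → ℤ} → (∀ x → f x ≡ g x) → Sum xs f ≡ Sum xs g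
Sum-cong xs f≗g = cong sumℤ (LP.map-cong f≗g xs)

Sum-cong-∈ : ∀ {A : Set} (xs : List A) {f g : A → ℤ} → (∀ {x} → x ∈ xs → f x ≡ g x) → Sum xs f ≡ Sum xs g
Sum-cong-∈ [] eq = refl
Sum-cong-∈ (x ∷ xs) eq = cong₂ _+ℤ_ (eq (here refl)) (Sum-cong-∈ xs (eq ∘ there))

Sum-0 : ∀ {A : Set} (xs : List A) → Sum xs (λ _ → + 0) ≡ + 0
Sum-0 [] = refl
Sum-0 (x ∷ xs) = trans (ℤP.+-identityˡ _) (Sum-0 xs)

Sum-zero : ∀ {A : Set} (xs : List A) {f : A → ℤ} → (∀ {x} → x ∈ xs → f x ≡ + 0) → Sum xs f ≡ + 0
Sum-zero xs eq = trans (Sum-cong-∈ xs eq) (Sum-0 xs)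

Sum-+ : ∀ {A : Set} (xs : List A) (f g : A → ℤ) → Sum xs (λ x → f x +ℤ g x) ≡ Sum xs f +ℤ Sum xs g
Sum-+ [] f g = refl
Sum-+ (x ∷ xs) f g = trans (cong ((f x +ℤ g x) +ℤ_) (Sum-+ xs f g)) (ℤ+.interchange (f x) (g x) _ _)

Sum-*ˡ : ∀ {A : Set} (xs : List A) k (f : A → ℤ) → Sum xs (λ x → k *ℤ f x) ≡ k *ℤ Sum xs f
Sum-*ˡ [] k f = sym (ℤP.*-zeroʳ k)
Sum-*ˡ (x ∷ xs) k f = trans (cong (k *ℤ f x +ℤ_) (Sum-*ˡ xs k f)) (sym (ℤP.*-distribˡ-+ k (f x) _))

Sum-*ʳ : ∀ {A : Set} (xs : List A) k (f : A → ℤ) → Sum xs (λ x → f x *ℤ k) ≡ Sum xs f *ℤ k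
Sum-*ʳ xs k f = trans (Sum-cong xs (λ x → ℤP.*-comm (f x) k)) (trans (Sum-*ˡ xs k f) (ℤP.*-comm k _))

Sum-++ : ∀ {A : Set} (xs ys : List A) (f : A → ℤ) → Sum (xs ++ ys) f ≡ Sum xs f +ℤ Sum ys f
Sum-++ [] ys f = sym (ℤP.+-identityˡ _)
Sum-++ (x ∷ xs) ys f = trans (cong (f x +ℤ_) (Sum-++ xs ys f)) (sym (ℤP.+-assoc (f x) _ _))

Sum-map : ∀ {A B : Set} (xs : List A) (g : A → B) (f : B → ℤ) → Sum (L.map g xs) f ≡ Sum xs (f ∘ g)
Sum-map xs g f = cong sumℤ (sym (LP.map-∘ xs))

Sum-concatMap : ∀ {A B : Set} (xs : List A) (g : A → List B) (f : B → ℤ) →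
                Sum (concatMap g xs) f ≡ Sum xs (λ x → Sum (g x) f)
Sum-concatMap [] g f = refl
Sum-concatMap (x ∷ xs) g f = trans (Sum-++ (g x) _ f) (cong (Sum (g x) f +ℤ_) (Sum-concatMap xs g f))

Sum-comm : ∀ {A B : Set} (xs : List A) (ys : List B) (f : A → B → ℤ) →
           Sum xs (λ x → Sum ys (f x)) ≡ Sum ys (λ y → Sum xs (λ x → f x y))
Sum-comm [] ys f = sym (Sum-0 ys)
Sum-comm (x ∷ xs) ys f = trans (cong (Sum ys (f x) +ℤ_) (Sum-comm xs ys f)) (sym (Sum-+ ys (f x) _))

[_] : Bool → ℤ
[ b ] = if b then + 1 else + 0

[]-∧ : ∀ b c → [ b ∧ c ] ≡ [ b ] *ℤ [ c ]
[]-∧ true c = sym (ℤP.*-identityˡ _)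
[]-∧ false c = refl

conv : {M : Set} → (M → List (M × M)) → M → (M → M → ℤ) → ℤ
conv splits m h = Sum (splits m) (λ pq → h (proj₁ pq) (proj₂ pq))

-- The laws speak of an arbitrary function `h` of the parts and not only of products of
-- coefficients: for exponents with two coordinates the inner convolution is such an `h`, so the
-- laws pass from ℕ to vectors and monomials along the nested lists of splittings.
record IsSplit {M : Set} (splits : M → List (M × M)) (δ : M → M → ℤ)
               (ε : M) (_⊕_ : M → M → M) (deg : M → ℕ) : Set where
  field
    splits-deg : ∀ m {p q} → (p , q) ∈ splits m → deg p ℕ.+ deg q ≡ deg m
    ε-deg      : deg ε ≡ 0
    deg-ε      : ∀ {m} → deg m ≡ 0 → m ≡ ε
    δ-refl     : ∀ m → δ m m ≡ + 1
    δ-≢        : ∀ {a m} → a ≢ m → δ a m ≡ + 0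
    conv-swap  : ∀ m (h : M → M → ℤ) → conv splits m (λ p q → h q p) ≡ conv splits m h
    conv-assoc : ∀ m (h : M → M → M → ℤ) → conv splits m (λ s r → conv splits s (λ p q → h p q r))
                       ≡ conv splits m (λ p s → conv splits s (λ q r → h p q r))
    conv-δ     : ∀ m (h : M → M → ℤ) → conv splits m (λ p q → δ ε p *ℤ h p q) ≡ h ε m
    conv-δδ    : ∀ a b m → conv splits m (λ p q → δ a p *ℤ δ b q) ≡ δ (a ⊕ b) m

δℕ : ℕ → ℕ → ℤ
δℕ a m = [ a ≡ᵇ m ]

module Naturals where

  convℕ : ℕ → (ℕ → ℕ → ℤ) → ℤ
  convℕ = conv splitsℕ

  convℕ-upTo : ∀ n (h : ℕ → ℕ → ℤ) → convℕ n h ≡ sumℤ (applyUpTo (λ i → h i (n ℕ.∸ i)) (suc n))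
  convℕ-upTo n h = cong sumℤ (trans (sym (LP.map-∘ {g = λ pq → h (proj₁ pq) (proj₂ pq)} {f = λ i → i , n ℕ.∸ i} (upTo (suc n))))
    (LP.map-applyUpTo id (λ i → h i (n ℕ.∸ i)) (suc n)))

  convℕ-suc : ∀ n (h : ℕ → ℕ → ℤ) → convℕ (suc n) h ≡ h 0 (suc n) +ℤ convℕ n (λ i j → h (suc i) j)
  convℕ-suc n h = trans (convℕ-upTo (suc n) h) (cong (h 0 (suc n) +ℤ_) (sym (convℕ-upTo n (λ i j → h (suc i) j))))

  convℕ-cong : ∀ n {h h′ : ℕ → ℕ → ℤ} → (∀ i j → h i j ≡ h′ i j) → convℕ n h ≡ convℕ n h′
  convℕ-cong n eq = Sum-cong (splitsℕ n) (λ _ → eq _ _)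

  convℕ-suc-last : ∀ n (h : ℕ → ℕ → ℤ) → convℕ (suc n) h ≡ h (suc n) 0 +ℤ convℕ n (λ i j → h i (suc j))
  convℕ-suc-last zero h = ℤ+.x∙yz≈y∙xz (h 0 1) (h 1 0) (+ 0)
  convℕ-suc-last (suc n) h = begin
    convℕ (suc (suc n)) h
      ≡⟨ convℕ-suc (suc n) h ⟩
    h 0 (suc (suc n)) +ℤ convℕ (suc n) (λ i j → h (suc i) j)
      ≡⟨ cong (h 0 (suc (suc n)) +ℤ_) (convℕ-suc-last n (λ i j → h (suc i) j)) ⟩
    h 0 (suc (suc n)) +ℤ (h (suc (suc n)) 0 +ℤ convℕ n (λ i j → h (suc i) (suc j)))
      ≡⟨ ℤ+.x∙yz≈y∙xz (h 0 (suc (suc n))) (h (suc (suc n)) 0) _ ⟩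
    h (suc (suc n)) 0 +ℤ (h 0 (suc (suc n)) +ℤ convℕ n (λ i j → h (suc i) (suc j)))
      ≡⟨ cong (h (suc (suc n)) 0 +ℤ_) (convℕ-suc n (λ i j → h i (suc j))) ⟨
    h (suc (suc n)) 0 +ℤ convℕ (suc n) (λ i j → h i (suc j)) ∎
    where
    open ≡-Reasoning

  swapℕ : ∀ n (h : ℕ → ℕ → ℤ) → convℕ n (λ p q → h q p) ≡ convℕ n h
  swapℕ zero h = refl
  swapℕ (suc n) h = begin
    convℕ (suc n) (λ p q → h q p)                       ≡⟨ convℕ-suc n (λ p q → h q p) ⟩
    h (suc n) 0 +ℤ convℕ n (λ p q → h q (suc p))       ≡⟨ cong (h (suc n) 0 +ℤ_) (swapℕ n (λ p q → h p (suc q))) ⟩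
    h (suc n) 0 +ℤ convℕ n (λ p q → h p (suc q))       ≡⟨ convℕ-suc-last n h ⟨
    convℕ (suc n) h                                     ∎
    where open ≡-Reasoning

  assocℕ : ∀ n (h : ℕ → ℕ → ℕ → ℤ) → convℕ n (λ s r → convℕ s (λ p q → h p q r))
                                    ≡ convℕ n (λ p s → convℕ s (λ q r → h p q r))
  assocℕ zero h = refl
  assocℕ (suc n) h = begin
    convℕ (suc n) (λ s r → convℕ s (λ p q → h p q r))
      ≡⟨ convℕ-suc n (λ s r → convℕ s (λ p q → h p q r)) ⟩
    (h 0 0 (suc n) +ℤ + 0) +ℤ convℕ n (λ s r → convℕ (suc s) (λ p q → h p q r))
      ≡⟨ cong₂ _+ℤ_ (ℤP.+-identityʳ (h 0 0 (suc n))) (convℕ-cong n (λ s r → convℕ-suc s (λ p q → h p q r))) ⟩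
    h 0 0 (suc n) +ℤ convℕ n (λ s r → h 0 (suc s) r +ℤ convℕ s (λ p q → h (suc p) q r))
      ≡⟨ cong (h 0 0 (suc n) +ℤ_) (Sum-+ (splitsℕ n) (λ p → h 0 (suc (proj₁ p)) (proj₂ p)) (λ p → convℕ (proj₁ p) (λ i j → h (suc i) j (proj₂ p)))) ⟩
    h 0 0 (suc n) +ℤ (convℕ n (λ s r → h 0 (suc s) r) +ℤ convℕ n (λ s r → convℕ s (λ p q → h (suc p) q r)))
      ≡⟨ ℤP.+-assoc (h 0 0 (suc n)) _ _ ⟨
    h 0 0 (suc n) +ℤ convℕ n (λ s r → h 0 (suc s) r) +ℤ convℕ n (λ s r → convℕ s (λ p q → h (suc p) q r))
      ≡⟨ cong₂ _+ℤ_ (sym (convℕ-suc n (λ q r → h 0 q r))) (assocℕ n (λ p q r → h (suc p) q r)) ⟩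
    convℕ (suc n) (λ q r → h 0 q r) +ℤ convℕ n (λ p s → convℕ s (λ q r → h (suc p) q r))
      ≡⟨ convℕ-suc n (λ p s → convℕ s (λ q r → h p q r)) ⟨
    convℕ (suc n) (λ p s → convℕ s (λ q r → h p q r)) ∎
    where open ≡-Reasoning

  δ-leftℕ : ∀ n (h : ℕ → ℕ → ℤ) → convℕ n (λ p q → δℕ 0 p *ℤ h p q) ≡ h 0 n
  δ-leftℕ zero h = trans (ℤP.+-identityʳ (+ 1 *ℤ h 0 0)) (ℤP.*-identityˡ (h 0 0))
  δ-leftℕ (suc n) h = begin
    convℕ (suc n) (λ p q → δℕ 0 p *ℤ h p q)         ≡⟨ convℕ-suc n (λ p q → δℕ 0 p *ℤ h p q) ⟩
    + 1 *ℤ h 0 (suc n) +ℤ convℕ n (λ _ _ → + 0)     ≡⟨ cong₂ _+ℤ_ (ℤP.*-identityˡ (h 0 (suc n))) (Sum-0 (splitsℕ n)) ⟩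
    h 0 (suc n) +ℤ + 0                              ≡⟨ ℤP.+-identityʳ _ ⟩
    h 0 (suc n)                                     ∎
    where open ≡-Reasoning

  δδℕ : ∀ a b n → convℕ n (λ p q → δℕ a p *ℤ δℕ b q) ≡ δℕ (a ℕ.+ b) n
  δδℕ zero b n = δ-leftℕ n (λ _ → δℕ b)
  δδℕ (suc a) b zero = refl
  δδℕ (suc a) b (suc n) = trans (convℕ-suc n (λ p q → δℕ (suc a) p *ℤ δℕ b q)) (trans (ℤP.+-identityˡ _) (δδℕ a b n))

  δ-reflℕ : ∀ m → δℕ m m ≡ + 1
  δ-reflℕ zero = refl
  δ-reflℕ (suc m) = δ-reflℕ m

  δ-≢ℕ : ∀ a m → a ≢ m → δℕ a m ≡ + 0
  δ-≢ℕ zero zero ne = ⊥-elim (ne refl)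
  δ-≢ℕ zero (suc m) ne = refl
  δ-≢ℕ (suc a) zero ne = refl
  δ-≢ℕ (suc a) (suc m) ne = δ-≢ℕ a m (ne ∘ cong suc)

  splitsℕ-sum : ∀ n {p q} → (p , q) ∈ splitsℕ n → p ℕ.+ q ≡ n
  splitsℕ-sum n pq∈ with ∈-map⁻ _ pq∈
  ... | i , i∈ , refl = ℕP.m+[n∸m]≡n (ℕP.≤-pred (∈-upTo⁻ i∈))

  isSplit : IsSplit splitsℕ δℕ 0 ℕ._+_ id
  isSplit = record
    { splits-deg = splitsℕ-sum
    ; ε-deg = refl
    ; deg-ε = id
    ; δ-refl = δ-reflℕ
    ; δ-≢ = δ-≢ℕ _ _
    ; conv-swap = swapℕ
    ; conv-assoc = assocℕ
    ; conv-δ = δ-leftℕ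
    ; conv-δδ = δδℕ
    }

-- The pairing is abstract because it is `_∷_` for vectors and `_,_` for monomials.
module Product
  {M N K : Set}
  {splits₁ : M → List (M × M)} {δ₁ : M → M → ℤ} {ε₁ : M} {_⊕₁_ : M → M → M} {deg₁ : M → ℕ}
  {splits₂ : N → List (N × N)} {δ₂ : N → N → ℤ} {ε₂ : N} {_⊕₂_ : N → N → N} {deg₂ : N → ℕ}
  (isSplit₁ : IsSplit splits₁ δ₁ ε₁ _⊕₁_ deg₁) (isSplit₂ : IsSplit splits₂ δ₂ ε₂ _⊕₂_ deg₂)
  (pair : M → N → K) (splits : K → List (K × K))
  (splits-pair : ∀ a b → splits (pair a b) ≡
    concatMap (λ p → L.map (λ q → pair (proj₁ p) (proj₁ q) , pair (proj₂ p) (proj₂ q)) (splits₂ b)) (splits₁ a))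
  where

  private
    module ₁ = IsSplit isSplit₁
    module ₂ = IsSplit isSplit₂

  conv-pair : ∀ a b (h : K → K → ℤ) → conv splits (pair a b) h ≡
    conv splits₁ a (λ a₁ a₂ → conv splits₂ b (λ b₁ b₂ → h (pair a₁ b₁) (pair a₂ b₂)))
  conv-pair a b h rewrite splits-pair a b =
    trans (Sum-concatMap (splits₁ a) _ _) (Sum-cong (splits₁ a) (λ p → Sum-map (splits₂ b) _ _))

  cong₂-conv : ∀ a b {h h′ : M → M → N → N → ℤ} → (∀ a₁ a₂ b₁ b₂ → h a₁ a₂ b₁ b₂ ≡ h′ a₁ a₂ b₁ b₂) →
    conv splits₁ a (λ a₁ a₂ → conv splits₂ b (h a₁ a₂)) ≡ conv splits₁ a (λ a₁ a₂ → conv splits₂ b (h′ a₁ a₂))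
  cong₂-conv a b eq = Sum-cong (splits₁ a) (λ _ → Sum-cong (splits₂ b) (λ _ → eq _ _ _ _))

  pair-swap : ∀ a b (h : K → K → ℤ) → conv splits (pair a b) (λ p q → h q p) ≡ conv splits (pair a b) h
  pair-swap a b h = begin
    conv splits (pair a b) (λ p q → h q p)
      ≡⟨ conv-pair a b _ ⟩
    conv splits₁ a (λ a₁ a₂ → conv splits₂ b (λ b₁ b₂ → h (pair a₂ b₂) (pair a₁ b₁)))
      ≡⟨ ₁.conv-swap a _ ⟩
    conv splits₁ a (λ a₁ a₂ → conv splits₂ b (λ b₁ b₂ → h (pair a₁ b₂) (pair a₂ b₁)))
      ≡⟨ Sum-cong (splits₁ a) (λ p → ₂.conv-swap b (λ b₁ b₂ → h (pair (proj₁ p) b₁) (pair (proj₂ p) b₂))) ⟩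
    conv splits₁ a (λ a₁ a₂ → conv splits₂ b (λ b₁ b₂ → h (pair a₁ b₁) (pair a₂ b₂)))
      ≡⟨ conv-pair a b h ⟨
    conv splits (pair a b) h ∎
    where open ≡-Reasoning

  conv-comm : ∀ a b (h : M → M → N → N → ℤ) →
    conv splits₂ b (λ b₁ b₂ → conv splits₁ a (λ a₁ a₂ → h a₁ a₂ b₁ b₂)) ≡
    conv splits₁ a (λ a₁ a₂ → conv splits₂ b (λ b₁ b₂ → h a₁ a₂ b₁ b₂))
  conv-comm a b h = Sum-comm (splits₂ b) (splits₁ a) _

  pair-assoc : ∀ a b (h : K → K → K → ℤ) →
    conv splits (pair a b) (λ s r → conv splits s (λ p q → h p q r)) ≡
    conv splits (pair a b) (λ p s → conv splits s (λ q r → h p q r))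
  pair-assoc a b h = begin
    conv splits (pair a b) (λ s r → conv splits s (λ p q → h p q r))
      ≡⟨ conv-pair a b _ ⟩
    conv splits₁ a (λ s r → conv splits₂ b (λ s′ r′ → conv splits (pair s s′) (λ p q → h p q (pair r r′))))
      ≡⟨ cong₂-conv a b (λ s r s′ r′ → conv-pair s s′ _) ⟩
    conv splits₁ a (λ s r → conv splits₂ b (λ s′ r′ →
      conv splits₁ s (λ p q → conv splits₂ s′ (λ p′ q′ → h (pair p p′) (pair q q′) (pair r r′)))))
      ≡⟨ Sum-cong (splits₁ a) (λ p → conv-comm (proj₁ p) b _) ⟩
    conv splits₁ a (λ s r → conv splits₁ s (λ p q →
      conv splits₂ b (λ s′ r′ → conv splits₂ s′ (λ p′ q′ → h (pair p p′) (pair q q′) (pair r r′)))))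
      ≡⟨ ₁.conv-assoc a _ ⟩
    conv splits₁ a (λ p s → conv splits₁ s (λ q r →
      conv splits₂ b (λ s′ r′ → conv splits₂ s′ (λ p′ q′ → h (pair p p′) (pair q q′) (pair r r′)))))
      ≡⟨ Sum-cong (splits₁ a) (λ (p , s) → Sum-cong (splits₁ s) (λ (q , r) →
           ₂.conv-assoc b (λ p′ q′ r′ → h (pair p p′) (pair q q′) (pair r r′)))) ⟩
    conv splits₁ a (λ p s → conv splits₁ s (λ q r →
      conv splits₂ b (λ p′ s′ → conv splits₂ s′ (λ q′ r′ → h (pair p p′) (pair q q′) (pair r r′)))))
      ≡⟨ Sum-cong (splits₁ a) (λ p → conv-comm (proj₂ p) b _) ⟨
    conv splits₁ a (λ p s → conv splits₂ b (λ p′ s′ →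
      conv splits₁ s (λ q r → conv splits₂ s′ (λ q′ r′ → h (pair p p′) (pair q q′) (pair r r′)))))
      ≡⟨ cong₂-conv a b (λ p s p′ s′ → conv-pair s s′ _) ⟨
    conv splits₁ a (λ p s → conv splits₂ b (λ p′ s′ → conv splits (pair s s′) (λ q r → h (pair p p′) q r)))
      ≡⟨ conv-pair a b _ ⟨
    conv splits (pair a b) (λ p s → conv splits s (λ q r → h p q r)) ∎
    where open ≡-Reasoning

  module _ (δ : K → K → ℤ) (δ-pair : ∀ a b a′ b′ → δ (pair a b) (pair a′ b′) ≡ δ₁ a a′ *ℤ δ₂ b b′) where

    pair-δ : ∀ a b (h : K → K → ℤ) → conv splits (pair a b) (λ p q → δ (pair ε₁ ε₂) p *ℤ h p q) ≡ h (pair ε₁ ε₂) (pair a b)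
    pair-δ a b h = begin
      conv splits (pair a b) (λ p q → δ (pair ε₁ ε₂) p *ℤ h p q)
        ≡⟨ conv-pair a b _ ⟩
      conv splits₁ a (λ a₁ a₂ → conv splits₂ b (λ b₁ b₂ → δ (pair ε₁ ε₂) (pair a₁ b₁) *ℤ h (pair a₁ b₁) (pair a₂ b₂)))
        ≡⟨ cong₂-conv a b (λ a₁ a₂ b₁ b₂ → trans (cong (ℤ._* h (pair a₁ b₁) (pair a₂ b₂)) (δ-pair ε₁ ε₂ a₁ b₁))
                                                  (ℤP.*-assoc (δ₁ ε₁ a₁) (δ₂ ε₂ b₁) _)) ⟩
      conv splits₁ a (λ a₁ a₂ → conv splits₂ b (λ b₁ b₂ → δ₁ ε₁ a₁ *ℤ (δ₂ ε₂ b₁ *ℤ h (pair a₁ b₁) (pair a₂ b₂))))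
        ≡⟨ Sum-cong (splits₁ a) (λ p → Sum-*ˡ (splits₂ b) (δ₁ ε₁ (proj₁ p)) _) ⟩
      conv splits₁ a (λ a₁ a₂ → δ₁ ε₁ a₁ *ℤ conv splits₂ b (λ b₁ b₂ → δ₂ ε₂ b₁ *ℤ h (pair a₁ b₁) (pair a₂ b₂)))
        ≡⟨ ₁.conv-δ a _ ⟩
      conv splits₂ b (λ b₁ b₂ → δ₂ ε₂ b₁ *ℤ h (pair ε₁ b₁) (pair a b₂))
        ≡⟨ ₂.conv-δ b _ ⟩
      h (pair ε₁ ε₂) (pair a b) ∎
      where open ≡-Reasoning

    pair-δδ : ∀ a a′ b b′ m m′ → conv splits (pair m m′) (λ p q → δ (pair a a′) p *ℤ δ (pair b b′) q)
                                  ≡ δ (pair (a ⊕₁ b) (a′ ⊕₂ b′)) (pair m m′)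
    pair-δδ a a′ b b′ m m′ = begin
      conv splits (pair m m′) (λ p q → δ (pair a a′) p *ℤ δ (pair b b′) q)
        ≡⟨ conv-pair m m′ _ ⟩
      conv splits₁ m (λ p q → conv splits₂ m′ (λ p′ q′ → δ (pair a a′) (pair p p′) *ℤ δ (pair b b′) (pair q q′)))
        ≡⟨ cong₂-conv m m′ (λ p q p′ q′ → trans (cong₂ _*ℤ_ (δ-pair a a′ p p′) (δ-pair b b′ q q′))
                                                 (ℤ*.interchange (δ₁ a p) (δ₂ a′ p′) (δ₁ b q) (δ₂ b′ q′))) ⟩
      conv splits₁ m (λ p q → conv splits₂ m′ (λ p′ q′ → (δ₁ a p *ℤ δ₁ b q) *ℤ (δ₂ a′ p′ *ℤ δ₂ b′ q′)))
        ≡⟨ Sum-cong (splits₁ m) (λ (p , q) → Sum-*ˡ (splits₂ m′) (δ₁ a p *ℤ δ₁ b q) _) ⟩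
      conv splits₁ m (λ p q → (δ₁ a p *ℤ δ₁ b q) *ℤ conv splits₂ m′ (λ p′ q′ → δ₂ a′ p′ *ℤ δ₂ b′ q′))
        ≡⟨ Sum-*ʳ (splits₁ m) (conv splits₂ m′ (λ p′ q′ → δ₂ a′ p′ *ℤ δ₂ b′ q′)) _ ⟩
      conv splits₁ m (λ p q → δ₁ a p *ℤ δ₁ b q) *ℤ conv splits₂ m′ (λ p′ q′ → δ₂ a′ p′ *ℤ δ₂ b′ q′)
        ≡⟨ cong₂ _*ℤ_ (₁.conv-δδ a b m) (₂.conv-δδ a′ b′ m′) ⟩
      δ₁ (a ⊕₁ b) m *ℤ δ₂ (a′ ⊕₂ b′) m′
        ≡⟨ δ-pair _ _ m m′ ⟨
      δ (pair (a ⊕₁ b) (a′ ⊕₂ b′)) (pair m m′) ∎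
      where
      open ≡-Reasoning

    pair-δ-refl : ∀ a b → δ (pair a b) (pair a b) ≡ + 1
    pair-δ-refl a b = trans (δ-pair a b a b) (cong₂ _*ℤ_ (₁.δ-refl a) (₂.δ-refl b))

  pair-deg : ∀ (deg : K → ℕ) → (∀ a b → deg (pair a b) ≡ deg₁ a ℕ.+ deg₂ b) →
             ∀ a b {p q} → (p , q) ∈ splits (pair a b) → deg p ℕ.+ deg q ≡ deg (pair a b)
  pair-deg deg deg-pair a b pq∈ rewrite splits-pair a b with ∈-concatMap⁻ _ {xs = splits₁ a} pq∈
  ... | any = go (splits₁ a) (₁.splits-deg a) any
    where
    go : ∀ xs → (∀ {p q} → (p , q) ∈ xs → deg₁ p ℕ.+ deg₁ q ≡ deg₁ a) → ∀ {p q} →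
         Any (λ x → (p , q) ∈ L.map (λ y → pair (proj₁ x) (proj₁ y) , pair (proj₂ x) (proj₂ y)) (splits₂ b)) xs →
         deg p ℕ.+ deg q ≡ deg (pair a b)
    go (x ∷ xs) hyp (there any) = go xs (hyp ∘ there) any
    go ((a₁ , a₂) ∷ xs) hyp (here pq∈) with ∈-map⁻ _ pq∈
    ... | (b₁ , b₂) , b∈ , refl = begin
      deg (pair a₁ b₁) ℕ.+ deg (pair a₂ b₂)                ≡⟨ cong₂ ℕ._+_ (deg-pair a₁ b₁) (deg-pair a₂ b₂) ⟩
      (deg₁ a₁ ℕ.+ deg₂ b₁) ℕ.+ (deg₁ a₂ ℕ.+ deg₂ b₂)      ≡⟨ ℕ+.interchange (deg₁ a₁) _ _ _ ⟩
      (deg₁ a₁ ℕ.+ deg₁ a₂) ℕ.+ (deg₂ b₁ ℕ.+ deg₂ b₂)      ≡⟨ cong₂ ℕ._+_ (hyp (here refl)) (₂.splits-deg b b∈) ⟩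
      deg₁ a ℕ.+ deg₂ b                                    ≡⟨ deg-pair a b ⟨
      deg (pair a b)                                       ∎
      where
      open ≡-Reasoning

δV : ∀ {n} → Vec ℕ n → Vec ℕ n → ℤ
δV a b = [ does (VP.≡-dec ℕ._≟_ a b) ]

_⊕_ : ∀ {n} → Vec ℕ n → Vec ℕ n → Vec ℕ n
_⊕_ = V.zipWith ℕ._+_

δV-≢ : ∀ {n} {a b : Vec ℕ n} → a ≢ b → δV a b ≡ + 0
δV-≢ {a = a} {b} ne with VP.≡-dec ℕ._≟_ a b
... | yes eq = ⊥-elim (ne eq)
... | no _ = refl

vecIsSplit : ∀ n → IsSplit {Vec ℕ n} splitsV δV (replicate n 0) _⊕_ V.sum
vecIsSplit zero = record
  { splits-deg = λ { [] (here refl) → refl }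
  ; ε-deg = refl
  ; deg-ε = λ { {[]} _ → refl }
  ; δ-refl = λ { [] → refl }
  ; δ-≢ = δV-≢
  ; conv-swap = λ { [] h → refl }
  ; conv-assoc = λ { [] h → refl }
  ; conv-δ = λ { [] h → trans (ℤP.+-identityʳ _) (ℤP.*-identityˡ _) }
  ; conv-δδ = λ { [] [] [] → refl }
  }
vecIsSplit (suc n) = record
  { splits-deg = λ { (e ∷ es) → P.pair-deg V.sum (λ _ _ → refl) e es }
  ; ε-deg = IsSplit.ε-deg (vecIsSplit n)
  ; deg-ε = λ { {e ∷ es} eq → cong₂ _∷_ (ℕP.m+n≡0⇒m≡0 e eq) (IsSplit.deg-ε (vecIsSplit n) (ℕP.m+n≡0⇒n≡0 e eq)) }
  ; δ-refl = λ { (e ∷ es) → P.pair-δ-refl δV δ-∷ e es }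
  ; δ-≢ = δV-≢
  ; conv-swap = λ { (e ∷ es) → P.pair-swap e es }
  ; conv-assoc = λ { (e ∷ es) → P.pair-assoc e es }
  ; conv-δ = λ { (e ∷ es) → P.pair-δ δV δ-∷ e es }
  ; conv-δδ = λ { (a ∷ as) (b ∷ bs) (e ∷ es) → P.pair-δδ δV δ-∷ a as b bs e es }
  }
  where
  module P = Product Naturals.isSplit (vecIsSplit n) _∷_ splitsV (λ _ _ → refl)
  δ-∷ : ∀ a as b bs → δV (a ∷ as) (b ∷ bs) ≡ δℕ a b *ℤ δV as bs
  δ-∷ a as b bs = []-∧ (a ≡ᵇ b) _

_⊕M_ : ∀ {r} → Mono r → Mono r → Mono r
(k , a) ⊕M (l , b) = k ℕ.+ l , a ⊕ b

degM : ∀ {r} → Mono r → ℕ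
degM (k , a) = k ℕ.+ V.sum a

δM-pair : ∀ {r} k (a : Vec ℕ (suc r)) l b → monoS (k , a) (l , b) ≡ δℕ k l *ℤ δV a b
δM-pair k a l b = []-∧ (k ≡ᵇ l) _

module MonoProduct r = Product Naturals.isSplit (vecIsSplit (suc r)) _,_ (splitsM {r}) (λ _ _ → refl)

monoIsSplit : ∀ r → IsSplit {Mono r} splitsM monoS (0 , replicate (suc r) 0) _⊕M_ degM
monoIsSplit r = record
  { splits-deg = λ (k , a) → P.pair-deg degM (λ _ _ → refl) k a
  ; ε-deg = IsSplit.ε-deg (vecIsSplit (suc r))
  ; deg-ε = λ { {k , a} eq → cong₂ _,_ (ℕP.m+n≡0⇒m≡0 k eq) (IsSplit.deg-ε (vecIsSplit (suc r)) (ℕP.m+n≡0⇒n≡0 k eq)) }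
  ; δ-refl = λ (k , a) → P.pair-δ-refl monoS δM-pair k a
  ; δ-≢ = λ { {k , a} {l , b} ne → δ-≢ k a l b ne }
  ; conv-swap = λ (k , a) h → P.pair-swap k a h
  ; conv-assoc = λ (k , a) h → P.pair-assoc k a h
  ; conv-δ = λ (k , a) h → P.pair-δ monoS δM-pair k a h
  ; conv-δδ = λ (k , a) (l , b) (m , c) → P.pair-δδ monoS δM-pair k a l b m c
  }
  where
  module P = MonoProduct r
  δ-≢ : ∀ k a l b → (k , a) ≢ (l , b) → monoS (k , a) (l , b) ≡ + 0
  δ-≢ k a l b ne = trans (δM-pair k a l b) (by (k ℕ.≟ l) (VP.≡-dec ℕ._≟_ a b))
    where
    by : Dec (k ≡ l) → Dec (a ≡ b) → δℕ k l *ℤ δV a b ≡ + 0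
    by (yes refl) (yes refl) = ⊥-elim (ne refl)
    by (no k≢l) _ = cong (_*ℤ δV a b) (Naturals.δ-≢ℕ k l k≢l)
    by (yes _) (no a≢b) = trans (cong (δℕ k l *ℤ_) (δV-≢ a≢b)) (ℤP.*-zeroʳ (δℕ k l))

-- Power series rings, congruence modulo high degree

module Convolution
  {M : Set} {splits : M → List (M × M)} {δ : M → M → ℤ} {ε : M} {_⊕_ : M → M → M} {deg : M → ℕ}
  (isSplit : IsSplit splits δ ε _⊕_ deg) where

  open IsSplit isSplit

  infix 4 _≋_ _≋[_]_
  infixl 6 _⊞_
  infixl 7 _⊛_

  -- A record does not unfold as the bare function type would, so the two series stay visible to
  -- unification.
  record _≋_ (f g : M → ℤ) : Set where
    constructor mk
    field at : ∀ m → f m ≡ g m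
  open _≋_ public

  _⊞_ _⊛_ : (M → ℤ) → (M → ℤ) → M → ℤ
  (f ⊞ g) m = f m +ℤ g m
  (f ⊛ g) m = conv splits m (λ p q → f p *ℤ g q)

  ⊟_ : (M → ℤ) → M → ℤ
  (⊟ f) m = ℤ.- f m

  conv-cong : ∀ m {h h′ : M → M → ℤ} → (∀ p q → deg p ℕ.+ deg q ≡ deg m → h p q ≡ h′ p q) →
              conv splits m h ≡ conv splits m h′
  conv-cong m eq = Sum-cong-∈ (splits m) (λ pq∈ → eq _ _ (splits-deg m pq∈))

  ⊛-cong : ∀ {f f′ g g′} → f ≋ f′ → g ≋ g′ → f ⊛ g ≋ f′ ⊛ g′
  ⊛-cong f≋ g≋ = mk λ m → conv-cong m (λ p q _ → cong₂ _*ℤ_ (at f≋ p) (at g≋ q))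

  ⊛-comm : ∀ f g → f ⊛ g ≋ g ⊛ f
  ⊛-comm f g = mk λ m → trans (conv-cong m (λ p q _ → ℤP.*-comm (f p) (g q)))
                              (conv-swap m (λ p q → g p *ℤ f q))

  ⊛-assoc : ∀ f g h → (f ⊛ g) ⊛ h ≋ f ⊛ (g ⊛ h)
  ⊛-assoc f g h = mk λ m → begin
    conv splits m (λ s r → conv splits s (λ p q → f p *ℤ g q) *ℤ h r)
      ≡⟨ conv-cong m (λ s r _ → Sum-*ʳ (splits s) (h r) (λ pq → f (proj₁ pq) *ℤ g (proj₂ pq))) ⟨
    conv splits m (λ s r → conv splits s (λ p q → (f p *ℤ g q) *ℤ h r))
      ≡⟨ conv-assoc m (λ p q r → (f p *ℤ g q) *ℤ h r) ⟩
    conv splits m (λ p s → conv splits s (λ q r → (f p *ℤ g q) *ℤ h r))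
      ≡⟨ conv-cong m (λ p s _ → conv-cong s (λ q r _ → ℤP.*-assoc (f p) (g q) (h r))) ⟩
    conv splits m (λ p s → conv splits s (λ q r → f p *ℤ (g q *ℤ h r)))
      ≡⟨ conv-cong m (λ p s _ → Sum-*ˡ (splits s) (f p) (λ qr → g (proj₁ qr) *ℤ h (proj₂ qr))) ⟩
    conv splits m (λ p s → f p *ℤ conv splits s (λ q r → g q *ℤ h r)) ∎
    where open ≡-Reasoning

  ⊛-identityˡ : ∀ f → δ ε ⊛ f ≋ f
  ⊛-identityˡ f = mk λ m → conv-δ-right m
    where
    conv-δ-right : ∀ m → conv splits m (λ p q → δ ε p *ℤ f q) ≡ f m
    conv-δ-right m = conv-δ m (λ _ → f)

  ⊛-distribˡ : ∀ f g h → f ⊛ (g ⊞ h) ≋ (f ⊛ g) ⊞ (f ⊛ h)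
  ⊛-distribˡ f g h = mk λ m → trans
    (conv-cong m (λ p q _ → ℤP.*-distribˡ-+ (f p) (g q) (h q)))
    (Sum-+ (splits m) (λ pq → f (proj₁ pq) *ℤ g (proj₂ pq)) (λ pq → f (proj₁ pq) *ℤ h (proj₂ pq)))

  ≋-refl : ∀ {f} → f ≋ f
  ≋-refl = mk λ _ → refl

  ≋-sym : ∀ {f g} → f ≋ g → g ≋ f
  ≋-sym e = mk (sym ∘ at e)

  ≋-trans : ∀ {f g h} → f ≋ g → g ≋ h → f ≋ h
  ≋-trans e e′ = mk λ m → trans (at e m) (at e′ m)

  ring : CommutativeRing 0ℓ 0ℓ
  ring = record
    { Carrier = M → ℤ ; _≈_ = _≋_ ; _+_ = _⊞_ ; _*_ = _⊛_ ; -_ = ⊟_ ; 0# = λ _ → + 0 ; 1# = δ ε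
    ; isCommutativeRing = record
      { isRing = record
        { +-isAbelianGroup = record
          { isGroup = record
            { isMonoid = record
              { isSemigroup = record
                { isMagma = record
                  { isEquivalence = record { refl = ≋-refl ; sym = ≋-sym ; trans = ≋-trans }
                  ; ∙-cong = λ e e′ → mk λ m → cong₂ _+ℤ_ (at e m) (at e′ m) }
                ; assoc = λ f g h → mk λ m → ℤP.+-assoc (f m) (g m) (h m) }
              ; identity = (λ f → mk λ m → ℤP.+-identityˡ (f m)) , (λ f → mk λ m → ℤP.+-identityʳ (f m)) }
            ; inverse = (λ f → mk λ m → ℤP.+-inverseˡ (f m)) , (λ f → mk λ m → ℤP.+-inverseʳ (f m))
            ; ⁻¹-cong = λ e → mk λ m → cong ℤ.-_ (at e m) }
          ; comm = λ f g → mk λ m → ℤP.+-comm (f m) (g m) }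
        ; *-cong = ⊛-cong
        ; *-assoc = ⊛-assoc
        ; *-identity = ⊛-identityˡ , (λ f → ≋-trans (⊛-comm f (δ ε)) (⊛-identityˡ f))
        ; distrib = ⊛-distribˡ , (λ f g h → ≋-trans (⊛-comm (g ⊞ h) f) (≋-trans (⊛-distribˡ f g h)
            (mk λ m → cong₂ _+ℤ_ (at (⊛-comm f g) m) (at (⊛-comm f h) m)))) }
      ; *-comm = ⊛-comm } }

  δ-⊛-δ : ∀ a b → δ a ⊛ δ b ≋ δ (a ⊕ b)
  δ-⊛-δ a b = mk (conv-δδ a b)

  record _≋[_]_ (f : M → ℤ) (d : ℕ) (g : M → ℤ) : Set where
    constructor mkUpTo
    field agree : ∀ m → deg m < d → f m ≡ g m
  open _≋[_]_ public

  ≋⇒≋[] : ∀ {f g d} → f ≋ g → f ≋[ d ] g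
  ≋⇒≋[] e = mkUpTo λ m _ → at e m

  ≋[]⇒≋ : ∀ {f g} → (∀ d → f ≋[ d ] g) → f ≋ g
  ≋[]⇒≋ e = mk λ m → agree (e (suc (deg m))) m ℕP.≤-refl

  ≋[]-zero : ∀ {f g} → f ≋[ 0 ] g
  ≋[]-zero = mkUpTo λ _ ()

  ≋[]-refl : ∀ {f d} → f ≋[ d ] f
  ≋[]-refl = mkUpTo λ _ _ → refl

  ≋[]-sym : ∀ {f g d} → f ≋[ d ] g → g ≋[ d ] f
  ≋[]-sym e = mkUpTo λ m l → sym (agree e m l)

  ≋[]-trans : ∀ {f g h d} → f ≋[ d ] g → g ≋[ d ] h → f ≋[ d ] h
  ≋[]-trans e e′ = mkUpTo λ m l → trans (agree e m l) (agree e′ m l)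

  ≋[]-weaken : ∀ {f g d d′} → d′ ≤ d → f ≋[ d ] g → f ≋[ d′ ] g
  ≋[]-weaken d′≤d e = mkUpTo λ m l → agree e m (ℕP.<-≤-trans l d′≤d)

  ⊞-[] : ∀ {f f′ g g′ d} → f ≋[ d ] f′ → g ≋[ d ] g′ → f ⊞ g ≋[ d ] f′ ⊞ g′
  ⊞-[] e e′ = mkUpTo λ m l → cong₂ _+ℤ_ (agree e m l) (agree e′ m l)

  ⊟-[] : ∀ {f g d} → f ≋[ d ] g → ⊟ f ≋[ d ] ⊟ g
  ⊟-[] e = mkUpTo λ m l → cong ℤ.-_ (agree e m l)

  ⊛-[] : ∀ {f f′ g g′ d} → f ≋[ d ] f′ → g ≋[ d ] g′ → f ⊛ g ≋[ d ] f′ ⊛ g′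
  ⊛-[] e e′ = mkUpTo λ m l → conv-cong m λ p q eq → cong₂ _*ℤ_
    (agree e p (ℕP.≤-<-trans (ℕP.≤-trans (ℕP.m≤m+n (deg p) (deg q)) (ℕP.≤-reflexive eq)) l))
    (agree e′ q (ℕP.≤-<-trans (ℕP.≤-trans (ℕP.m≤n+m (deg q) (deg p)) (ℕP.≤-reflexive eq)) l))

  -- In each summand either `p` is `ε`, where `k` vanishes, or `q` has degree below that of `m`.
  -- Multiplication by a series without constant term is thus a contraction; inverses, the
  -- independence of `y` from `z` and the uniqueness of `G` all rest on this.
  ⊛-gain : ∀ {k f g d} → k ε ≡ + 0 → f ≋[ d ] g → k ⊛ f ≋[ suc d ] k ⊛ g
  ⊛-gain {k} {f} {g} {d} kε e = mkUpTo λ m l → conv-cong m (term m l)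
    where
    term : ∀ m → deg m < suc d → ∀ p q → deg p ℕ.+ deg q ≡ deg m → k p *ℤ f q ≡ k p *ℤ g q
    term m l p q eq with deg p in eqp
    ... | zero rewrite deg-ε {p} eqp | kε = refl
    ... | suc n = cong (k p *ℤ_) (agree e q (ℕP.≤-trans
            (ℕP.≤-trans (s≤s (ℕP.m≤n+m (deg q) n)) (ℕP.≤-reflexive eq)) (ℕP.≤-pred l)))

  ⊛-at-ε : ∀ f g → (f ⊛ g) ε ≡ f ε *ℤ g ε
  ⊛-at-ε f g = trans (conv-cong ε term) (conv-δ ε (λ p q → f p *ℤ g q))
    where
    term : ∀ p q → deg p ℕ.+ deg q ≡ deg ε → f p *ℤ g q ≡ δ ε p *ℤ (f p *ℤ g q)
    term p q eq rewrite deg-ε {p} (ℕP.m+n≡0⇒m≡0 (deg p) (trans eq ε-deg)) | δ-refl ε =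
      sym (ℤP.*-identityˡ (f ε *ℤ g q))

  module Inverse (f : M → ℤ) (fε : f ε ≡ + 1) where
    open CommutativeRing ring using (+-cong)

    remainder : M → ℤ
    remainder = δ ε ⊞ (⊟ f)

    remainder-ε : remainder ε ≡ + 0
    remainder-ε = cong₂ _+ℤ_ (δ-refl ε) (cong ℤ.-_ fε)

    -- These are the partial sums of the geometric series in `remainder`, whose sum inverts
    -- `f = 1 - remainder`.
    iterate : ℕ → M → ℤ
    iterate zero = λ _ → + 0
    iterate (suc n) = δ ε ⊞ remainder ⊛ iterate n

    iterate-suc : ∀ n → iterate n ≋[ n ] iterate (suc n)
    iterate-suc zero = ≋[]-zero
    iterate-suc (suc n) = ⊞-[] {δ ε} ≋[]-refl (⊛-gain {remainder} remainder-ε (iterate-suc n))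

    iterate-+ : ∀ n k → iterate n ≋[ n ] iterate (k ℕ.+ n)
    iterate-+ n zero = ≋[]-refl
    iterate-+ n (suc k) = ≋[]-trans (iterate-+ n k) (≋[]-weaken (ℕP.m≤n+m n k) (iterate-suc (k ℕ.+ n)))

    inverse : M → ℤ
    -- `iterate n` is final in degrees strictly below `n`, so degree `deg m` needs `suc (deg m)`
    -- iterations.
    inverse m = iterate (suc (deg m)) m

    inverse-iterate : ∀ d → inverse ≋[ d ] iterate d
    inverse-iterate d = mkUpTo λ m l → trans
      (agree (iterate-+ (suc (deg m)) (d ℕ.∸ suc (deg m))) m ℕP.≤-refl)
      (cong (λ n → iterate n m) (ℕP.m∸n+n≡m l))

    inverse-fixed : inverse ≋ δ ε ⊞ remainder ⊛ inverse
    inverse-fixed = ≋[]⇒≋ λ d → ≋[]-trans (≋[]-weaken (ℕP.n≤1+n d) (inverse-iterate (suc d)))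
      (⊞-[] {δ ε} ≋[]-refl (⊛-[] {remainder} ≋[]-refl (≋[]-sym (inverse-iterate d))))

    inverse-correct : f ⊛ inverse ≋ δ ε
    inverse-correct = begin
      f ⊛ inverse
        ≈⟨ solve 2 (λ f h → f :* h := :1 :- ((:1 :+ (:1 :- f) :* h) :- h)) ≋-refl f inverse ⟩
      δ ε ⊞ (⊟ ((δ ε ⊞ remainder ⊛ inverse) ⊞ (⊟ inverse)))
        ≈⟨ +-cong {δ ε} ≋-refl (-‿cong (+-cong (≋-sym inverse-fixed) ≋-refl)) ⟩
      δ ε ⊞ (⊟ (inverse ⊞ (⊟ inverse)))
        ≈⟨ solve 1 (λ h → :1 :- (h :- h) := :1) ≋-refl inverse ⟩
      δ ε ∎
      where
      open IntegerSolver ring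
      open CommutativeRing ring using (-‿cong; setoid)
      open import Relation.Binary.Reasoning.Setoid setoid

-- The series ring of Defs and the operator G ↦ F

Sum-filterᵇ : ∀ {A : Set} (p : A → Bool) (xs : List A) (f : A → ℤ) →
              Sum (L.filterᵇ p xs) f ≡ Sum xs (λ x → [ p x ] *ℤ f x)
Sum-filterᵇ p [] f = refl
Sum-filterᵇ p (x ∷ xs) f with p x
... | true  = cong₂ _+ℤ_ (sym (ℤP.*-identityˡ (f x))) (Sum-filterᵇ p xs f)
... | false = trans (Sum-filterᵇ p xs f) (sym (ℤP.+-identityˡ _))

Sum-δℕ : ∀ n c (f : ℕ → ℤ) → c < n → Sum (upTo n) (λ j → δℕ c j *ℤ f j) ≡ f c
Sum-δℕ n c f c<n = trans (cong sumℤ (LP.map-applyUpTo id (λ j → δℕ c j *ℤ f j) n)) (go n c f c<n)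
  where
  zeros : ∀ n → sumℤ (applyUpTo (λ _ → + 0) n) ≡ + 0
  zeros zero = refl
  zeros (suc n) = trans (ℤP.+-identityˡ _) (zeros n)
  go : ∀ n c (f : ℕ → ℤ) → c < n → sumℤ (applyUpTo (λ j → δℕ c j *ℤ f j) n) ≡ f c
  go (suc n) zero f _ = trans (cong₂ _+ℤ_ (ℤP.*-identityˡ (f 0)) (zeros n)) (ℤP.+-identityʳ (f 0))
  go (suc n) (suc c) f (s≤s c<n) = trans (ℤP.+-identityˡ _) (go n c (f ∘ suc) c<n)

countTrue≤ : ∀ {m} (S : Vec Bool m) → countTrue S ≤ m
countTrue≤ [] = z≤n
countTrue≤ (true ∷ S) = s≤s (countTrue≤ S)
countTrue≤ (false ∷ S) = ℕP.m≤n⇒m≤1+n (countTrue≤ S)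

indicator : ∀ {m} → Vec Bool m → Vec ℕ m
indicator = V.map (λ b → if b then 1 else 0)

unit : ∀ {m} → Fin m → Vec ℕ m
unit j = tabulate (λ i → if does (i Fin.≟ j) then 1 else 0)

lookup-unit : ∀ {m} (j : Fin m) → lookup (unit j) j ≡ 1
lookup-unit j = trans (VP.lookup∘tabulate _ j) (by (j Fin.≟ j))
  where
  by : (d : Dec (j ≡ j)) → (if does d then 1 else 0) ≡ 1
  by (yes _) = refl
  by (no j≢j) = ⊥-elim (j≢j refl)

lookup-unit-≢ : ∀ {m} {i j : Fin m} → i ≢ j → lookup (unit j) i ≡ 0
lookup-unit-≢ {i = i} {j} i≢j = trans (VP.lookup∘tabulate _ i) (by (i Fin.≟ j))
  where
  by : (d : Dec (i ≡ j)) → (if does d then 1 else 0) ≡ 0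
  by (yes eq) = ⊥-elim (i≢j eq)
  by (no _) = refl

unitIf : ∀ {n} → Bool → Fin n → Vec ℕ n
unitIf {n} b j = if b then unit j else replicate n 0

-- The exponent of the product of the `x_(f k)` over all `k` selected by `S`. The map `f` is a
-- parameter because recursion on the vector replaces it by `f ∘ suc`.
unitSum : ∀ {n m} → (Fin m → Fin n) → Vec Bool m → Vec ℕ n
unitSum f [] = replicate _ 0
unitSum f (b ∷ S) = unitIf b (f zero) ⊕ unitSum (f ∘ suc) S

lookup-unitIf : ∀ {n} b (j : Fin n) → lookup (unitIf b j) j ≡ (if b then 1 else 0)
lookup-unitIf true j = lookup-unit j
lookup-unitIf false j = VP.lookup-replicate j 0

lookup-unitIf-≢ : ∀ {n} b {i j : Fin n} → i ≢ j → lookup (unitIf b j) i ≡ 0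
lookup-unitIf-≢ true i≢j = lookup-unit-≢ i≢j
lookup-unitIf-≢ false {i} i≢j = VP.lookup-replicate i 0

lookup-unitSum-∷ : ∀ {n m} (f : Fin (suc m) → Fin n) b S i →
  lookup (unitSum f (b ∷ S)) i ≡ lookup (unitIf b (f zero)) i ℕ.+ lookup (unitSum (f ∘ suc) S) i
lookup-unitSum-∷ f b S i = VP.lookup-zipWith ℕ._+_ i (unitIf b (f zero)) (unitSum (f ∘ suc) S)

lookup-unitSum-∉ : ∀ {n m} (f : Fin m → Fin n) S i → (∀ k → i ≢ f k) → lookup (unitSum f S) i ≡ 0
lookup-unitSum-∉ f [] i i∉ = VP.lookup-replicate i 0
lookup-unitSum-∉ f (b ∷ S) i i∉ = trans (lookup-unitSum-∷ f b S i)
  (cong₂ ℕ._+_ (lookup-unitIf-≢ b (i∉ zero)) (lookup-unitSum-∉ (f ∘ suc) S i (i∉ ∘ suc)))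

lookup-unitSum : ∀ {n m} (f : Fin m → Fin n) → (∀ {k l} → f k ≡ f l → k ≡ l) → ∀ S k →
                 lookup (unitSum f S) (f k) ≡ (if lookup S k then 1 else 0)
lookup-unitSum f inj (b ∷ S) zero = trans (lookup-unitSum-∷ f b S (f zero)) (trans
  (cong₂ ℕ._+_ (lookup-unitIf b (f zero))
    (lookup-unitSum-∉ (f ∘ suc) S (f zero) (λ k eq → FinP.0≢1+n (inj eq))))
  (ℕP.+-identityʳ _))
lookup-unitSum f inj (b ∷ S) (suc k) = trans (lookup-unitSum-∷ f b S (f (suc k)))
  (cong₂ ℕ._+_ (lookup-unitIf-≢ b (λ eq → FinP.0≢1+n (sym (inj eq))))
    (lookup-unitSum (f ∘ suc) (FinP.suc-injective ∘ inj) S k))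

unitSum-id : ∀ {m} (S : Vec Bool m) → unitSum id S ≡ indicator S
unitSum-id S = trans (sym (VP.tabulate∘lookup _)) (trans (VP.tabulate-cong (λ i →
  trans (lookup-unitSum id id S i) (sym (VP.lookup-map i _ S)))) (VP.tabulate∘lookup _))

sumS-at : ∀ {A : Set} {r} (f : A → Series r) (xs : List A) m → sumS (L.map f xs) m ≡ Sum xs (λ x → f x m)
sumS-at f [] m = refl
sumS-at f (x ∷ xs) m = cong (f x m +ℤ_) (sumS-at f xs m)

module _ {r : ℕ} where

  open Convolution (monoIsSplit r) public
  open CommutativeRing ring using (setoid; +-cong; *-cong; *-congˡ; *-congʳ; *-assoc; -‿cong; *-identityʳ)
  open MonoProduct r using (conv-pair)
  open Naturals using (convℕ; convℕ-suc; splitsℕ-sum)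

  Δ ev₀ : Series r → Series r
  Δ f (k , a) = f (suc k , a)
  ev₀ f (zero , a) = f (zero , a)
  ev₀ f (suc k , a) = + 0

  zS-suc : ∀ f k a → (zS ⊛ f) (suc k , a) ≡ f (k , a)
  zS-suc f k a = begin
    (zS ⊛ f) (suc k , a)
      ≡⟨ conv-pair (suc k) a (λ p q → zS p *ℤ f q) ⟩
    convℕ (suc k) inner
      ≡⟨ convℕ-suc k inner ⟩
    conv splitsV a (λ _ _ → + 0) +ℤ convℕ k (λ i j → inner (suc i) j)
      ≡⟨ cong (_+ℤ convℕ k (λ i j → inner (suc i) j)) (Sum-0 (splitsV a)) ⟩
    + 0 +ℤ convℕ k (λ i j → inner (suc i) j)
      ≡⟨ ℤP.+-identityˡ (convℕ k (λ i j → inner (suc i) j)) ⟩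
    convℕ k (λ i j → inner (suc i) j)
      ≡⟨ conv-pair k a (λ p q → oneS p *ℤ f q) ⟨
    (oneS ⊛ f) (k , a)
      ≡⟨ at (⊛-identityˡ f) (k , a) ⟩
    f (k , a) ∎
    where
    open ≡-Reasoning
    inner : ℕ → ℕ → ℤ
    inner i j = conv splitsV a (λ b c → zS (i , b) *ℤ f (j , c))

  zS-zero : ∀ f a → (zS ⊛ f) (zero , a) ≡ + 0
  zS-zero f a = trans (conv-pair zero a (λ p q → zS p *ℤ f q))
    (trans (ℤP.+-identityʳ (conv splitsV a (λ _ _ → + 0))) (Sum-0 (splitsV a)))

  split-ev₀ : ∀ f → f ≋ ev₀ f ⊞ zS ⊛ Δ f
  split-ev₀ f = mk λ
    { (zero , a) → sym (trans (cong (f (zero , a) +ℤ_) (zS-zero (Δ f) a)) (ℤP.+-identityʳ _))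
    ; (suc k , a) → sym (trans (ℤP.+-identityˡ _) (zS-suc (Δ f) k a)) }

  z-cancel : ∀ {f g} → zS ⊛ f ≋ zS ⊛ g → f ≋ g
  z-cancel {f} {g} eq = mk λ (k , a) → trans (sym (zS-suc f k a)) (trans (at eq (suc k , a)) (zS-suc g k a))

  ev₀-cong : ∀ {f g} → f ≋ g → ev₀ f ≋ ev₀ g
  ev₀-cong eq = mk λ { (zero , a) → at eq (zero , a) ; (suc k , a) → refl }

  ev₀-+ : ∀ f g → ev₀ (f ⊞ g) ≋ ev₀ f ⊞ ev₀ g
  ev₀-+ f g = mk λ { (zero , a) → refl ; (suc k , a) → refl }

  ev₀-* : ∀ f g → ev₀ (f ⊛ g) ≋ ev₀ f ⊛ ev₀ g
  ev₀-* f g = mk λ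
    { (zero , a) → trans (conv-pair zero a (λ p q → f p *ℤ g q)) (sym (conv-pair zero a (λ p q → ev₀ f p *ℤ ev₀ g q)))
    ; (suc k , a) → sym (trans (conv-pair (suc k) a (λ p q → ev₀ f p *ℤ ev₀ g q))
        (Sum-zero (splitsℕ (suc k)) λ {kk} kk∈ → Sum-zero (splitsV a) λ {aa} _ →
          vanish (proj₁ kk) (proj₂ kk) (proj₁ aa) (proj₂ aa) (splitsℕ-sum (suc k) kk∈))) }
    where
    vanish : ∀ {k} i j b c → i ℕ.+ j ≡ suc k → ev₀ f (i , b) *ℤ ev₀ g (j , c) ≡ + 0
    vanish zero (suc j) b c _ = ℤP.*-zeroʳ (f (zero , b))
    vanish (suc i) j b c _ = refl

  ev₀-monoS : ∀ a → ev₀ (monoS (0 , a)) ≋ monoS (0 , a)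
  ev₀-monoS a = mk λ { (zero , b) → refl ; (suc k , b) → refl }

  ev₀-z : ev₀ zS ≋ (λ _ → + 0)
  ev₀-z = mk λ { (zero , b) → refl ; (suc k , b) → refl }

  module K = Kernel.Shift ring zS Δ ev₀ ev₀-cong ev₀-+ ev₀-* (ev₀-monoS (replicate (suc r) 0)) ev₀-z split-ev₀ z-cancel

  open K.Operators (xS {r}) (λ i → ev₀-monoS (unit i)) public

  xPower : ∀ {m} → (Fin m → Fin (suc r)) → Vec Bool m → Series r
  xPower f [] = oneS
  xPower f (b ∷ S) = (if b then xS (f zero) else oneS) ⊛ xPower (f ∘ suc) S

  xPower-monoS : ∀ {m} (f : Fin m → Fin (suc r)) S → xPower f S ≋ monoS (0 , unitSum f S)
  xPower-monoS f [] = ≋-refl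
  xPower-monoS f (b ∷ S) = ≋-trans (⊛-cong (head b) (xPower-monoS (f ∘ suc) S))
    (δ-⊛-δ (0 , unitIf b (f zero)) (0 , unitSum (f ∘ suc) S))
    where
    head : ∀ b → (if b then xS (f zero) else oneS) ≋ monoS (0 , unitIf b (f zero))
    head true = ≋-refl
    head false = ≋-refl

  subsetSum : ∀ {m} → (Fin m → Fin (suc r)) → Series r → Series r
  subsetSum {m} f G n = Sum (allBool m) (λ S → (xPower f S ⊛ shiftZ (countTrue S) G) n)

  shiftZ-suc : ∀ j G → shiftZ (suc j) G ≋ shiftZ j (Δ G)
  shiftZ-suc j G = mk λ (k , a) → cong (λ l → G (l , a)) (ℕP.+-suc k j)

  shiftZ-const : ∀ j k f → K.Constant k → shiftZ j (k ⊛ f) ≋ k ⊛ shiftZ j f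
  shiftZ-const zero k f k₀ = ≋-trans (shiftZ-zero (k ⊛ f)) (⊛-cong {k} ≋-refl (≋-sym (shiftZ-zero f)))
    where
    shiftZ-zero : ∀ f → shiftZ 0 f ≋ f
    shiftZ-zero f = mk λ (k , a) → cong (λ l → f (l , a)) (ℕP.+-identityʳ k)
  shiftZ-const (suc j) k f k₀ =
    ≋-trans (shiftZ-suc j (k ⊛ f))
    (≋-trans (shiftZ-cong (K.Δ-const f k₀))
    (≋-trans (shiftZ-const j k (Δ f) k₀) (⊛-cong {k} ≋-refl (≋-sym (shiftZ-suc j f)))))
    where
    shiftZ-cong : ∀ {f g} → f ≋ g → shiftZ j f ≋ shiftZ j g
    shiftZ-cong eq = mk λ (k , a) → at eq (k ℕ.+ j , a)

  -- This expands the product of the operators `1 + x Δ`: the first factor decides whether its index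
  -- belongs to the subset, and the monomials can be moved past `Δ` since they are free of `z`.
  Ts-subsetSum : ∀ m (f : Fin m → Fin (suc r)) G → Ts (L.tabulate f) G ≋ subsetSum f G
  Ts-subsetSum zero f G = mk λ n → sym (trans (ℤP.+-identityʳ _)
    (trans (at (⊛-identityˡ (shiftZ 0 G)) n) (cong (λ k → G (k , proj₂ n)) (ℕP.+-identityʳ _))))
  Ts-subsetSum (suc m) f G = ≋-trans (Ts-subsetSum m (f ∘ suc) (T (f zero) G)) (mk λ n → sym (begin
    Sum (concatMap (λ S → (true ∷ S) ∷ (false ∷ S) ∷ []) (allBool m)) (λ S → (xPower f S ⊛ shiftZ (countTrue S) G) n)
      ≡⟨ Sum-concatMap (allBool m) (λ S → (true ∷ S) ∷ (false ∷ S) ∷ []) (λ S → (xPower f S ⊛ shiftZ (countTrue S) G) n) ⟩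
    Sum (allBool m) (λ S → (xPower f (true ∷ S) ⊛ shiftZ (suc (countTrue S)) G) n
                           +ℤ ((xPower f (false ∷ S) ⊛ shiftZ (countTrue S) G) n +ℤ + 0))
      ≡⟨ Sum-cong (allBool m) (λ S → at (step S) n) ⟩
    Sum (allBool m) (λ S → (xPower (f ∘ suc) S ⊛ shiftZ (countTrue S) (T (f zero) G)) n) ∎))
    where
    open ≡-Reasoning
    shift-T : ∀ j → shiftZ j (T (f zero) G) ≋ shiftZ j G ⊞ xS (f zero) ⊛ shiftZ (suc j) G
    shift-T j = mk λ n → cong (shiftZ j G n +ℤ_)
      (at (≋-trans (shiftZ-const j (xS (f zero)) (Δ G) (ev₀-monoS (unit (f zero))))
                   (⊛-cong {xS (f zero)} ≋-refl (≋-sym (shiftZ-suc j G)))) n)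
    step : ∀ S → (xPower f (true ∷ S) ⊛ shiftZ (suc (countTrue S)) G) ⊞ ((oneS ⊛ xPower (f ∘ suc) S ⊛ shiftZ (countTrue S) G) ⊞ (λ _ → + 0))
                 ≋ xPower (f ∘ suc) S ⊛ shiftZ (countTrue S) (T (f zero) G)
    step S = ≋-trans
      (IS.solve 4 (λ x p a b → (x IS.:* p IS.:* a) IS.:+ ((IS.:1 IS.:* p IS.:* b) IS.:+ IS.con (+ 0)) IS.:= p IS.:* (b IS.:+ x IS.:* a))
        ≋-refl (xS (f zero)) (xPower (f ∘ suc) S) (shiftZ (suc (countTrue S)) G) (shiftZ (countTrue S) G))
      (⊛-cong {xPower (f ∘ suc) S} ≋-refl (≋-sym (shift-T (countTrue S))))
      where module IS = IntegerSolver ring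

  -- Every subset occurs in exactly one `e_j`, so the sum over `j` collapses to `j = |S|`; the range
  -- of `j` is long enough since a subset has at most `r + 1` elements.
  Fseries-at : ∀ G n → Fseries r G n ≡ Sum (allBool (suc r)) (λ S → (monoS (0 , indicator S) ⊛ shiftZ (countTrue S) G) n)
  Fseries-at G n = begin
    Fseries r G n
      ≡⟨ sumS-at (λ j → esym r j *S shiftZ j G) (upTo (suc (suc r))) n ⟩
    Sum (upTo (suc (suc r))) (λ j → (esym r j ⊛ shiftZ j G) n)
      ≡⟨ Sum-cong (upTo (suc (suc r))) (λ j → esym-⊛ j (shiftZ j G) n) ⟩
    Sum (upTo (suc (suc r))) (λ j → Sum subsets (λ S → δℕ (countTrue S) j *ℤ (mono S ⊛ shiftZ j G) n))
      ≡⟨ Sum-comm (upTo (suc (suc r))) subsets (λ j S → δℕ (countTrue S) j *ℤ (mono S ⊛ shiftZ j G) n) ⟩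
    Sum subsets (λ S → Sum (upTo (suc (suc r))) (λ j → δℕ (countTrue S) j *ℤ (mono S ⊛ shiftZ j G) n))
      ≡⟨ Sum-cong subsets (λ S → Sum-δℕ (suc (suc r)) (countTrue S) (λ j → (mono S ⊛ shiftZ j G) n) (s≤s (countTrue≤ S))) ⟩
    Sum subsets (λ S → (mono S ⊛ shiftZ (countTrue S) G) n) ∎
    where
    open ≡-Reasoning
    subsets = allBool (suc r)
    mono : Vec Bool (suc r) → Series r
    mono S = monoS (0 , indicator S)
    esym-at : ∀ j p → esym r j p ≡ Sum subsets (λ S → δℕ (countTrue S) j *ℤ mono S p)
    esym-at j p = trans (sumS-at mono (L.filterᵇ (λ S → countTrue S ≡ᵇ j) subsets) p)
      (Sum-filterᵇ (λ S → countTrue S ≡ᵇ j) subsets (λ S → mono S p))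
    esym-⊛ : ∀ j H n → (esym r j ⊛ H) n ≡ Sum subsets (λ S → δℕ (countTrue S) j *ℤ (mono S ⊛ H) n)
    esym-⊛ j H n = begin
      conv splitsM n (λ p q → esym r j p *ℤ H q)
        ≡⟨ Sum-cong (splitsM n) (λ (p , q) → trans (cong (_*ℤ H q) (esym-at j p))
             (sym (Sum-*ʳ subsets (H q) (λ S → δℕ (countTrue S) j *ℤ mono S p)))) ⟩
      conv splitsM n (λ p q → Sum subsets (λ S → δℕ (countTrue S) j *ℤ mono S p *ℤ H q))
        ≡⟨ Sum-comm (splitsM n) subsets (λ pq S → δℕ (countTrue S) j *ℤ mono S (proj₁ pq) *ℤ H (proj₂ pq)) ⟩
      Sum subsets (λ S → conv splitsM n (λ p q → δℕ (countTrue S) j *ℤ mono S p *ℤ H q))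
        ≡⟨ Sum-cong subsets (λ S → trans
             (Sum-cong (splitsM n) (λ (p , q) → ℤP.*-assoc (δℕ (countTrue S) j) (mono S p) (H q)))
             (Sum-*ˡ (splitsM n) (δℕ (countTrue S) j) (λ pq → mono S (proj₁ pq) *ℤ H (proj₂ pq)))) ⟩
      Sum subsets (λ S → δℕ (countTrue S) j *ℤ (mono S ⊛ H) n) ∎

  Fseries-subsetSum : ∀ G → Fseries r G ≋ subsetSum id G
  Fseries-subsetSum G = mk λ n → trans (Fseries-at G n)
    (Sum-cong (allBool (suc r)) (λ S → at (⊛-cong {g = shiftZ (countTrue S) G} (mono-xPower S) ≋-refl) n))
    where
    mono-xPower : ∀ S → monoS (0 , indicator S) ≋ xPower id S
    mono-xPower S = ≋-sym (≋-trans (xPower-monoS id S) (mk λ m → cong (λ a → monoS (0 , a) m) (unitSum-id S)))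

  Fseries-Ts : ∀ G → Fseries r G ≋ Ts (allFin (suc r)) G
  Fseries-Ts G = ≋-trans (Fseries-subsetSum G) (≋-sym (Ts-subsetSum (suc r) id G))

-- Uniqueness of the solution, and its expression by `y` and `c` in the ring of series

module _ {r : ℕ} where

  private
    is : List (Fin (suc r))
    is = allFin (suc r)

    ε : Mono r
    ε = 0 , replicate (suc r) 0

  ⊛-congˡ : ∀ f {g g′ : Series r} → g ≋ g′ → f ⊛ g ≋ f ⊛ g′
  ⊛-congˡ f = ⊛-cong {f = f} ≋-refl

  ⊛-congʳ : ∀ {f f′ : Series r} g → f ≋ f′ → f ⊛ g ≋ f′ ⊛ g
  ⊛-congʳ g eq = ⊛-cong {g = g} eq ≋-refl

  xS-ε : ∀ j → xS {r} j ε ≡ + 0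
  xS-ε j = IsSplit.δ-≢ (monoIsSplit r) unit≢ε
    where
    unit≢ε : (0 , unit j) ≢ ε
    unit≢ε eq with trans (sym (lookup-unit j)) (trans (cong (λ a → lookup (proj₂ a) j) eq) (VP.lookup-replicate j 0))
    ... | ()

  Δ-[] : ∀ {f g : Series r} {d} → f ≋[ suc d ] g → Δ f ≋[ d ] Δ g
  Δ-[] eq = mkUpTo λ (k , a) l → agree eq (suc k , a) (s≤s l)

  -- `Δ` loses one degree of precision, and the factor `x_j`, having no constant term, wins it back.
  T-[] : ∀ j {f g : Series r} {d} → f ≋[ d ] g → T j f ≋[ d ] T j g
  T-[] j {d = zero} _ = ≋[]-zero
  T-[] j {f} {g} {d = suc d} eq = ⊞-[] {f = f} eq (⊛-gain {k = xS j} (xS-ε j) (Δ-[] eq))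

  Ts-[] : ∀ js {f g : Series r} {d} → f ≋[ d ] g → Ts js f ≋[ d ] Ts js g
  Ts-[] [] eq = eq
  Ts-[] (j ∷ js) eq = Ts-[] js (T-[] j eq)

  functional-equation-unique : ∀ {G G′ : Series r} →
    G ≋ oneS ⊞ zS ⊛ (Ts is G ⊛ G) → G′ ≋ oneS ⊞ zS ⊛ (Ts is G′ ⊛ G′) → G ≋ G′
  functional-equation-unique {G} {G′} eq eq′ = ≋[]⇒≋ go
    where
    go : ∀ d → G ≋[ d ] G′
    go zero = ≋[]-zero
    go (suc d) = ≋[]-trans (≋⇒≋[] eq) (≋[]-trans
      (⊞-[] {f = oneS} ≋[]-refl (⊛-gain {k = zS} refl (⊛-[] {f = Ts is G} {f′ = Ts is G′} {g = G} {g′ = G′} (Ts-[] is (go d)) (go d))))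
      (≋[]-sym (≋⇒≋[] eq′)))

  private
    product : (Fin (suc r) → Series r) → List (Fin (suc r)) → Series r
    product y js = prodS (L.map (λ i → oneS +S y i) js)

  product-[] : ∀ {y y′ : Fin (suc r) → Series r} {d} js → (∀ j → y j ≋[ d ] y′ j) → product y js ≋[ d ] product y′ js
  product-[] [] eq = ≋[]-refl
  product-[] {y} {y′} (j ∷ js) eq = ⊛-[] {f = oneS ⊞ y j} {f′ = oneS ⊞ y′ j} {g = product y js} {g′ = product y′ js}
    (⊞-[] {f = oneS} ≋[]-refl (eq j)) (product-[] js eq)

  ev₀-product : ∀ (y : Fin (suc r) → Series r) js → ev₀ (product y js) ≋ product (ev₀ ∘ y) js
  ev₀-product y [] = ev₀-monoS (replicate (suc r) 0)
  ev₀-product y (j ∷ js) = ≋-trans (ev₀-* (oneS ⊞ y j) (product y js))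
    (⊛-cong {g = ev₀ (product y js)} (≋-trans (ev₀-+ oneS (y j)) (mk λ m → cong (_+ℤ ev₀ (y j) m) (at (ev₀-monoS (replicate (suc r) 0)) m)))
            (ev₀-product y js))

  1+-ε : ∀ {f : Series r} → f ε ≡ + 0 → (oneS ⊞ f) ε ≡ + 1
  1+-ε fε = cong₂ _+ℤ_ (IsSplit.δ-refl (monoIsSplit r) ε) fε

  product-ε : ∀ (y : Fin (suc r) → Series r) → (∀ j → y j ε ≡ + 0) → ∀ js → product y js ε ≡ + 1
  product-ε y yε [] = IsSplit.δ-refl (monoIsSplit r) ε
  product-ε y yε (j ∷ js) = trans (⊛-at-ε (oneS ⊞ y j) (product y js)) (cong₂ _*ℤ_ (1+-ε {f = y j} (yε j)) (product-ε y yε js))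

  module _ (y : Fin (suc r) → Series r) (yε : ∀ j → y j ε ≡ + 0)
           (y-eq : ∀ j → xS j ⊛ Ey y ⊛ Ey y ≋ y j ⊛ (oneS ⊞ y j)) where

    open IntegerSolver (ring {r}) using (solve; _:=_; _:+_; _:*_; _:-_; :1)

    private
      -- In this form each term on the right has a factor without constant term, `x_j` or `y_j`
      -- itself, so the system for `y` is contracting.
      y-fixed : ∀ (f x E : Series r) → x ⊛ E ⊛ E ≋ f ⊛ (oneS ⊞ f) → f ≋ x ⊛ (E ⊛ E) ⊞ (⊟ (f ⊛ f))
      y-fixed f x E eq = ≋-trans
        (solve 1 (λ f → f := f :* (:1 :+ f) :- f :* f) ≋-refl f)
        (mk λ m → cong (_+ℤ (⊟ (f ⊛ f)) m) (trans (sym (at eq m)) (at (⊛-assoc x E E) m)))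

    ev₀-y-eq : ∀ j → xS j ⊛ Ey (ev₀ ∘ y) ⊛ Ey (ev₀ ∘ y) ≋ ev₀ (y j) ⊛ (oneS ⊞ ev₀ (y j))
    ev₀-y-eq j = ≋-trans (≋-sym left) (≋-trans (ev₀-cong (y-eq j)) right)
      where
      left : ev₀ (xS j ⊛ Ey y ⊛ Ey y) ≋ xS j ⊛ Ey (ev₀ ∘ y) ⊛ Ey (ev₀ ∘ y)
      left = ≋-trans (ev₀-* (xS j ⊛ Ey y) (Ey y)) (⊛-cong {f = ev₀ (xS j ⊛ Ey y)} {g = ev₀ (Ey y)}
        (≋-trans (ev₀-* (xS j) (Ey y)) (⊛-cong {f = ev₀ (xS j)} {g = ev₀ (Ey y)} (ev₀-monoS (unit j)) (ev₀-product y is)))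
        (ev₀-product y is))
      right : ev₀ (y j ⊛ (oneS ⊞ y j)) ≋ ev₀ (y j) ⊛ (oneS ⊞ ev₀ (y j))
      right = ≋-trans (ev₀-* (y j) (oneS ⊞ y j)) (⊛-congˡ (ev₀ (y j)) (≋-trans (ev₀-+ oneS (y j))
        (mk λ m → cong (_+ℤ ev₀ (y j) m) (at (ev₀-monoS (replicate (suc r) 0)) m))))

    -- ev₀ ∘ y satisfies the equations that determine y.
    y-constant : ∀ j → K.Constant (y j)
    y-constant j = ≋-sym (≋[]⇒≋ (λ d → go d j))
      where
      go : ∀ d j → y j ≋[ d ] ev₀ (y j)
      go zero j = ≋[]-zero
      go (suc d) j = ≋[]-trans (≋⇒≋[] (y-fixed (y j) (xS j) (Ey y) (y-eq j))) (≋[]-trans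
        (⊞-[] {f = xS j ⊛ (Ey y ⊛ Ey y)} {g = ⊟ (y j ⊛ y j)}
          (⊛-gain {k = xS j} (xS-ε j) (⊛-[] {f = Ey y} {g = Ey y} E≋ E≋))
          -- The square is changed one factor at a time, the factor that is kept being each time one
          -- without constant term.
          (⊟-[] {f = y j ⊛ y j} (≋[]-trans (⊛-gain {k = y j} (yε j) (go d j)) (≋[]-trans (≋⇒≋[] (⊛-comm (y j) (ev₀ (y j))))
            (⊛-gain {k = ev₀ (y j)} (yε j) (go d j))))))
        (≋[]-sym (≋⇒≋[] (y-fixed (ev₀ (y j)) (xS j) (Ey (ev₀ ∘ y)) (ev₀-y-eq j)))))
        where
        E≋ : Ey y ≋[ d ] Ey (ev₀ ∘ y)
        E≋ = product-[] is (go d)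

    private
      E V W : Series r
      E = Ey y
      V = E ⊛ E

      Eε : E ε ≡ + 1
      Eε = product-ε y yε is

      Vε : V ε ≡ + 1
      Vε = trans (⊛-at-ε E E) (cong₂ _*ℤ_ Eε Eε)

      W = Inverse.inverse V Vε

      VW : V ⊛ W ≋ oneS
      VW = Inverse.inverse-correct V Vε

    E-constant : K.Constant E
    E-constant = ≋-trans (ev₀-product y is) (product-cong is)
      where
      product-cong : ∀ js → product (ev₀ ∘ y) js ≋ product y js
      product-cong [] = ≋-refl
      product-cong (j ∷ js) = ⊛-cong {f = oneS ⊞ ev₀ (y j)} {g = product (ev₀ ∘ y) js}
        (mk λ m → cong (oneS m +ℤ_) (at (y-constant j) m)) (product-cong js)

    -- `W` and `ev₀ W` are both inverse to `V`, which is constant, and inverses are unique.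
    W-constant : K.Constant W
    W-constant = begin
      ev₀ W                        ≈⟨ solve 1 (λ w → w := :1 :* w) ≋-refl (ev₀ W) ⟩
      oneS ⊛ ev₀ W                 ≈⟨ ⊛-congʳ (ev₀ W) (≋-sym VW) ⟩
      V ⊛ W ⊛ ev₀ W                ≈⟨ solve 3 (λ v w e → v :* w :* e := w :* (v :* e)) ≋-refl V W (ev₀ W) ⟩
      W ⊛ (V ⊛ ev₀ W)              ≈⟨ ⊛-congˡ W (⊛-congʳ (ev₀ W) (≋-sym V-constant)) ⟩
      W ⊛ (ev₀ V ⊛ ev₀ W)          ≈⟨ ⊛-congˡ W (≋-sym (ev₀-* V W)) ⟩
      W ⊛ ev₀ (V ⊛ W)              ≈⟨ ⊛-congˡ W (ev₀-cong VW) ⟩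
      W ⊛ ev₀ oneS                 ≈⟨ ⊛-congˡ W (ev₀-monoS (replicate (suc r) 0)) ⟩
      W ⊛ oneS                     ≈⟨ solve 1 (λ w → w :* :1 := w) ≋-refl W ⟩
      W                            ∎
      where
      open CommutativeRing (ring {r}) using (setoid)
      open import Relation.Binary.Reasoning.Setoid setoid
      V-constant : K.Constant V
      V-constant = K.constant-* {k = E} {l = E} E-constant E-constant

    module _ (c : Series r) (c-eq : c ≋ oneS ⊞ (zS ⊛ E ⊛ E) ⊛ c ⊛ c) where

      private
        factor : Fin (suc r) → Series r
        factor i = oneS ⊞ y i ⊛ c

        factor-ε : ∀ i → factor i ε ≡ + 1
        factor-ε i = 1+-ε {f = y i ⊛ c} (trans (⊛-at-ε (y i) c) (cong (_*ℤ c ε) (yε i)))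

        q : Fin (suc r) → Series r
        q i = Inverse.inverse (factor i) (factor-ε i)

        xV : ∀ i → xS i ⊛ V ≋ y i ⊛ (oneS ⊞ y i)
        xV i = ≋-trans (≋-sym (⊛-assoc (xS i) E E)) (y-eq i)

        c-eq′ : c ≋ oneS ⊞ (zS ⊛ V) ⊛ (c ⊛ c)
        c-eq′ = ≋-trans c-eq
          (solve 3 (λ z e c → :1 :+ (z :* e :* e) :* c :* c := :1 :+ (z :* (e :* e)) :* (c :* c)) ≋-refl zS E c)

      private
        module S = Solution y q c V W y-constant W-constant VW xV c-eq′ (λ i → Inverse.inverse-correct (factor i) (factor-ε i))

        P≋ : ∀ js → S.P c js ≋ prodS (L.map (λ i → oneS +S y i *S c) js)
        P≋ [] = ≋-refl
        P≋ (j ∷ js) = ⊛-congˡ (oneS ⊞ y j ⊛ c) (P≋ js)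

        E≋P1 : ∀ js → product y js ≋ S.P oneS js
        E≋P1 [] = ≋-refl
        E≋P1 (j ∷ js) = ⊛-cong {f = oneS ⊞ y j} {g = product y js}
          (solve 1 (λ y → :1 :+ y := :1 :+ y :* :1) ≋-refl (y j)) (E≋P1 js)

        module Ver = S.Verify is E E-constant (E≋P1 is) ≋-refl

      solution : ∀ (G : Series r) → G ≋ oneS ⊞ zS ⊛ (Fseries r G ⊛ G) →
        (G ⊛ Eyu y c ≋ c ⊛ E) × ((zS ⊛ E ⊛ E) ⊛ c ⊛ Fseries r G ≋ E ⊛ (c ⊛ E ⊞ (⊟ Eyu y c)))
      solution G G-eq = part₁ , part₂
        where
        G≋ : G ≋ Ver.G*
        G≋ = functional-equation-unique {G = G} {G′ = Ver.G*}
          (≋-trans G-eq (mk λ m → cong (oneS m +ℤ_) (at (⊛-congˡ zS (⊛-congʳ G (Fseries-Ts G))) m)))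
          Ver.functional-equation
        F≋ : Fseries r G ≋ Ver.F*
        F≋ = ≋-trans (Fseries-Ts G) (Ts-cong is G≋)
        part₁ : G ⊛ Eyu y c ≋ c ⊛ E
        part₁ = ≋-trans (⊛-cong {f = G} {g = Eyu y c} G≋ (≋-sym (P≋ is))) Ver.G*-product
        part₂ : (zS ⊛ E ⊛ E) ⊛ c ⊛ Fseries r G ≋ E ⊛ (c ⊛ E ⊞ (⊟ Eyu y c))
        part₂ = ≋-trans (⊛-congˡ ((zS ⊛ E ⊛ E) ⊛ c) F≋)
          (≋-trans (solve 4 (λ z e c f → (z :* e :* e) :* c :* f := (z :* (e :* e)) :* c :* f) ≋-refl zS E c Ver.F*)
          (≋-trans Ver.tcF* (⊛-congˡ E (mk λ m → cong (λ p → (c ⊛ E) m +ℤ (ℤ.- p)) (at (P≋ is) m)))))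

-- Words and stack sorting

Word : Set
Word = List ℕ

≡ᵇ-true : ∀ {a b} → (a ≡ᵇ b) ≡ true → a ≡ b
≡ᵇ-true {a} {b} eq = ℕP.≡ᵇ⇒≡ a b (Equivalence.from T-≡ eq)

≡ᵇ-false : ∀ {a b} → (a ≡ᵇ b) ≡ false → a ≢ b
≡ᵇ-false {a} eq refl with trans (sym (Equivalence.to T-≡ (ℕP.≡⇒≡ᵇ a a refl))) eq
... | ()

≡ᵇ-refl : ∀ a → (a ≡ᵇ a) ≡ true
≡ᵇ-refl a = Equivalence.to T-≡ (ℕP.≡⇒≡ᵇ a a refl)

≢⇒≡ᵇ : ∀ {a b} → a ≢ b → (a ≡ᵇ b) ≡ false
≢⇒≡ᵇ {a} {b} ne with a ≡ᵇ b in eq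
... | true = ⊥-elim (ne (≡ᵇ-true eq))
... | false = refl

occ-++ : ∀ a u v → occ a (u ++ v) ≡ occ a u + occ a v
occ-++ a [] v = refl
occ-++ a (b ∷ u) v = trans (cong (_+_ (if b ≡ᵇ a then 1 else 0)) (occ-++ a u v)) (sym (ℕP.+-assoc (if b ≡ᵇ a then 1 else 0) _ _))

occ-∉ : ∀ {a} w → a ∉ w → occ a w ≡ 0
occ-∉ [] _ = refl
occ-∉ {a} (b ∷ w) a∉ rewrite ≢⇒≡ᵇ {b} {a} (λ e → a∉ (here (sym e))) = occ-∉ w (a∉ ∘ there)

occ-∈ : ∀ {a} w → a ∈ w → 1 ≤ occ a w
occ-∈ {a} (b ∷ w) (here refl) rewrite ≡ᵇ-refl a = s≤s z≤n
occ-∈ {a} (b ∷ w) (there a∈) = ℕP.≤-trans (occ-∈ w a∈) (ℕP.m≤n+m _ _)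

occ-pos : ∀ {a} w → 1 ≤ occ a w → a ∈ w
occ-pos {a} (b ∷ w) le with b ≡ᵇ a in eq
... | true = here (sym (≡ᵇ-true eq))
... | false = there (occ-pos w le)

-- Inverse to `splitBy`: it writes `α₁ m α₂ m ⋯ m α_{r+1}` from the list of the factors.
join : ℕ → List Word → Word
join m [] = []
join m (b ∷ []) = b
join m (b ∷ bs@(_ ∷ _)) = b ++ m ∷ join m bs

NonEmpty : ∀ {A : Set} → List A → Set
NonEmpty w = w ≢ []

splitBy-nonEmpty : ∀ m w → NonEmpty (splitBy m w)
splitBy-nonEmpty m [] ()
splitBy-nonEmpty m (a ∷ w) eq with a ≡ᵇ m | splitBy m w
splitBy-nonEmpty m (a ∷ w) () | true | _
splitBy-nonEmpty m (a ∷ w) () | false | []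
splitBy-nonEmpty m (a ∷ w) () | false | _ ∷ _

join-∷ : ∀ m b bs → NonEmpty bs → join m (b ∷ bs) ≡ b ++ m ∷ join m bs
join-∷ m b [] ne = ⊥-elim (ne refl)
join-∷ m b (_ ∷ _) ne = refl

join-consHead : ∀ m a bs → join m (consHead a bs) ≡ a ∷ join m bs
join-consHead m a [] = refl
join-consHead m a (b ∷ []) = refl
join-consHead m a (b ∷ _ ∷ _) = refl

join-splitBy : ∀ m w → join m (splitBy m w) ≡ w
join-splitBy m [] = refl
join-splitBy m (a ∷ w) with a ≡ᵇ m in eq
... | true = trans (join-∷ m [] (splitBy m w) (splitBy-nonEmpty m w)) (cong₂ _∷_ (sym (≡ᵇ-true eq)) (join-splitBy m w))
... | false = trans (join-consHead m a (splitBy m w)) (cong (a ∷_) (join-splitBy m w))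

splitBy-++ : ∀ m b w → m ∉ b → splitBy m (b ++ m ∷ w) ≡ b ∷ splitBy m w
splitBy-++ m [] w m∉ rewrite ≡ᵇ-refl m = refl
splitBy-++ m (a ∷ b) w m∉ rewrite ≢⇒≡ᵇ {a} {m} (λ e → m∉ (here (sym e))) = cong (consHead a) (splitBy-++ m b w (m∉ ∘ there))

splitBy-∉ : ∀ m b → m ∉ b → splitBy m b ≡ b ∷ []
splitBy-∉ m [] m∉ = refl
splitBy-∉ m (a ∷ b) m∉ rewrite ≢⇒≡ᵇ {a} {m} (λ e → m∉ (here (sym e))) = cong (consHead a) (splitBy-∉ m b (m∉ ∘ there))

splitBy-join : ∀ m bs → NonEmpty bs → m ∉ concat bs → splitBy m (join m bs) ≡ bs
splitBy-join m [] ne _ = ⊥-elim (ne refl)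
splitBy-join m (b ∷ []) _ m∉ = splitBy-∉ m b (m∉ ∘ ∈-++⁺ˡ)
splitBy-join m (b ∷ bs@(_ ∷ _)) _ m∉ =
  trans (splitBy-++ m b (join m bs) (m∉ ∘ ∈-++⁺ˡ)) (cong (b ∷_) (splitBy-join m bs (λ ()) (m∉ ∘ ∈-++⁺ʳ b)))

concat-consHead : ∀ a bs → concat (consHead a bs) ≡ a ∷ concat bs
concat-consHead a [] = refl
concat-consHead a (_ ∷ _) = refl

splitBy-∌ : ∀ m w → m ∉ concat (splitBy m w)
splitBy-∌ m [] ()
splitBy-∌ m (a ∷ w) m∈ with a ≡ᵇ m in eq
... | true = splitBy-∌ m w m∈
... | false with subst (m ∈_) (concat-consHead a (splitBy m w)) m∈
...   | here e = ≡ᵇ-false eq (sym e)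
...   | there m∈′ = splitBy-∌ m w m∈′

length-consHead : ∀ a bs → NonEmpty bs → length (consHead a bs) ≡ length bs
length-consHead a [] ne = ⊥-elim (ne refl)
length-consHead a (_ ∷ _) _ = refl

length-splitBy : ∀ m w → length (splitBy m w) ≡ suc (occ m w)
length-splitBy m [] = refl
length-splitBy m (a ∷ w) with a ≡ᵇ m
... | true = cong suc (length-splitBy m w)
... | false = trans (length-consHead a (splitBy m w) (splitBy-nonEmpty m w)) (length-splitBy m w)

∈-join⁻ : ∀ m bs {a} → a ∈ join m bs → a ≡ m ⊎ a ∈ concat bs
∈-join⁻ m (b ∷ []) a∈ = inj₂ (∈-++⁺ˡ a∈)
∈-join⁻ m (b ∷ bs@(_ ∷ _)) a∈ =
  [ inj₂ ∘ ∈-++⁺ˡ , [ inj₁ , map₂ (∈-++⁺ʳ b) ∘ ∈-join⁻ m bs ]′ ∘ toSum ]′ (∈-++⁻ b a∈)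

∈-join⁺ : ∀ m bs {a} → a ∈ concat bs → a ∈ join m bs
∈-join⁺ m (b ∷ []) a∈ = [ id , (λ ()) ]′ (∈-++⁻ b a∈)
∈-join⁺ m (b ∷ bs@(_ ∷ _)) a∈ = [ ∈-++⁺ˡ , ∈-++⁺ʳ b ∘ there ∘ ∈-join⁺ m bs ]′ (∈-++⁻ b a∈)

occ-join-≢ : ∀ m bs {a} → a ≢ m → occ a (join m bs) ≡ occ a (concat bs)
occ-join-≢ m [] _ = refl
occ-join-≢ m (b ∷ []) {a} _ = cong (occ a) (sym (LP.++-identityʳ b))
occ-join-≢ m (b ∷ bs@(_ ∷ _)) {a} a≢m = trans (occ-++ a b _) (trans
  (cong (_+_ (occ a b)) (trans (cong (λ x → (if x then 1 else 0) + occ a (join m bs)) (≢⇒≡ᵇ (a≢m ∘ sym))) (occ-join-≢ m bs a≢m)))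
  (sym (occ-++ a b (concat bs))))

occ-join : ∀ m bs → NonEmpty bs → m ∉ concat bs → suc (occ m (join m bs)) ≡ length bs
occ-join m bs ne m∉ = trans (sym (length-splitBy m (join m bs))) (cong length (splitBy-join m bs ne m∉))

length-join : ∀ m bs {b} → b ∈ bs → length b ≤ length (join m bs)
length-join m (b ∷ []) (here refl) = ℕP.≤-refl
length-join m (b ∷ bs@(_ ∷ _)) (here refl) = ℕP.≤-trans (ℕP.m≤m+n _ _) (ℕP.≤-reflexive (sym (LP.length-++ b)))
length-join m (b ∷ bs@(_ ∷ _)) (there b′∈) = ℕP.≤-trans (length-join m bs b′∈)
  (ℕP.≤-trans (ℕP.n≤1+n _) (ℕP.≤-trans (ℕP.m≤n+m _ (length b)) (ℕP.≤-reflexive (sym (LP.length-++ b)))))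

length-join-< : ∀ m b c bs {d} → d ∈ (b ∷ c ∷ bs) → length d < length (join m (b ∷ c ∷ bs))
length-join-< m b c bs (here refl) = ℕP.≤-trans (ℕP.≤-reflexive (ℕP.+-comm 1 (length b)))
  (ℕP.≤-trans (ℕP.+-monoʳ-≤ (length b) (s≤s z≤n)) (ℕP.≤-reflexive (sym (LP.length-++ b))))
length-join-< m b c bs (there d∈) = ℕP.≤-trans (s≤s (length-join m (c ∷ bs) d∈))
  (ℕP.≤-trans (ℕP.m≤n+m _ (length b)) (ℕP.≤-reflexive (sym (LP.length-++ b))))

maxL-∈ : ∀ a w → maxL (a ∷ w) ∈ a ∷ w
maxL-∈ a [] = here (ℕP.⊔-identityʳ a)
maxL-∈ a (b ∷ w) with ℕP.≤-total a (maxL (b ∷ w))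
... | inj₁ le = there (subst (_∈ b ∷ w) (sym (ℕP.m≤n⇒m⊔n≡n le)) (maxL-∈ b w))
... | inj₂ ge = here (ℕP.m≥n⇒m⊔n≡m ge)

maxL-≥ : ∀ {a} w → a ∈ w → a ≤ maxL w
maxL-≥ (b ∷ w) (here refl) = ℕP.m≤m⊔n b (maxL w)
maxL-≥ (b ∷ w) (there a∈) = ℕP.≤-trans (maxL-≥ w a∈) (ℕP.m≤n⊔m b (maxL w))

maxL-unique : ∀ {m} w → m ∈ w → (∀ {a} → a ∈ w → a ≤ m) → maxL w ≡ m
maxL-unique (a ∷ w) m∈ ≤m = ℕP.≤-antisym (≤m (maxL-∈ a w)) (maxL-≥ (a ∷ w) m∈)

splitBy-shorter : ∀ m w → m ∈ w → ∀ {b} → b ∈ splitBy m w → length b < length w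
splitBy-shorter m w m∈ {b} b∈ with splitBy m w | join-splitBy m w | length-splitBy m w
... | b₁ ∷ b₂ ∷ bs | eq | _ = subst (λ v → length b < length v) eq (length-join-< m b₁ b₂ bs b∈)
... | b₁ ∷ [] | _ | eq with subst (1 ≤_) (sym (ℕP.suc-injective eq)) (occ-∈ w m∈)
...   | ()

concatMap-cong-∈ : ∀ {A B : Set} {f g : A → List B} xs → (∀ {x} → x ∈ xs → f x ≡ g x) → concatMap f xs ≡ concatMap g xs
concatMap-cong-∈ [] eq = refl
concatMap-cong-∈ (x ∷ xs) eq = cong₂ _++_ (eq (here refl)) (concatMap-cong-∈ xs (eq ∘ there))

sortF-fuel : ∀ f f′ w → length w ≤ f → length w ≤ f′ → sortF f w ≡ sortF f′ w
sortF-fuel zero zero [] _ _ = refl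
sortF-fuel zero (suc f′) [] _ _ = refl
sortF-fuel (suc f) zero [] _ _ = refl
sortF-fuel (suc f) (suc f′) [] _ _ = refl
sortF-fuel (suc f) (suc f′) (a ∷ w) (s≤s le) (s≤s le′) = cong (_++ maxL (a ∷ w) ∷ [])
  (concatMap-cong-∈ (splitBy (maxL (a ∷ w)) (a ∷ w)) λ {b} b∈ →
    let lb = ℕP.≤-pred (splitBy-shorter (maxL (a ∷ w)) (a ∷ w) (maxL-∈ a w) b∈) in
    sortF-fuel f f′ b (ℕP.≤-trans lb le) (ℕP.≤-trans lb le′))

stackSort-rec : ∀ a w → stackSort (a ∷ w) ≡ concatMap stackSort (splitBy (maxL (a ∷ w)) (a ∷ w)) ++ maxL (a ∷ w) ∷ []
stackSort-rec a w = cong (_++ maxL (a ∷ w) ∷ [])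
  (concatMap-cong-∈ (splitBy (maxL (a ∷ w)) (a ∷ w)) λ {b} b∈ →
    sortF-fuel (length w) (length b) b (ℕP.≤-pred (splitBy-shorter (maxL (a ∷ w)) (a ∷ w) (maxL-∈ a w) b∈)) ℕP.≤-refl)

-- At least two factors are required because with a single one the letter `m` would not occur in the
-- joined word.
stackSort-join : ∀ m b c bs → (∀ {a} → a ∈ concat (b ∷ c ∷ bs) → a < m) →
  stackSort (join m (b ∷ c ∷ bs)) ≡ concatMap stackSort (b ∷ c ∷ bs) ++ m ∷ []
stackSort-join m b c bs <m with join m (b ∷ c ∷ bs) in eq
... | [] with subst (m ∈_) eq (∈-++⁺ʳ b (here refl))
...   | ()
stackSort-join m b c bs <m | a ∷ w = trans (stackSort-rec a w)
  (cong₂ (λ x y → concatMap stackSort x ++ y ∷ []) split max)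
  where
  max : maxL (a ∷ w) ≡ m
  max = maxL-unique (a ∷ w) (subst (m ∈_) eq (∈-++⁺ʳ b (here refl)))
    λ x∈ → [ ℕP.≤-reflexive , ℕP.<⇒≤ ∘ <m ]′ (∈-join⁻ m (b ∷ c ∷ bs) (subst (_ ∈_) (sym eq) x∈))
  split : splitBy (maxL (a ∷ w)) (a ∷ w) ≡ b ∷ c ∷ bs
  split = trans (cong₂ splitBy max (sym eq)) (splitBy-join m (b ∷ c ∷ bs) (λ ()) (λ m∈ → ℕP.<-irrefl refl (<m m∈)))

∈-concatMap-transfer : ∀ (f : Word → Word) ws {a} → (∀ {w} → w ∈ ws → a ∈ f w → a ∈ w) → a ∈ concatMap f ws → a ∈ concat ws
∈-concatMap-transfer f (w ∷ ws) h a∈ with ∈-++⁻ (f w) a∈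
... | inj₁ a∈w = ∈-++⁺ˡ (h (here refl) a∈w)
... | inj₂ a∈ws = ∈-++⁺ʳ w (∈-concatMap-transfer f ws (h ∘ there) a∈ws)

∈-concat-transfer : ∀ (f : Word → Word) ws {a} → (∀ {w} → w ∈ ws → a ∈ w → a ∈ f w) → a ∈ concat ws → a ∈ concatMap f ws
∈-concat-transfer f (w ∷ ws) h a∈ with ∈-++⁻ w a∈
... | inj₁ a∈w = ∈-++⁺ˡ (h (here refl) a∈w)
... | inj₂ a∈ws = ∈-++⁺ʳ (f w) (∈-concat-transfer f ws (h ∘ there) a∈ws)

∈-sortF⁻ : ∀ f w {a} → a ∈ sortF f w → a ∈ w
∈-sortF⁻ (suc f) (b ∷ w) {a} a∈ with ∈-++⁻ (concatMap (sortF f) (splitBy (maxL (b ∷ w)) (b ∷ w))) a∈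
... | inj₂ (here refl) = maxL-∈ b w
... | inj₁ a∈′ = subst (a ∈_) (join-splitBy m (b ∷ w)) (∈-join⁺ m (splitBy m (b ∷ w))
        (∈-concatMap-transfer (sortF f) (splitBy m (b ∷ w)) (λ {v} _ → ∈-sortF⁻ f v) a∈′))
  where m = maxL (b ∷ w)

∈-sortF⁺ : ∀ f w {a} → length w ≤ f → a ∈ w → a ∈ sortF f w
∈-sortF⁺ (suc f) (b ∷ w) {a} (s≤s le) a∈ with ∈-join⁻ (maxL (b ∷ w)) (splitBy (maxL (b ∷ w)) (b ∷ w)) (subst (a ∈_) (sym (join-splitBy (maxL (b ∷ w)) (b ∷ w))) a∈)
... | inj₁ refl = ∈-++⁺ʳ (concatMap (sortF f) (splitBy a (b ∷ w))) (here refl)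
... | inj₂ a∈′ = ∈-++⁺ˡ (∈-concat-transfer (sortF f) (splitBy m (b ∷ w))
      (λ {v} v∈ → ∈-sortF⁺ f v (ℕP.≤-trans (ℕP.≤-pred (splitBy-shorter m (b ∷ w) (maxL-∈ b w) v∈)) le)) a∈′)
  where m = maxL (b ∷ w)

∈-stackSort⁻ : ∀ {w a} → a ∈ stackSort w → a ∈ w
∈-stackSort⁻ {w} = ∈-sortF⁻ (length w) w

∈-stackSort⁺ : ∀ {w a} → a ∈ w → a ∈ stackSort w
∈-stackSort⁺ {w} = ∈-sortF⁺ (length w) w ℕP.≤-refl

-- Serves to bound the letters of a tuple once its sorted word is known.
∈-sorted⁺ : ∀ ws {a} → a ∈ concat ws → a ∈ stackSort (concatMap stackSort ws)
∈-sorted⁺ ws = ∈-stackSort⁺ ∘ ∈-concat-transfer stackSort ws (λ _ → ∈-stackSort⁺)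

maxL-shift : ∀ p a w → maxL (map (_+_ p) (a ∷ w)) ≡ p + maxL (a ∷ w)
maxL-shift p a [] = trans (ℕP.⊔-identityʳ (p + a)) (cong (_+_ p) (sym (ℕP.⊔-identityʳ a)))
maxL-shift p a (b ∷ w) = trans (cong ((p + a) ⊔_) (maxL-shift p b w)) (sym (ℕP.+-distribˡ-⊔ p a (maxL (b ∷ w))))

≡ᵇ-shift : ∀ p a b → (p + a ≡ᵇ p + b) ≡ (a ≡ᵇ b)
≡ᵇ-shift zero a b = refl
≡ᵇ-shift (suc p) a b = ≡ᵇ-shift p a b

splitBy-shift : ∀ p m w → splitBy (p + m) (map (_+_ p) w) ≡ map (map (_+_ p)) (splitBy m w)
splitBy-shift p m [] = refl
splitBy-shift p m (a ∷ w) rewrite ≡ᵇ-shift p a m | splitBy-shift p m w with a ≡ᵇ m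
... | true = refl
... | false with splitBy m w
...   | [] = refl
...   | _ ∷ _ = refl

sortF-shift : ∀ p f w → sortF f (map (_+_ p) w) ≡ map (_+_ p) (sortF f w)
sortF-shift p zero w = refl
sortF-shift p (suc f) [] = refl
sortF-shift p (suc f) (a ∷ w) = trans
  (cong (λ m → concatMap (sortF f) (splitBy m (map (_+_ p) (a ∷ w))) ++ m ∷ []) (maxL-shift p a w))
  (trans (cong (λ ws → concatMap (sortF f) ws ++ (p + maxL (a ∷ w)) ∷ []) (splitBy-shift p (maxL (a ∷ w)) (a ∷ w)))
  (trans (cong (_++ (p + maxL (a ∷ w)) ∷ []) (parts (splitBy (maxL (a ∷ w)) (a ∷ w))))
    (sym (LP.map-++ (_+_ p) (concatMap (sortF f) (splitBy (maxL (a ∷ w)) (a ∷ w))) (maxL (a ∷ w) ∷ [])))))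
  where
  parts : ∀ ws → concatMap (sortF f) (map (map (_+_ p)) ws) ≡ map (_+_ p) (concatMap (sortF f) ws)
  parts [] = refl
  parts (v ∷ ws) = trans (cong₂ _++_ (sortF-shift p f v) (parts ws)) (sym (LP.map-++ (_+_ p) (sortF f v) _))

stackSort-shift : ∀ p w → stackSort (map (_+_ p) w) ≡ map (_+_ p) (stackSort w)
stackSort-shift p w = trans (cong (λ l → sortF l (map (_+_ p) w)) (LP.length-map (_+_ p) w)) (sortF-shift p (length w) w)

concatMap-stackSort-shift : ∀ p ws → concatMap stackSort (map (map (_+_ p)) ws) ≡ map (_+_ p) (concatMap stackSort ws)
concatMap-stackSort-shift p [] = refl
concatMap-stackSort-shift p (v ∷ ws) = trans (cong₂ _++_ (stackSort-shift p v) (concatMap-stackSort-shift p ws)) (sym (LP.map-++ (_+_ p) (stackSort v) _))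

letters-suc : ∀ n → letters (suc n) ≡ letters n ++ suc n ∷ []
letters-suc n = trans (cong (map suc) (sym (LP.upTo-∷ʳ n))) (LP.map-++ suc (upTo n) (n ∷ []))

letters-+ : ∀ p q → letters (p + q) ≡ letters p ++ map (_+_ p) (letters q)
letters-+ p zero = trans (cong letters (ℕP.+-identityʳ p)) (sym (LP.++-identityʳ _))
letters-+ p (suc q) = begin
  letters (p + suc q)                                       ≡⟨ cong letters (ℕP.+-suc p q) ⟩
  letters (suc (p + q))                                     ≡⟨ letters-suc (p + q) ⟩
  letters (p + q) ++ suc (p + q) ∷ []                       ≡⟨ cong₂ (λ u x → u ++ x ∷ []) (letters-+ p q) (sym (ℕP.+-suc p q)) ⟩
  (letters p ++ map (_+_ p) (letters q)) ++ (p + suc q) ∷ [] ≡⟨ LP.++-assoc (letters p) _ _ ⟩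
  letters p ++ map (_+_ p) (letters q) ++ (p + suc q) ∷ []   ≡⟨ cong (letters p ++_) (LP.map-++ (_+_ p) (letters q) (suc q ∷ [])) ⟨
  letters p ++ map (_+_ p) (letters q ++ suc q ∷ [])         ≡⟨ cong (λ u → letters p ++ map (_+_ p) u) (letters-suc q) ⟨
  letters p ++ map (_+_ p) (letters (suc q))                 ∎
  where open ≡-Reasoning

∈-letters⁻ : ∀ {n a} → a ∈ letters n → 1 ≤ a × a ≤ n
∈-letters⁻ a∈ with ∈-map⁻ suc a∈
... | i , i∈ , refl = s≤s z≤n , ∈-upTo⁻ i∈

∈-letters⁺ : ∀ {n a} → 1 ≤ a → a ≤ n → a ∈ letters n
∈-letters⁺ {a = suc a} _ a≤n = ∈-map⁺ suc (∈-upTo⁺ a≤n)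

length-letters : ∀ n → length (letters n) ≡ n
length-letters n = trans (LP.length-map suc (upTo n)) (LP.length-upTo n)

-- Tuples of r-permutations and removal of the largest letter

∧-true : ∀ {b c} → b ∧ c ≡ true → b ≡ true × c ≡ true
∧-true {true} eq = refl , eq

≤ᵇ-true : ∀ {a b} → (a ≤ᵇ b) ≡ true → a ≤ b
≤ᵇ-true {a} {b} eq = ℕP.≤ᵇ⇒≤ a b (Equivalence.from T-≡ eq)

≤⇒≤ᵇ-true : ∀ {a b} → a ≤ b → (a ≤ᵇ b) ≡ true
≤⇒≤ᵇ-true le = Equivalence.to T-≡ (ℕP.≤⇒≤ᵇ le)

-- Phrased with subsequences `a b a`, the condition visibly passes to every subsequence of a word.
Pat : Word → Set
Pat w = ∀ {a b} → (a ∷ b ∷ a ∷ []) ⊆ w → b ≤ a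

-- The flag `g` tells whether all letters read so far are at most `a`. It may become false with
-- impunity as long as `a` does not return, hence the premise `a ∈ w` in the first half.
chk-sound : ∀ a g w → chk a g w ≡ true → (a ∈ w → g ≡ true) × (∀ {b} → (b ∷ a ∷ []) ⊆ w → b ≤ a)
chk-sound a g [] _ = (λ ()) , (λ ())
chk-sound a g (x ∷ w) eq = inside , bounded
  where
  now : not (x ≡ᵇ a) ∨ g ≡ true
  now = proj₁ (∧-true {not (x ≡ᵇ a) ∨ g} eq)
  later : (a ∈ w → g ∧ (x ≤ᵇ a) ≡ true) × (∀ {b} → (b ∷ a ∷ []) ⊆ w → b ≤ a)
  later = chk-sound a (g ∧ (x ≤ᵇ a)) w (proj₂ (∧-true {not (x ≡ᵇ a) ∨ g} eq))
  inside : a ∈ x ∷ w → g ≡ true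
  inside (here refl) = trans (sym (cong (λ t → not t ∨ g) (≡ᵇ-refl a))) now
  inside (there a∈) = proj₁ (∧-true (proj₁ later a∈))
  bounded : ∀ {b} → (b ∷ a ∷ []) ⊆ (x ∷ w) → b ≤ a
  bounded (_ ∷ʳ s) = proj₂ later s
  bounded (refl ∷ s) = ≤ᵇ-true (proj₂ (∧-true {g} (proj₁ later (to∈ s))))

chk-complete : ∀ a g w → (a ∈ w → g ≡ true) → (∀ {b} → (b ∷ a ∷ []) ⊆ w → b ≤ a) → chk a g w ≡ true
chk-complete a g [] _ _ = refl
chk-complete a g (x ∷ w) inside bounded = cong₂ _∧_ now
  (chk-complete a (g ∧ (x ≤ᵇ a)) w
    (λ a∈ → cong₂ _∧_ (inside (there a∈)) (≤⇒≤ᵇ-true (bounded (refl ∷ from∈ a∈))))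
    (λ s → bounded (x ∷ʳ s)))
  where
  now : not (x ≡ᵇ a) ∨ g ≡ true
  now with x ≡ᵇ a in eq
  ... | false = refl
  ... | true = inside (here (sym (≡ᵇ-true eq)))

patternOK-sound : ∀ w → patternOK w ≡ true → Pat w
patternOK-sound (x ∷ w) eq (_ ∷ʳ s) = patternOK-sound w (proj₂ (∧-true {chk x true w} eq)) s
patternOK-sound (x ∷ w) eq (refl ∷ s) = proj₂ (chk-sound x true w (proj₁ (∧-true eq))) s

patternOK-complete : ∀ w → Pat w → patternOK w ≡ true
patternOK-complete [] _ = refl
patternOK-complete (x ∷ w) pat = cong₂ _∧_ (chk-complete x true w (λ _ → refl) (λ s → pat (refl ∷ s)))
  (patternOK-complete w (λ s → pat (x ∷ʳ s)))

Disj : Word → Word → Set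
Disj u v = ∀ {a} → a ∈ u → a ∈ v → ⊥

⊆-++⁻ : ∀ u {v xs : Word} → xs ⊆ u ++ v → ∃[ ys ] ∃[ zs ] (xs ≡ ys ++ zs × ys ⊆ u × zs ⊆ v)
⊆-++⁻ [] s = [] , _ , refl , [] , s
⊆-++⁻ (x ∷ u) (_ ∷ʳ s) with ⊆-++⁻ u s
... | ys , zs , eq , s₁ , s₂ = ys , zs , eq , x ∷ʳ s₁ , s₂
⊆-++⁻ (x ∷ u) (refl ∷ s) with ⊆-++⁻ u s
... | ys , zs , eq , s₁ , s₂ = x ∷ ys , zs , cong (x ∷_) eq , refl ∷ s₁ , s₂

⊆-left : ∀ (u v : Word) → u ⊆ u ++ v
⊆-left u v = SP.++⁺ʳ v ⊆-refl

⊆-right : ∀ (u v : Word) → v ⊆ u ++ v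
⊆-right u v = SP.++⁺ˡ u ⊆-refl

⊆-∈ : ∀ {u v : Word} {a} → u ⊆ v → a ∈ u → a ∈ v
⊆-∈ s a∈ = to∈ (⊆-trans (from∈ a∈) s)

Pat-⊆ : ∀ {u v} → u ⊆ v → Pat v → Pat u
Pat-⊆ s pat t = pat (⊆-trans t s)

-- The two copies of `a` in a subsequence `a b a` lie in the same one of two disjoint words, and
-- then so does `b`.
Pat-++ : ∀ {u v} → Pat u → Pat v → Disj u v → Pat (u ++ v)
Pat-++ {u} pu pv disj s with ⊆-++⁻ u s
... | [] , _ , refl , _ , s₂ = pv s₂
... | _ ∷ [] , _ , refl , s₁ , s₂ = ⊥-elim (disj (to∈ s₁) (⊆-∈ s₂ (there (here refl))))
... | _ ∷ _ ∷ [] , _ , refl , s₁ , s₂ = ⊥-elim (disj (⊆-∈ s₁ (here refl)) (⊆-∈ s₂ (here refl)))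
... | _ ∷ _ ∷ _ ∷ [] , [] , refl , s₁ , _ = pu s₁

Pat-∷ : ∀ {m v} → Pat v → (∀ {a} → a ∈ v → a ≤ m) → Pat (m ∷ v)
Pat-∷ pv ≤m (_ ∷ʳ s) = pv s
Pat-∷ pv ≤m (refl ∷ s) = ≤m (⊆-∈ s (here refl))

-- For words without common letters the pattern condition can be tested word by word. This inductive
-- form combines both requirements on a tuple and is easy to cut and to concatenate.
Good : List Word → Set
Good [] = ⊤
Good (w ∷ ws) = Pat w × Disj w (concat ws) × Good ws

Good-++⁺ : ∀ A {B} → Good A → Good B → Disj (concat A) (concat B) → Good (A ++ B)
Good-++⁺ [] _ gB _ = gB
Good-++⁺ (w ∷ A) {B} (pw , dw , gA) gB d = pw , disj , Good-++⁺ A gA gB (d ∘ ∈-++⁺ʳ w)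
  where
  disj : Disj w (concat (A ++ B))
  disj a∈w a∈ = [ dw a∈w , d (∈-++⁺ˡ a∈w) ]′ (∈-++⁻ (concat A) (subst (_ ∈_) (sym (LP.concat-++ A B)) a∈))

Good-++⁻ : ∀ A {B} → Good (A ++ B) → Good A × Good B × Disj (concat A) (concat B)
Good-++⁻ [] g = tt , g , (λ ())
Good-++⁻ (w ∷ A) {B} (pw , dw , g) with Good-++⁻ A g
... | gA , gB , d = (pw , (λ a∈w a∈A → dw a∈w (in-++ (∈-++⁺ˡ a∈A))) , gA) , gB ,
        (λ a∈ a∈B → [ (λ a∈w → dw a∈w (in-++ (∈-++⁺ʳ (concat A) a∈B))) , (λ a∈A → d a∈A a∈B) ]′ (∈-++⁻ w a∈))
  where
  in-++ : ∀ {a} → a ∈ concat A ++ concat B → a ∈ concat (A ++ B)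
  in-++ = subst (_ ∈_) (LP.concat-++ A B)

Good-Pat : ∀ T → Good T → Pat (concat T)
Good-Pat [] _ ()
Good-Pat (w ∷ ws) (pw , dw , g) = Pat-++ pw (Good-Pat ws g) dw

Good⇒Pat-join : ∀ m bs → (∀ {a} → a ∈ concat bs → a < m) → Good bs → Pat (join m bs)
Good⇒Pat-join m [] _ _ ()
Good⇒Pat-join m (b ∷ []) _ (pb , _) = pb
Good⇒Pat-join m (b ∷ bs@(_ ∷ _)) <m (pb , db , g) = Pat-++ pb (Pat-∷ (Good⇒Pat-join m bs (<m ∘ ∈-++⁺ʳ b) g) ≤m) disj
  where
  ≤m : ∀ {a} → a ∈ join m bs → a ≤ m
  ≤m a∈ = [ ℕP.≤-reflexive , ℕP.<⇒≤ ∘ <m ∘ ∈-++⁺ʳ b ]′ (∈-join⁻ m bs a∈)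
  disj : Disj b (m ∷ join m bs)
  disj a∈b (here refl) = ℕP.<-irrefl refl (<m (∈-++⁺ˡ a∈b))
  disj a∈b (there a∈) = [ (λ { refl → ℕP.<-irrefl refl (<m (∈-++⁺ˡ a∈b)) }) , db a∈b ]′ (∈-join⁻ m bs a∈)

-- A letter `a` common to two factors would give the subsequence `a m a` with `m` larger than `a`.
-- The pattern condition thus forces the factors to be disjoint, which lets them serve as components
-- of a tuple.
Pat-join⇒Good : ∀ m bs → (∀ {a} → a ∈ concat bs → a < m) → Pat (join m bs) → Good bs
Pat-join⇒Good m [] _ _ = tt
Pat-join⇒Good m (b ∷ []) _ pat = pat , (λ _ ()) , tt
Pat-join⇒Good m (b ∷ bs@(_ ∷ _)) <m pat =
  Pat-⊆ (⊆-left b _) pat , disj , Pat-join⇒Good m bs (<m ∘ ∈-++⁺ʳ b) (Pat-⊆ (⊆-trans (m ∷ʳ ⊆-refl) (⊆-right b _)) pat)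
  where
  disj : Disj b (concat bs)
  disj a∈b a∈bs = ℕP.<⇒≱ (<m (∈-++⁺ˡ a∈b)) (pat (SP.++⁺ (from∈ a∈b) (refl ∷ from∈ (∈-join⁺ m bs a∈bs))))

dropEmpty : List Word → List Word
dropEmpty [] = []
dropEmpty ([] ∷ ws) = dropEmpty ws
dropEmpty (w@(_ ∷ _) ∷ ws) = w ∷ dropEmpty ws

concat-dropEmpty : ∀ ws → concat (dropEmpty ws) ≡ concat ws
concat-dropEmpty [] = refl
concat-dropEmpty ([] ∷ ws) = concat-dropEmpty ws
concat-dropEmpty (w@(_ ∷ _) ∷ ws) = cong (w ++_) (concat-dropEmpty ws)

concatMap-dropEmpty : ∀ ws → concatMap stackSort (dropEmpty ws) ≡ concatMap stackSort ws
concatMap-dropEmpty [] = refl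
concatMap-dropEmpty ([] ∷ ws) = concatMap-dropEmpty ws
concatMap-dropEmpty (w@(_ ∷ _) ∷ ws) = cong (stackSort w ++_) (concatMap-dropEmpty ws)

Good-dropEmpty⁺ : ∀ ws → Good ws → Good (dropEmpty ws)
Good-dropEmpty⁺ [] g = g
Good-dropEmpty⁺ ([] ∷ ws) (_ , _ , g) = Good-dropEmpty⁺ ws g
Good-dropEmpty⁺ (w@(_ ∷ _) ∷ ws) (p , d , g) =
  p , (λ a∈ a∈′ → d a∈ (subst (_ ∈_) (concat-dropEmpty ws) a∈′)) , Good-dropEmpty⁺ ws g

Good-dropEmpty⁻ : ∀ ws → Good (dropEmpty ws) → Good ws
Good-dropEmpty⁻ [] g = g
Good-dropEmpty⁻ ([] ∷ ws) g = (λ ()) , (λ ()) , Good-dropEmpty⁻ ws g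
Good-dropEmpty⁻ (w@(_ ∷ _) ∷ ws) (p , d , g) =
  p , (λ a∈ a∈′ → d a∈ (subst (_ ∈_) (sym (concat-dropEmpty ws)) a∈′)) , Good-dropEmpty⁻ ws g

shift : ℕ → List Word → List Word
shift p = map (map (_+_ p))

concat-shift : ∀ p ws → concat (shift p ws) ≡ map (_+_ p) (concat ws)
concat-shift p ws = LP.concat-map ws

map-⊆⁻ : ∀ p (w xs : Word) → xs ⊆ map (_+_ p) w → ∃[ ys ] (xs ≡ map (_+_ p) ys × ys ⊆ w)
map-⊆⁻ p [] [] [] = [] , refl , []
map-⊆⁻ p (x ∷ w) xs (_ ∷ʳ s) with map-⊆⁻ p w xs s
... | ys , eq , s′ = ys , eq , x ∷ʳ s′
map-⊆⁻ p (x ∷ w) (_ ∷ xs) (refl ∷ s) with map-⊆⁻ p w xs s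
... | ys , eq , s′ = x ∷ ys , cong (_ ∷_) eq , refl ∷ s′

Pat-shift⁺ : ∀ p {w} → Pat w → Pat (map (_+_ p) w)
Pat-shift⁺ p {w} pat s with map-⊆⁻ p w _ s
... | x ∷ y ∷ z ∷ [] , eq , s′ with LP.∷-injective eq
... | refl , eq₂ with LP.∷-injective eq₂
... | refl , eq₃ with ℕP.+-cancelˡ-≡ p x z (LP.∷-injectiveˡ eq₃)
... | refl = ℕP.+-monoʳ-≤ p (pat s′)

Pat-shift⁻ : ∀ p {w} → Pat (map (_+_ p) w) → Pat w
Pat-shift⁻ p pat s = ℕP.+-cancelˡ-≤ p _ _ (pat (SP.map⁺ (_+_ p) s))

∈-shift⁺ : ∀ p {w : Word} {a} → a ∈ w → p + a ∈ map (_+_ p) w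
∈-shift⁺ p = ∈-map⁺ (_+_ p)

∈-shift⁻ : ∀ p {w : Word} {a} → p + a ∈ map (_+_ p) w → a ∈ w
∈-shift⁻ p {w} {a} a∈ with ∈-map⁻ (_+_ p) a∈
... | b , b∈ , eq = subst (_∈ w) (sym (ℕP.+-cancelˡ-≡ p a b eq)) b∈

Good-shift⁺ : ∀ p ws → Good ws → Good (shift p ws)
Good-shift⁺ p [] _ = tt
Good-shift⁺ p (w ∷ ws) (pw , dw , g) = Pat-shift⁺ p pw , disj , Good-shift⁺ p ws g
  where
  disj : Disj (map (_+_ p) w) (concat (shift p ws))
  disj a∈ a∈′ with ∈-map⁻ (_+_ p) a∈
  ... | b , b∈ , refl = dw b∈ (∈-shift⁻ p (subst (p + b ∈_) (concat-shift p ws) a∈′))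

Good-shift⁻ : ∀ p ws → Good (shift p ws) → Good ws
Good-shift⁻ p [] _ = tt
Good-shift⁻ p (w ∷ ws) (pw , dw , g) = Pat-shift⁻ p pw ,
  (λ a∈ a∈′ → dw (∈-shift⁺ p a∈) (subst (_ ∈_) (sym (concat-shift p ws)) (∈-shift⁺ p a∈′))) , Good-shift⁻ p ws g

occ-shift : ∀ p a w → occ (p + a) (map (_+_ p) w) ≡ occ a w
occ-shift p a [] = refl
occ-shift p a (b ∷ w) = cong₂ (λ t n → (if t then 1 else 0) + n) (≡ᵇ-shift p b a) (occ-shift p a w)

record Weak (r n : ℕ) (T : List Word) : Set where
  field
    range  : ∀ {a} → a ∈ concat T → 1 ≤ a × a ≤ n
    count  : ∀ {a} → 1 ≤ a → a ≤ n → occ a (concat T) ≡ r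
    good   : Good T
    sorted : stackSort (concatMap stackSort T) ≡ letters n

Weak-dropEmpty⁺ : ∀ {r n} A B → Weak r n (A ++ B) → Weak r n (A ++ dropEmpty B)
Weak-dropEmpty⁻ : ∀ {r n} A B → Weak r n (A ++ dropEmpty B) → Weak r n (A ++ B)

private
  concat-≡ : ∀ A B → concat (A ++ dropEmpty B) ≡ concat (A ++ B)
  concat-≡ A B = trans (sym (LP.concat-++ A (dropEmpty B))) (trans (cong (concat A ++_) (concat-dropEmpty B)) (LP.concat-++ A B))

  sort-≡ : ∀ A B → concatMap stackSort (A ++ dropEmpty B) ≡ concatMap stackSort (A ++ B)
  sort-≡ A B = trans (LP.concatMap-++ stackSort A (dropEmpty B))
    (trans (cong (concatMap stackSort A ++_) (concatMap-dropEmpty B)) (sym (LP.concatMap-++ stackSort A B)))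

Weak-dropEmpty⁺ A B w = record
  { range = λ a∈ → range (subst (_ ∈_) (concat-≡ A B) a∈)
  ; count = λ {a} l u → trans (cong (occ a) (concat-≡ A B)) (count l u)
  ; good = let (gA , gB , d) = Good-++⁻ A good in
      Good-++⁺ A gA (Good-dropEmpty⁺ B gB) (λ a∈ a∈′ → d a∈ (subst (_ ∈_) (concat-dropEmpty B) a∈′))
  ; sorted = trans (cong stackSort (sort-≡ A B)) sorted }
  where open Weak w

Weak-dropEmpty⁻ A B w = record
  { range = λ a∈ → range (subst (_ ∈_) (sym (concat-≡ A B)) a∈)
  ; count = λ {a} l u → trans (cong (occ a) (sym (concat-≡ A B))) (count l u)
  ; good = let (gA , gB , d) = Good-++⁻ A good in
      Good-++⁺ A gA (Good-dropEmpty⁻ B gB) (λ a∈ a∈′ → d a∈ (subst (_ ∈_) (sym (concat-dropEmpty B)) a∈′))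
  ; sorted = trans (cong stackSort (sym (sort-≡ A B))) sorted }
  where open Weak w

-- Sorting α with largest letter m moves m to its end, so the whole first pass reads left ++ m ∷ right.
sort-insert : ∀ m A b c bs B →
  (∀ {a} → a ∈ concat (A ++ b ∷ c ∷ bs) → a < m) → (∀ {a} → a ∈ concat B → a < m) →
  stackSort (concatMap stackSort (A ++ join m (b ∷ c ∷ bs) ∷ B)) ≡
  (stackSort (concatMap stackSort (A ++ b ∷ c ∷ bs)) ++ stackSort (concatMap stackSort B)) ++ m ∷ []
sort-insert m A b c bs B <m <m′ = begin
  stackSort (concatMap stackSort (A ++ join m βs ∷ B))
    ≡⟨ cong stackSort firstPass ⟩
  stackSort (join m (left ∷ right ∷ []))
    ≡⟨ stackSort-join m left right [] small ⟩
  (stackSort left ++ (stackSort right ++ [])) ++ m ∷ []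
    ≡⟨ cong (λ x → (stackSort left ++ x) ++ m ∷ []) (LP.++-identityʳ (stackSort right)) ⟩
  (stackSort left ++ stackSort right) ++ m ∷ [] ∎
  where
  open ≡-Reasoning
  βs = b ∷ c ∷ bs
  left = concatMap stackSort (A ++ βs)
  right = concatMap stackSort B
  firstPass : concatMap stackSort (A ++ join m βs ∷ B) ≡ left ++ m ∷ right
  firstPass = begin
    concatMap stackSort (A ++ join m βs ∷ B)
      ≡⟨ LP.concatMap-++ stackSort A (join m βs ∷ B) ⟩
    concatMap stackSort A ++ stackSort (join m βs) ++ right
      ≡⟨ cong (λ x → concatMap stackSort A ++ x ++ right) (stackSort-join m b c bs (<m ∘ subst (_ ∈_) (LP.concat-++ A βs) ∘ ∈-++⁺ʳ (concat A))) ⟩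
    concatMap stackSort A ++ (concatMap stackSort βs ++ m ∷ []) ++ right
      ≡⟨ cong (concatMap stackSort A ++_) (LP.++-assoc (concatMap stackSort βs) (m ∷ []) right) ⟩
    concatMap stackSort A ++ concatMap stackSort βs ++ m ∷ right
      ≡⟨ LP.++-assoc (concatMap stackSort A) _ _ ⟨
    (concatMap stackSort A ++ concatMap stackSort βs) ++ m ∷ right
      ≡⟨ cong (_++ m ∷ right) (LP.concatMap-++ stackSort A βs) ⟨
    left ++ m ∷ right ∎
  small : ∀ {a} → a ∈ concat (left ∷ right ∷ []) → a < m
  small a∈ with ∈-++⁻ left a∈
  ... | inj₁ a∈l = <m (∈-concatMap-transfer stackSort (A ++ βs) (λ _ → ∈-stackSort⁻) a∈l)
  ... | inj₂ a∈r = <m′ (∈-concatMap-transfer stackSort B (λ _ → ∈-stackSort⁻) (subst (_ ∈_) (LP.++-identityʳ right) a∈r))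

∈-concat-++⁻ : ∀ A {B : List Word} {a} → a ∈ concat (A ++ B) → a ∈ concat A ⊎ a ∈ concat B
∈-concat-++⁻ A {B} a∈ = ∈-++⁻ (concat A) (subst (_ ∈_) (sym (LP.concat-++ A B)) a∈)

∈-concat-++⁺ˡ : ∀ A {B : List Word} {a} → a ∈ concat A → a ∈ concat (A ++ B)
∈-concat-++⁺ˡ A {B} a∈ = subst (_ ∈_) (LP.concat-++ A B) (∈-++⁺ˡ a∈)

∈-concat-++⁺ʳ : ∀ A {B : List Word} {a} → a ∈ concat B → a ∈ concat (A ++ B)
∈-concat-++⁺ʳ A {B} a∈ = subst (_ ∈_) (LP.concat-++ A B) (∈-++⁺ʳ (concat A) a∈)

occ-concat-++ : ∀ a A (B : List Word) → occ a (concat (A ++ B)) ≡ occ a (concat A) + occ a (concat B)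
occ-concat-++ a A B = trans (cong (occ a) (sym (LP.concat-++ A B))) (occ-++ a (concat A) (concat B))

occ-insert-≢ : ∀ m A βs (B : List Word) {a} → a ≢ m →
  occ a (concat (A ++ join m βs ∷ B)) ≡ occ a (concat (A ++ βs)) + occ a (concat B)
occ-insert-≢ m A βs B {a} a≢m = begin
  occ a (concat (A ++ join m βs ∷ B))
    ≡⟨ occ-concat-++ a A (join m βs ∷ B) ⟩
  occ a (concat A) + occ a (join m βs ++ concat B)
    ≡⟨ cong (_+_ (occ a (concat A))) (trans (occ-++ a (join m βs) (concat B)) (cong (_+ occ a (concat B)) (occ-join-≢ m βs a≢m))) ⟩
  occ a (concat A) + (occ a (concat βs) + occ a (concat B))
    ≡⟨ ℕP.+-assoc (occ a (concat A)) _ _ ⟨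
  (occ a (concat A) + occ a (concat βs)) + occ a (concat B)
    ≡⟨ cong (_+ occ a (concat B)) (occ-concat-++ a A βs) ⟨
  occ a (concat (A ++ βs)) + occ a (concat B) ∎
  where open ≡-Reasoning

occ-insert : ∀ m A α (B : List Word) → m ∉ concat A → m ∉ concat B →
  occ m (concat (A ++ α ∷ B)) ≡ occ m α
occ-insert m A α B m∉A m∉B = begin
  occ m (concat (A ++ α ∷ B))                ≡⟨ occ-concat-++ m A (α ∷ B) ⟩
  occ m (concat A) + occ m (α ++ concat B)   ≡⟨ cong₂ _+_ (occ-∉ (concat A) m∉A) (occ-++ m α (concat B)) ⟩
  occ m α + occ m (concat B)                 ≡⟨ cong (_+_ (occ m α)) (occ-∉ (concat B) m∉B) ⟩
  occ m α + 0                                ≡⟨ ℕP.+-identityʳ _ ⟩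
  occ m α                                    ∎
  where open ≡-Reasoning

module _ {r p q : ℕ} (A : List Word) (b c : Word) (bs B : List Word) where

  private
    βs : List Word
    βs = b ∷ c ∷ bs
    m : ℕ
    m = suc (p + q)

  -- By `sort-insert` the final word is the sorted left part, the sorted right part and `m`. Moving
  -- the letters of the right part up by `p` is exactly what makes this `letters m`.
  weak-insert : length βs ≡ suc r → Weak r p (A ++ βs) → Weak r q B →
                Weak r m (A ++ join m βs ∷ shift p B)
  weak-insert len wl wr = record { range = range ; count = count ; good = good ; sorted = sorted }
    where
    module l = Weak wl
    module r = Weak wr
    goods = Good-++⁻ A l.good

    inB : ∀ {a} → a ∈ concat (shift p B) → ∃[ a′ ] (a ≡ p + a′ × 1 ≤ a′ × a′ ≤ q)
    inB a∈ with ∈-map⁻ (_+_ p) (subst (_ ∈_) (concat-shift p B) a∈)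
    ... | a′ , a′∈ , eq = a′ , eq , r.range a′∈

    left<m : ∀ {a} → a ∈ concat (A ++ βs) → a < m
    left<m a∈ = s≤s (ℕP.≤-trans (proj₂ (l.range a∈)) (ℕP.m≤m+n p q))

    right<m : ∀ {a} → a ∈ concat (shift p B) → a < m
    right<m a∈ with inB a∈
    ... | a′ , refl , _ , a′≤q = s≤s (ℕP.+-monoʳ-≤ p a′≤q)

    left-right : ∀ {a} → a ∈ concat (A ++ βs) → a ∈ concat (shift p B) → ⊥
    left-right a∈ a∈′ with inB a∈′
    ... | a′ , refl , 1≤a′ , _ = ℕP.<⇒≱ (ℕP.m<m+n p 1≤a′) (proj₂ (l.range a∈))

    m∉left : m ∉ concat (A ++ βs)
    m∉left m∈ = ℕP.<-irrefl refl (left<m m∈)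

    m∉right : m ∉ concat (shift p B)
    m∉right m∈ = ℕP.<-irrefl refl (right<m m∈)

    range : ∀ {a} → a ∈ concat (A ++ join m βs ∷ shift p B) → 1 ≤ a × a ≤ m
    range a∈ with ∈-concat-++⁻ A a∈
    ... | inj₁ a∈A = proj₁ (l.range (∈-concat-++⁺ˡ A a∈A)) , ℕP.<⇒≤ (left<m (∈-concat-++⁺ˡ A a∈A))
    ... | inj₂ a∈′ with ∈-++⁻ (join m βs) a∈′
    ...   | inj₂ a∈B = (case inB a∈B of λ { (a′ , refl , 1≤a′ , _) → ℕP.≤-trans 1≤a′ (ℕP.m≤n+m a′ p) }) , ℕP.<⇒≤ (right<m a∈B)
    ...   | inj₁ a∈j with ∈-join⁻ m βs a∈j
    ...     | inj₁ refl = s≤s z≤n , ℕP.≤-refl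
    ...     | inj₂ a∈β = proj₁ (l.range (∈-concat-++⁺ʳ A a∈β)) , ℕP.<⇒≤ (left<m (∈-concat-++⁺ʳ A a∈β))

    count : ∀ {a} → 1 ≤ a → a ≤ m → occ a (concat (A ++ join m βs ∷ shift p B)) ≡ r
    count {a} 1≤a a≤m with a ℕ.≟ m
    ... | yes refl = trans (occ-insert m A (join m βs) (shift p B) (m∉left ∘ ∈-concat-++⁺ˡ A) m∉right)
            (ℕP.suc-injective (trans (occ-join m βs (λ ()) (m∉left ∘ ∈-concat-++⁺ʳ A)) len))
    ... | no a≢m with a ℕ.≤? p
    ...   | yes a≤p = trans (occ-insert-≢ m A βs (shift p B) a≢m) (trans
              (cong₂ _+_ (l.count 1≤a a≤p) (occ-∉ (concat (shift p B)) λ a∈ → case inB a∈ of λ { (a′ , refl , 1≤a′ , _) → ℕP.<⇒≱ (ℕP.m<m+n p 1≤a′) a≤p }))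
              (ℕP.+-identityʳ r))
    ...   | no a≰p = trans (occ-insert-≢ m A βs (shift p B) a≢m) (cong₂ _+_
              (occ-∉ (concat (A ++ βs)) (a≰p ∘ proj₂ ∘ l.range))
              (begin
                occ a (concat (shift p B))           ≡⟨ cong (occ a) (concat-shift p B) ⟩
                occ a (map (_+_ p) (concat B))        ≡⟨ cong (λ x → occ x (map (_+_ p) (concat B))) (ℕP.m+[n∸m]≡n p≤a) ⟨
                occ (p + (a ∸ p)) (map (_+_ p) (concat B)) ≡⟨ occ-shift p (a ∸ p) (concat B) ⟩
                occ (a ∸ p) (concat B)               ≡⟨ r.count (ℕP.m<n⇒0<n∸m (ℕP.≰⇒> a≰p)) a∸p≤q ⟩
                r                                    ∎))
      where
      open ≡-Reasoning
      p≤a : p ≤ a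
      p≤a = ℕP.<⇒≤ (ℕP.≰⇒> a≰p)
      a∸p≤q : a ∸ p ≤ q
      a∸p≤q = ℕP.≤-trans (ℕP.∸-monoˡ-≤ p (ℕP.≤-pred (ℕP.≤∧≢⇒< a≤m a≢m))) (ℕP.≤-reflexive (ℕP.m+n∸m≡n p q))

    good : Good (A ++ join m βs ∷ shift p B)
    good = Good-++⁺ A (proj₁ goods)
      (Good⇒Pat-join m βs (left<m ∘ ∈-concat-++⁺ʳ A) (proj₁ (proj₂ goods)) , join-disj , Good-shift⁺ p B r.good)
      λ a∈A a∈ → [ (λ a∈j → [ (λ { refl → m∉left (∈-concat-++⁺ˡ A a∈A) }) , proj₂ (proj₂ goods) a∈A ]′ (∈-join⁻ m βs a∈j))
                 , left-right (∈-concat-++⁺ˡ A a∈A) ]′ (∈-++⁻ (join m βs) a∈)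
      where
      join-disj : Disj (join m βs) (concat (shift p B))
      join-disj a∈ a∈B = [ (λ { refl → m∉right a∈B }) , (λ a∈β → left-right (∈-concat-++⁺ʳ A a∈β) a∈B) ]′ (∈-join⁻ m βs a∈)

    sorted : stackSort (concatMap stackSort (A ++ join m βs ∷ shift p B)) ≡ letters m
    sorted = begin
      stackSort (concatMap stackSort (A ++ join m βs ∷ shift p B))
        ≡⟨ sort-insert m A b c bs (shift p B) left<m right<m ⟩
      (stackSort (concatMap stackSort (A ++ βs)) ++ stackSort (concatMap stackSort (shift p B))) ++ m ∷ []
        ≡⟨ cong₂ (λ u v → (u ++ v) ++ m ∷ []) l.sorted (trans (cong stackSort (concatMap-stackSort-shift p B))
             (trans (stackSort-shift p (concatMap stackSort B)) (cong (map (_+_ p)) r.sorted))) ⟩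
      (letters p ++ map (_+_ p) (letters q)) ++ m ∷ []
        ≡⟨ cong (_++ m ∷ []) (letters-+ p q) ⟨
      letters (p + q) ++ m ∷ []
        ≡⟨ letters-suc (p + q) ⟨
      letters m ∎
      where open ≡-Reasoning

++-injective : ∀ {X : Set} (us vs : List X) {us′ vs′} → length us ≡ length vs → us ++ us′ ≡ vs ++ vs′ → us ≡ vs × us′ ≡ vs′
++-injective [] [] _ eq = refl , eq
++-injective (u ∷ us) (v ∷ vs) len eq with LP.∷-injective eq
... | refl , eq′ with ++-injective us vs (ℕP.suc-injective len) eq′
...   | refl , eq″ = refl , eq″

unshift : ℕ → List Word → List Word
unshift p = map (map (_∸ p))

shift-unshift : ∀ p ws → (∀ {a} → a ∈ concat ws → p ≤ a) → shift p (unshift p ws) ≡ ws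
shift-unshift p [] _ = refl
shift-unshift p (w ∷ ws) p≤ = cong₂ _∷_ (word w (p≤ ∘ ∈-++⁺ˡ)) (shift-unshift p ws (p≤ ∘ ∈-++⁺ʳ w))
  where
  word : ∀ w → (∀ {a} → a ∈ w → p ≤ a) → map (_+_ p) (map (_∸ p) w) ≡ w
  word [] _ = refl
  word (a ∷ w) p≤ = cong₂ _∷_ (ℕP.m+[n∸m]≡n (p≤ (here refl))) (word w (p≤ ∘ there))

unshift-shift : ∀ p ws → unshift p (shift p ws) ≡ ws
unshift-shift p [] = refl
unshift-shift p (w ∷ ws) = cong₂ _∷_ (word w) (unshift-shift p ws)
  where
  word : ∀ w → map (_∸ p) (map (_+_ p) w) ≡ w
  word [] = refl
  word (a ∷ w) = cong₂ _∷_ (ℕP.m+n∸m≡n p a) (word w)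

-- A two-stack-sortable tuple sorts to `letters p`, so this length recovers `p`; it locates the
-- border between the small and the large letters when a tuple is taken apart.
sortedLength : List Word → ℕ
sortedLength ws = length (stackSort (concatMap stackSort ws))

module _ {r n : ℕ} (A : List Word) (b c : Word) (bs B : List Word) where

  private
    βs : List Word
    βs = b ∷ c ∷ bs
    m : ℕ
    m = suc n
    p = sortedLength (A ++ βs)

  -- By `sort-insert` the sorted word without its last letter is `left ++ right`, and it equals
  -- `letters n`. So `left` is an initial segment `letters p` and `right` consists of the letters
  -- above `p`. Sorting loses no letter, hence these bounds hold for the unsorted words as well, and
  -- each half is sortable by itself.
  weak-remove : m ∉ concat βs → Weak r m (A ++ join m βs ∷ B) →
    length βs ≡ suc r × p ≤ n × Weak r p (A ++ βs) × Weak r (n ∸ p) (unshift p B) × shift p (unshift p B) ≡ B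
  weak-remove m∉β w = len , p≤n ,
    record { range = rangeˡ ; count = countˡ ; good = goodˡ ; sorted = proj₁ sorted² } ,
    record { range = rangeʳ ; count = countʳ ; good = goodʳ ; sorted = sortedʳ } , shifted
    where
    module w = Weak w
    goods = Good-++⁻ A w.good
    A-rest = proj₂ (proj₂ goods)
    pat-join = proj₁ (proj₁ (proj₂ goods))
    join-B = proj₁ (proj₂ (proj₁ (proj₂ goods)))
    good-B = proj₂ (proj₂ (proj₁ (proj₂ goods)))

    m∈join : m ∈ join m βs
    m∈join = ∈-++⁺ʳ b (here refl)

    m∉A : m ∉ concat A
    m∉A m∈ = A-rest m∈ (∈-++⁺ˡ m∈join)

    m∉B : m ∉ concat B
    m∉B = join-B m∈join

    β∈ : ∀ {a} → a ∈ concat βs → a ∈ join m βs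
    β∈ = ∈-join⁺ m βs

    left<m : ∀ {a} → a ∈ concat (A ++ βs) → a < m
    left<m a∈ = [ (λ a∈A → ℕP.≤∧≢⇒< (proj₂ (w.range (∈-concat-++⁺ˡ A a∈A))) (λ { refl → m∉A a∈A }))
                , (λ a∈β → ℕP.≤∧≢⇒< (proj₂ (w.range (∈-concat-++⁺ʳ A (∈-++⁺ˡ (β∈ a∈β))))) (λ { refl → m∉β a∈β })) ]′
                (∈-concat-++⁻ A a∈)

    B-range : ∀ {a} → a ∈ concat B → 1 ≤ a × a ≤ m
    B-range a∈ = w.range (∈-concat-++⁺ʳ A (∈-++⁺ʳ (join m βs) a∈))

    right<m : ∀ {a} → a ∈ concat B → a < m
    right<m a∈ = ℕP.≤∧≢⇒< (proj₂ (B-range a∈)) (λ { refl → m∉B a∈ })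

    len : length βs ≡ suc r
    len = trans (sym (occ-join m βs (λ ()) m∉β)) (cong suc (trans
      (sym (occ-insert m A (join m βs) B m∉A m∉B)) (w.count (s≤s z≤n) ℕP.≤-refl)))

    left right : Word
    left = stackSort (concatMap stackSort (A ++ βs))
    right = stackSort (concatMap stackSort B)

    halves : left ++ right ≡ letters n
    halves = LP.∷ʳ-injectiveˡ (left ++ right) (letters n)
      (trans (sym (sort-insert m A b c bs B left<m right<m)) (trans w.sorted (letters-suc n)))

    p≤n : p ≤ n
    p≤n = ℕP.≤-trans (ℕP.m≤m+n p (length right)) (ℕP.≤-reflexive
      (trans (sym (LP.length-++ left)) (trans (cong length halves) (length-letters n))))

    p+q : p + (n ∸ p) ≡ n
    p+q = ℕP.m+[n∸m]≡n p≤n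

    sorted² : left ≡ letters p × right ≡ map (_+_ p) (letters (n ∸ p))
    sorted² = ++-injective left (letters p) (sym (length-letters p))
      (trans halves (trans (cong letters (sym p+q)) (letters-+ p (n ∸ p))))

    rangeˡ : ∀ {a} → a ∈ concat (A ++ βs) → 1 ≤ a × a ≤ p
    rangeˡ a∈ = ∈-letters⁻ (subst (_ ∈_) (proj₁ sorted²) (∈-sorted⁺ (A ++ βs) a∈))

    inB : ∀ {a} → a ∈ concat B → ∃[ a′ ] (a′ ∈ letters (n ∸ p) × a ≡ p + a′)
    inB a∈ = ∈-map⁻ (_+_ p) (subst (_ ∈_) (proj₂ sorted²) (∈-sorted⁺ B a∈))

    p<B : ∀ {a} → a ∈ concat B → p < a
    p<B a∈ with inB a∈
    ... | a′ , a′∈ , refl = ℕP.m<m+n p (proj₁ (∈-letters⁻ a′∈))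

    countˡ : ∀ {a} → 1 ≤ a → a ≤ p → occ a (concat (A ++ βs)) ≡ r
    countˡ {a} 1≤a a≤p = begin
      occ a (concat (A ++ βs))                        ≡⟨ ℕP.+-identityʳ _ ⟨
      occ a (concat (A ++ βs)) + 0                    ≡⟨ cong (_+_ (occ a (concat (A ++ βs)))) (occ-∉ (concat B) (λ a∈ → ℕP.<⇒≱ (p<B a∈) a≤p)) ⟨
      occ a (concat (A ++ βs)) + occ a (concat B)     ≡⟨ occ-insert-≢ m A βs B (λ { refl → ℕP.<⇒≱ (s≤s p≤n) a≤p }) ⟨
      occ a (concat (A ++ join m βs ∷ B))             ≡⟨ w.count 1≤a (ℕP.≤-trans a≤p (ℕP.m≤n⇒m≤1+n p≤n)) ⟩
      r                                               ∎
      where open ≡-Reasoning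

    goodˡ : Good (A ++ βs)
    goodˡ = Good-++⁺ A (proj₁ goods) (Pat-join⇒Good m βs (left<m ∘ ∈-concat-++⁺ʳ A) pat-join)
      (λ a∈A a∈β → A-rest a∈A (∈-++⁺ˡ (β∈ a∈β)))

    shifted : shift p (unshift p B) ≡ B
    shifted = shift-unshift p B (ℕP.<⇒≤ ∘ p<B)

    concat-B : concat B ≡ map (_+_ p) (concat (unshift p B))
    concat-B = trans (cong concat (sym shifted)) (concat-shift p (unshift p B))

    rangeʳ : ∀ {a} → a ∈ concat (unshift p B) → 1 ≤ a × a ≤ n ∸ p
    rangeʳ {a} a∈ with inB (subst (p + a ∈_) (sym concat-B) (∈-shift⁺ p a∈))
    ... | a′ , a′∈ , eq = ∈-letters⁻ (subst (_∈ letters (n ∸ p)) (sym (ℕP.+-cancelˡ-≡ p a a′ eq)) a′∈)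

    countʳ : ∀ {a} → 1 ≤ a → a ≤ n ∸ p → occ a (concat (unshift p B)) ≡ r
    countʳ {a} 1≤a a≤q = begin
      occ a (concat (unshift p B))                                  ≡⟨ occ-shift p a (concat (unshift p B)) ⟨
      occ (p + a) (map (_+_ p) (concat (unshift p B)))               ≡⟨ cong (occ (p + a)) concat-B ⟨
      occ (p + a) (concat B)                                        ≡⟨ cong (_+ occ (p + a) (concat B)) (occ-∉ (concat (A ++ βs)) (λ a∈ → ℕP.<⇒≱ (ℕP.m<m+n p 1≤a) (proj₂ (rangeˡ a∈)))) ⟨
      occ (p + a) (concat (A ++ βs)) + occ (p + a) (concat B)       ≡⟨ occ-insert-≢ m A βs B (λ eq → ℕP.<-irrefl eq (s≤s p+a≤n)) ⟨
      occ (p + a) (concat (A ++ join m βs ∷ B))                     ≡⟨ w.count (ℕP.≤-trans 1≤a (ℕP.m≤n+m a p)) (ℕP.m≤n⇒m≤1+n p+a≤n) ⟩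
      r                                                             ∎
      where
      open ≡-Reasoning
      p+a≤n : p + a ≤ n
      p+a≤n = ℕP.≤-trans (ℕP.+-monoʳ-≤ p a≤q) (ℕP.≤-reflexive p+q)

    goodʳ : Good (unshift p B)
    goodʳ = Good-shift⁻ p (unshift p B) (subst Good (sym shifted) good-B)

    sortedʳ : stackSort (concatMap stackSort (unshift p B)) ≡ letters (n ∸ p)
    sortedʳ = LP.map-injective (ℕP.+-cancelˡ-≡ p _ _) (begin
      map (_+_ p) (stackSort (concatMap stackSort (unshift p B)))      ≡⟨ stackSort-shift p (concatMap stackSort (unshift p B)) ⟨
      stackSort (map (_+_ p) (concatMap stackSort (unshift p B)))      ≡⟨ cong stackSort (concatMap-stackSort-shift p (unshift p B)) ⟨
      stackSort (concatMap stackSort (shift p (unshift p B)))         ≡⟨ cong (stackSort ∘ concatMap stackSort) shifted ⟩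
      right                                                           ≡⟨ proj₂ sorted² ⟩
      map (_+_ p) (letters (n ∸ p))                                    ∎)
      where open ≡-Reasoning

-- Descents

smallerHead : ℕ → Word → Bool
smallerHead a [] = false
smallerHead a (b ∷ _) = b <ᵇ a

smallerThan : ℕ → Maybe ℕ → Bool
smallerThan a = maybe (λ p → p <ᵇ a) false

isDesc : ℕ → Maybe ℕ → Word → ℕ → Word → Bool
isDesc zero p s a w = smallerThan a p ∧ (occ a s ≡ᵇ 0)
isDesc (suc i) p s a w = smallerHead a w ∧ (occ a s ≡ᵇ i)

bit : Bool → ℕ
bit b = if b then 1 else 0

desc : ℕ → Maybe ℕ → Word → Word → ℕ
desc j p s [] = 0
desc j p s (a ∷ w) = bit (isDesc j p s a w) + desc j (just a) (a ∷ s) w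

-- descType is defined by a where-local function that has no name outside its clause; the
-- with-abstractions generalise its arguments so that unification can fill it in for the
-- underscore in the type of local-desc.
mutual
  descType-zero : ∀ a w → descType 0 (a ∷ w) ≡ desc 0 nothing [] (a ∷ w)
  descType-zero a w with a ∷ w
  ... | u with 0 | just a | L.[ a ] | w
  ... | j | p | s | v = local-desc j u p s v

  local-desc : ∀ j u p s v → _ ≡ desc j p s v
  local-desc j u p s [] = refl
  local-desc zero u p s (a ∷ v) = cong (_+_ (bit (isDesc zero p s a v))) (local-desc zero u (just a) (a ∷ s) v)
  local-desc (suc j) u p s (a ∷ []) = local-desc (suc j) u (just a) (a ∷ s) []
  local-desc (suc j) u p s (a ∷ v@(b ∷ _)) =
    cong (_+_ (bit (isDesc (suc j) p s a v))) (local-desc (suc j) u (just a) (a ∷ s) v)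

descType-desc : ∀ j w → descType j w ≡ desc j nothing [] w
descType-desc j w = local-desc j w nothing [] w

≥⇒<ᵇ-false : ∀ {a b} → b ≤ a → (a <ᵇ b) ≡ false
≥⇒<ᵇ-false {a} {zero} _ = refl
≥⇒<ᵇ-false {suc a} {suc b} (s≤s le) = ≥⇒<ᵇ-false le

<⇒<ᵇ-true : ∀ {a b} → a < b → (a <ᵇ b) ≡ true
<⇒<ᵇ-true {zero} {suc b} _ = refl
<⇒<ᵇ-true {suc a} {suc b} (s≤s lt) = <⇒<ᵇ-true lt

lastOr : Maybe ℕ → Word → Maybe ℕ
lastOr p [] = p
lastOr p (a ∷ u) = lastOr (just a) u

-- All that `desc` uses of the text read before `u`: how often each letter has been seen, and how
-- the preceding letter compares. A factor can therefore be counted as if it stood alone.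
record Similar (u : Word) (p p′ : Maybe ℕ) (s s′ : Word) : Set where
  field
    sameOcc  : ∀ {a} → a ∈ u → occ a s ≡ occ a s′
    samePrev : ∀ {a} → a ∈ u → smallerThan a p ≡ smallerThan a p′

similar-tail : ∀ {a u p p′ s s′} → Similar (a ∷ u) p p′ s s′ → Similar u (just a) (just a) (a ∷ s) (a ∷ s′)
similar-tail {a} sim = record
  { sameOcc = λ {b} b∈ → cong (_+_ (bit (a ≡ᵇ b))) (Similar.sameOcc sim (there b∈)) ; samePrev = λ _ → refl }

isDesc-cong : ∀ j {p p′ s s′ a w w′} → smallerThan a p ≡ smallerThan a p′ → occ a s ≡ occ a s′ →
              smallerHead a w ≡ smallerHead a w′ → isDesc j p s a w ≡ isDesc j p′ s′ a w′
isDesc-cong zero ep es ew = cong₂ _∧_ ep (cong (_≡ᵇ 0) es)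
isDesc-cong (suc j) ep es ew = cong₂ _∧_ ew (cong (_≡ᵇ j) es)

desc-similar : ∀ j u {p p′ s s′} → Similar u p p′ s s′ → desc j p s u ≡ desc j p′ s′ u
desc-similar j [] sim = refl
desc-similar j (a ∷ u) {p} {p′} sim = cong₂ _+_
  (cong bit (isDesc-cong j {p} {p′} {w = u} {w′ = u} (samePrev (here refl)) (sameOcc (here refl)) refl))
  (desc-similar j u (similar-tail sim))
  where open Similar sim

-- The letter `m` after `u` is larger than the last letter of `u`, so like the end of a word it
-- creates no descent there.
desc-prefix : ∀ j u {p p′ s s′} m w → (∀ {a} → a ∈ u → a < m) → Similar u p p′ s s′ →
  desc j p s (u ++ m ∷ w) ≡ desc j p′ s′ u + desc j (lastOr p u) (u ʳ++ s) (m ∷ w)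
desc-prefix j [] m w <m sim = refl
desc-prefix j (a ∷ u) {p} {p′} {s} {s′} m w <m sim = trans
  (cong₂ _+_ (cong bit (isDesc-cong j {p} {p′} {w = u ++ m ∷ w} {w′ = u} (samePrev (here refl)) (sameOcc (here refl)) (next u)))
    (desc-prefix j u m w (<m ∘ there) (similar-tail sim)))
  (sym (ℕP.+-assoc (bit (isDesc j p′ s′ a u)) _ _))
  where
  open Similar sim
  next : ∀ u → smallerHead a (u ++ m ∷ w) ≡ smallerHead a u
  next [] = ≥⇒<ᵇ-false (ℕP.<⇒≤ (<m (here refl)))
  next (_ ∷ _) = refl

occ-ʳ++ : ∀ a u s → occ a (u ʳ++ s) ≡ occ a u + occ a s
occ-ʳ++ a [] s = refl
occ-ʳ++ a (b ∷ u) s = trans (occ-ʳ++ a u (b ∷ s)) (trans (ℕ+.x∙yz≈y∙xz (occ a u) (bit (b ≡ᵇ a)) (occ a s))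
  (sym (ℕP.+-assoc (bit (b ≡ᵇ a)) (occ a u) (occ a s))))

nonEmptyᵇ : Word → Bool
nonEmptyᵇ [] = false
nonEmptyᵇ (_ ∷ _) = true

-- k numbers the occurrences of the largest letter from 0, and b, c are the factors around it.
separatorDesc : ℕ → ℕ → Word → Word → Bool
separatorDesc zero k b c = nonEmptyᵇ b ∧ (k ≡ᵇ 0)
separatorDesc (suc i) k b c = nonEmptyᵇ c ∧ (k ≡ᵇ i)

separatorDescs : ℕ → ℕ → List Word → ℕ
separatorDescs j k [] = 0
separatorDescs j k (b ∷ []) = 0
separatorDescs j k (b ∷ bs@(c ∷ _)) = bit (separatorDesc j k b c) + separatorDescs j (suc k) bs

totalDesc : ℕ → List Word → ℕ
totalDesc j T = sum (map (descType j) T)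

smallerThan-lastOr : ∀ m b p → (∀ {a} → a ∈ b → a < m) → smallerThan m p ≡ false → smallerThan m (lastOr p b) ≡ nonEmptyᵇ b
smallerThan-lastOr m [] p <m pf = pf
smallerThan-lastOr m (a ∷ []) p <m pf = <⇒<ᵇ-true (<m (here refl))
smallerThan-lastOr m (a ∷ b@(_ ∷ _)) p <m pf = smallerThan-lastOr m b nothing (<m ∘ there) refl

smallerHead-join : ∀ m c cs → (∀ {a} → a ∈ c → a < m) → smallerHead m (join m (c ∷ cs)) ≡ nonEmptyᵇ c
smallerHead-join m [] [] _ = refl
smallerHead-join m [] (_ ∷ _) _ = ≥⇒<ᵇ-false {m} {m} ℕP.≤-refl
smallerHead-join m (a ∷ c) [] <m = <⇒<ᵇ-true (<m (here refl))
smallerHead-join m (a ∷ c) (_ ∷ _) <m = <⇒<ᵇ-true (<m (here refl))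

module _ (j m : ℕ) where

  -- Generalised to the middle of a word, just after `k` copies of `m`: the remaining factors share
  -- no letter with the text already read, and the preceding letter, being absent or `m`, is never
  -- smaller.
  desc-join : ∀ k bs p s → (∀ {a} → a ∈ concat bs → a < m) → Good bs → (∀ {a} → a ∈ concat bs → occ a s ≡ 0) →
    occ m s ≡ k → (∀ {a} → a ≤ m → smallerThan a p ≡ false) →
    desc j p s (join m bs) ≡ totalDesc j bs + separatorDescs j k bs
  desc-join k [] p s _ _ _ _ _ = refl
  desc-join k (b ∷ []) p s <m g unseen _ prev = begin
    desc j p s b                   ≡⟨ desc-similar j b (record { sameOcc = unseen ∘ ∈-++⁺ˡ ; samePrev = prev ∘ ℕP.<⇒≤ ∘ <m ∘ ∈-++⁺ˡ }) ⟩
    desc j nothing [] b            ≡⟨ descType-desc j b ⟨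
    descType j b                   ≡⟨ trans (ℕP.+-identityʳ _) (ℕP.+-identityʳ _) ⟨
    totalDesc j (b ∷ []) + 0       ∎
    where open ≡-Reasoning
  desc-join k (b ∷ bs@(c ∷ cs)) p s <m (_ , db , g) unseen seen prev = begin
    desc j p s (b ++ m ∷ join m bs)
      ≡⟨ desc-prefix j b m (join m bs) (<m ∘ ∈-++⁺ˡ) (record { sameOcc = unseen ∘ ∈-++⁺ˡ ; samePrev = prev ∘ ℕP.<⇒≤ ∘ <m ∘ ∈-++⁺ˡ }) ⟩
    desc j nothing [] b + (bit (isDesc j (lastOr p b) (b ʳ++ s) m (join m bs)) + desc j (just m) (m ∷ b ʳ++ s) (join m bs))
      ≡⟨ cong₂ (λ x y → x + (bit y + desc j (just m) (m ∷ b ʳ++ s) (join m bs))) (sym (descType-desc j b)) (separator j) ⟩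
    descType j b + (bit (separatorDesc j k b c) + desc j (just m) (m ∷ b ʳ++ s) (join m bs))
      ≡⟨ cong (λ x → descType j b + (bit (separatorDesc j k b c) + x))
           (desc-join (suc k) bs (just m) (m ∷ b ʳ++ s) (<m ∘ ∈-++⁺ʳ b) g unseen′ seen′ (λ a≤m → ≥⇒<ᵇ-false a≤m)) ⟩
    descType j b + (bit (separatorDesc j k b c) + (totalDesc j bs + separatorDescs j (suc k) bs))
      ≡⟨ cong (_+_ (descType j b)) (ℕ+.x∙yz≈y∙xz (bit (separatorDesc j k b c)) (totalDesc j bs) _) ⟩
    descType j b + (totalDesc j bs + separatorDescs j k (b ∷ bs))
      ≡⟨ ℕP.+-assoc (descType j b) _ _ ⟨
    totalDesc j (b ∷ bs) + separatorDescs j k (b ∷ bs) ∎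
    where
    open ≡-Reasoning
    m∉b : m ∉ b
    m∉b m∈ = ℕP.<-irrefl refl (<m (∈-++⁺ˡ m∈))
    occ-m : occ m (b ʳ++ s) ≡ k
    occ-m = trans (occ-ʳ++ m b s) (cong₂ _+_ (occ-∉ b m∉b) seen)
    unseen′ : ∀ {a} → a ∈ concat bs → occ a (m ∷ b ʳ++ s) ≡ 0
    unseen′ {a} a∈ = cong₂ _+_ (cong bit (≢⇒≡ᵇ {m} {a} (λ { refl → ℕP.<-irrefl refl (<m (∈-++⁺ʳ b a∈)) })))
      (trans (occ-ʳ++ a b s) (cong₂ _+_ (occ-∉ b (λ a∈b → db a∈b a∈)) (unseen (∈-++⁺ʳ b a∈))))
    seen′ : occ m (m ∷ b ʳ++ s) ≡ suc k
    seen′ = cong₂ (λ x y → bit x + y) (≡ᵇ-refl m) occ-m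
    separator : ∀ j → isDesc j (lastOr p b) (b ʳ++ s) m (join m bs) ≡ separatorDesc j k b c
    separator zero = cong₂ _∧_ (smallerThan-lastOr m b p (<m ∘ ∈-++⁺ˡ) (prev ℕP.≤-refl)) (cong (_≡ᵇ 0) occ-m)
    separator (suc i) = cong₂ _∧_ (smallerHead-join m c cs (<m ∘ ∈-++⁺ʳ b ∘ ∈-++⁺ˡ)) (cong (_≡ᵇ i) occ-m)

nonEmptyAt : ℕ → List Word → Bool
nonEmptyAt _ [] = false
nonEmptyAt zero (b ∷ _) = nonEmptyᵇ b
nonEmptyAt (suc j) (_ ∷ bs) = nonEmptyAt j bs

separatorDescs-late : ∀ i k bs → i < k → separatorDescs (suc i) k bs ≡ 0
separatorDescs-late i k [] _ = refl
separatorDescs-late i k (b ∷ []) _ = refl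
separatorDescs-late i k (b ∷ bs@(c ∷ _)) i<k = cong₂ _+_
  (cong bit (trans (cong (nonEmptyᵇ c ∧_) (≢⇒≡ᵇ {k} {i} (λ eq → ℕP.<-irrefl (sym eq) i<k))) (∧-zeroʳ (nonEmptyᵇ c))))
  (separatorDescs-late i (suc k) bs (ℕP.m≤n⇒m≤1+n i<k))

separatorDescs-zero : ∀ k bs → separatorDescs 0 (suc k) bs ≡ 0
separatorDescs-zero k [] = refl
separatorDescs-zero k (b ∷ []) = refl
separatorDescs-zero k (b ∷ bs@(_ ∷ _)) = cong₂ _+_ (cong bit (∧-zeroʳ (nonEmptyᵇ b))) (separatorDescs-zero (suc k) bs)

-- Type `suc (i + k)` examines copy `i + k` of the largest letter, counted from 0. It comes `i`
-- copies after the current one, and the factor behind it is entry `i` of `bs`.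
separatorDescs-suc : ∀ i k b bs → separatorDescs (suc (i + k)) k (b ∷ bs) ≡ bit (nonEmptyAt i bs)
separatorDescs-suc i k b [] = refl
separatorDescs-suc zero k b bs@(c ∷ _) rewrite ≡ᵇ-refl k | separatorDescs-late k (suc k) bs ℕP.≤-refl
  with nonEmptyᵇ c
... | true = refl
... | false = refl
separatorDescs-suc (suc i) k b bs@(c ∷ cs) = cong₂ _+_
  (cong bit (trans (cong (nonEmptyᵇ c ∧_) (≢⇒≡ᵇ {k} {suc i + k} (λ eq → ℕP.<-irrefl eq (s≤s (ℕP.m≤n+m k i))))) (∧-zeroʳ (nonEmptyᵇ c))))
  (trans (cong (λ x → separatorDescs (suc x) (suc k) bs) (sym (ℕP.+-suc i k))) (separatorDescs-suc i (suc k) c cs))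

-- Type 0 asks for a smaller letter before the first copy, that is for a nonempty factor 0; a type
-- `j ≥ 1` asks for one after copy `j`, that is for a nonempty factor `j`. So the `r + 1` types
-- correspond to the `r + 1` factors.
separatorDescs-first : ∀ j b c bs → separatorDescs j 0 (b ∷ c ∷ bs) ≡ bit (nonEmptyAt j (b ∷ c ∷ bs))
separatorDescs-first zero b c bs rewrite separatorDescs-zero 0 (c ∷ bs) with nonEmptyᵇ b
... | true = refl
... | false = refl
separatorDescs-first (suc i) b c bs = trans
  (cong (λ x → separatorDescs (suc x) 0 (b ∷ c ∷ bs)) (sym (ℕP.+-identityʳ i)))
  (separatorDescs-suc i 0 b (c ∷ bs))

descType-join : ∀ j m b c bs → (∀ {a} → a ∈ concat (b ∷ c ∷ bs) → a < m) → Good (b ∷ c ∷ bs) →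
  descType j (join m (b ∷ c ∷ bs)) ≡ totalDesc j (b ∷ c ∷ bs) + bit (nonEmptyAt j (b ∷ c ∷ bs))
descType-join j m b c bs <m g = trans (descType-desc j (join m (b ∷ c ∷ bs)))
  (trans (desc-join j m 0 (b ∷ c ∷ bs) nothing [] <m g (λ _ → refl) refl (λ _ → refl))
    (cong (_+_ (totalDesc j (b ∷ c ∷ bs))) (separatorDescs-first j b c bs)))

<ᵇ-shift : ∀ p a b → (p + a <ᵇ p + b) ≡ (a <ᵇ b)
<ᵇ-shift zero a b = refl
<ᵇ-shift (suc p) a b = <ᵇ-shift p a b

desc-shift : ∀ j q p s w → desc j (Maybe.map (_+_ q) p) (map (_+_ q) s) (map (_+_ q) w) ≡ desc j p s w
desc-shift j q p s [] = refl
desc-shift j q p s (a ∷ w) = cong₂ _+_ (cong bit (same j)) (desc-shift j q (just a) (a ∷ s) w)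
  where
  samePrev : ∀ p → smallerThan (q + a) (Maybe.map (_+_ q) p) ≡ smallerThan a p
  samePrev nothing = refl
  samePrev (just b) = <ᵇ-shift q b a
  sameHead : ∀ w → smallerHead (q + a) (map (_+_ q) w) ≡ smallerHead a w
  sameHead [] = refl
  sameHead (b ∷ _) = <ᵇ-shift q b a
  same : ∀ j → isDesc j (Maybe.map (_+_ q) p) (map (_+_ q) s) (q + a) (map (_+_ q) w) ≡ isDesc j p s a w
  same zero = cong₂ _∧_ (samePrev p) (cong (_≡ᵇ 0) (occ-shift q a s))
  same (suc i) = cong₂ _∧_ (sameHead w) (cong (_≡ᵇ i) (occ-shift q a s))

descType-shift : ∀ j q w → descType j (map (_+_ q) w) ≡ descType j w
descType-shift j q w = trans (descType-desc j (map (_+_ q) w)) (trans (desc-shift j q nothing [] w) (sym (descType-desc j w)))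

totalDesc-shift : ∀ j q ws → totalDesc j (shift q ws) ≡ totalDesc j ws
totalDesc-shift j q [] = refl
totalDesc-shift j q (w ∷ ws) = cong₂ _+_ (descType-shift j q w) (totalDesc-shift j q ws)

totalDesc-++ : ∀ j A B → totalDesc j (A ++ B) ≡ totalDesc j A + totalDesc j B
totalDesc-++ j A B = trans (cong sum (LP.map-++ (descType j) A B)) (SumP.sum-++ (map (descType j) A) (map (descType j) B))

totalDesc-dropEmpty : ∀ j ws → totalDesc j (dropEmpty ws) ≡ totalDesc j ws
totalDesc-dropEmpty j [] = refl
totalDesc-dropEmpty j ([] ∷ ws) = totalDesc-dropEmpty j ws
totalDesc-dropEmpty j (w@(_ ∷ _) ∷ ws) = cong (_+_ (descType j w)) (totalDesc-dropEmpty j ws)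

totalDesc-insert : ∀ j m A b c bs p B → (∀ {a} → a ∈ concat (b ∷ c ∷ bs) → a < m) → Good (b ∷ c ∷ bs) →
  totalDesc j (A ++ join m (b ∷ c ∷ bs) ∷ shift p B) ≡
  bit (nonEmptyAt j (b ∷ c ∷ bs)) + (totalDesc j (A ++ dropEmpty (b ∷ c ∷ bs)) + totalDesc j B)
totalDesc-insert j m A b c bs p B <m g = begin
  totalDesc j (A ++ join m βs ∷ shift p B)
    ≡⟨ totalDesc-++ j A (join m βs ∷ shift p B) ⟩
  totalDesc j A + (descType j (join m βs) + totalDesc j (shift p B))
    ≡⟨ cong₂ (λ x y → totalDesc j A + (x + y)) (descType-join j m b c bs <m g) (totalDesc-shift j p B) ⟩
  totalDesc j A + ((totalDesc j βs + e) + totalDesc j B)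
    ≡⟨ cong (λ x → totalDesc j A + (x + totalDesc j B)) (ℕP.+-comm (totalDesc j βs) e) ⟩
  totalDesc j A + ((e + totalDesc j βs) + totalDesc j B)
    ≡⟨ cong (_+_ (totalDesc j A)) (ℕP.+-assoc e _ _) ⟩
  totalDesc j A + (e + (totalDesc j βs + totalDesc j B))
    ≡⟨ ℕ+.x∙yz≈y∙xz (totalDesc j A) e _ ⟩
  e + (totalDesc j A + (totalDesc j βs + totalDesc j B))
    ≡⟨ cong (_+_ e) (ℕP.+-assoc (totalDesc j A) _ _) ⟨
  e + ((totalDesc j A + totalDesc j βs) + totalDesc j B)
    ≡⟨ cong (λ x → e + (x + totalDesc j B)) (trans (cong (_+_ (totalDesc j A)) (sym (totalDesc-dropEmpty j βs))) (sym (totalDesc-++ j A (dropEmpty βs)))) ⟩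
  e + (totalDesc j (A ++ dropEmpty βs) + totalDesc j B) ∎
  where
  open ≡-Reasoning
  βs = b ∷ c ∷ bs
  e = bit (nonEmptyAt j βs)

occupancy : ∀ k → List Word → Vec Bool k
occupancy zero _ = []
occupancy (suc k) [] = false ∷ occupancy k []
occupancy (suc k) (b ∷ bs) = nonEmptyᵇ b ∷ occupancy k bs

lookup-occupancy : ∀ {k} bs (j : Fin k) → lookup (occupancy k bs) j ≡ nonEmptyAt (toℕ j) bs
lookup-occupancy [] zero = refl
lookup-occupancy [] (suc j) = lookup-occupancy [] j
lookup-occupancy (b ∷ bs) zero = refl
lookup-occupancy (b ∷ bs) (suc j) = lookup-occupancy bs j

lookup-ext : ∀ {X : Set} {k} {u v : Vec X k} → (∀ i → lookup u i ≡ lookup v i) → u ≡ v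
lookup-ext {u = u} {v} eq = trans (sym (VP.tabulate∘lookup u)) (trans (VP.tabulate-cong eq) (VP.tabulate∘lookup v))

weightVec-insert : ∀ r m A b c bs p B → (∀ {a} → a ∈ concat (b ∷ c ∷ bs) → a < m) → Good (b ∷ c ∷ bs) →
  weightVec r (A ++ join m (b ∷ c ∷ bs) ∷ shift p B) ≡
  indicator (occupancy (suc r) (b ∷ c ∷ bs)) ⊕ (weightVec r (A ++ dropEmpty (b ∷ c ∷ bs)) ⊕ weightVec r B)
weightVec-insert r m A b c bs p B <m g = lookup-ext λ i → begin
  lookup (weightVec r (A ++ join m βs ∷ shift p B)) i
    ≡⟨ VP.lookup∘tabulate (λ j → totalDesc (toℕ j) (A ++ join m βs ∷ shift p B)) i ⟩
  totalDesc (toℕ i) (A ++ join m βs ∷ shift p B)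
    ≡⟨ totalDesc-insert (toℕ i) m A b c bs p B <m g ⟩
  bit (nonEmptyAt (toℕ i) βs) + (totalDesc (toℕ i) (A ++ dropEmpty βs) + totalDesc (toℕ i) B)
    ≡⟨ cong₂ _+_ (trans (VP.lookup-map i bit S) (cong bit (lookup-occupancy βs i)))
         (trans (VP.lookup-zipWith _+_ i (weightVec r (A ++ dropEmpty βs)) (weightVec r B))
           (cong₂ _+_ (VP.lookup∘tabulate (λ j → totalDesc (toℕ j) (A ++ dropEmpty βs)) i)
                      (VP.lookup∘tabulate (λ j → totalDesc (toℕ j) B) i))) ⟨
  lookup (indicator S) i + lookup (weightVec r (A ++ dropEmpty βs) ⊕ weightVec r B) i
    ≡⟨ VP.lookup-zipWith _+_ i (indicator S) (weightVec r (A ++ dropEmpty βs) ⊕ weightVec r B) ⟨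
  lookup (indicator S ⊕ (weightVec r (A ++ dropEmpty βs) ⊕ weightVec r B)) i ∎
  where
  open ≡-Reasoning
  βs = b ∷ c ∷ bs
  S = occupancy (suc r) βs

-- Enumeration

module _ {A B : Set} where

  ∈-concatMap-intro : ∀ (f : A → List B) {xs x y} → x ∈ xs → y ∈ f x → y ∈ concatMap f xs
  ∈-concatMap-intro f x∈ y∈ = ∈-concatMap⁺ f (Any.map (λ { refl → y∈ }) x∈)

  ∈-concatMap-elim : ∀ (f : A → List B) {xs y} → y ∈ concatMap f xs → ∃[ x ] (x ∈ xs × y ∈ f x)
  ∈-concatMap-elim f {xs} y∈ = find (∈-concatMap⁻ f {xs = xs} y∈)

  -- Different blocks are disjoint because `g` recovers from an element the block that it belongs
  -- to.
  unique-concatMap : ∀ (f : A → List B) (g : B → A) xs → Unique xs → (∀ {x} → x ∈ xs → Unique (f x)) →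
    (∀ {x y} → x ∈ xs → y ∈ f x → g y ≡ x) → Unique (concatMap f xs)
  unique-concatMap f g [] _ _ _ = []
  unique-concatMap f g (x ∷ xs) (x∉ ∷ uxs) uf gf = UP.++⁺ (uf (here refl))
    (unique-concatMap f g xs uxs (uf ∘ there) (gf ∘ there))
    λ { (y∈ , y∈′) → case ∈-concatMap-elim f {xs} y∈′ of λ { (x′ , x′∈ , y∈″) →
      All.lookup x∉ x′∈ (trans (sym (gf (here refl) y∈)) (gf (there x′∈) y∈″)) } }

  unique-map : ∀ (f : A → B) (g : B → A) xs → Unique xs → (∀ {x} → x ∈ xs → g (f x) ≡ x) → Unique (map f xs)
  unique-map f g [] _ _ = []
  unique-map f g (x ∷ xs) (x∉ ∷ uxs) gf = All.tabulate (λ {y} y∈ eq → case ∈-map⁻ f y∈ of λ { (x′ , x′∈ , refl) →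
      All.lookup x∉ x′∈ (trans (sym (gf (here refl))) (trans (cong g eq) (gf (there x′∈)))) })
    ∷ unique-map f g xs uxs (gf ∘ there)

letters-unique : ∀ n → Unique (letters n)
letters-unique n = UP.map⁺ ℕP.suc-injective (UP.upTo⁺ n)

∈-wordsOver⁻ : ∀ n l {w} → w ∈ wordsOver n l → ∀ {a} → a ∈ w → a ∈ letters n
∈-wordsOver⁻ n zero (here refl) ()
∈-wordsOver⁻ n (suc l) w∈ a∈ with ∈-concatMap-elim (λ a → map (a ∷_) (wordsOver n l)) {letters n} w∈
... | b , b∈ , w∈′ with ∈-map⁻ (b ∷_) w∈′
∈-wordsOver⁻ n (suc l) w∈ (here refl) | b , b∈ , _ | v , v∈ , refl = b∈
∈-wordsOver⁻ n (suc l) w∈ (there a∈) | b , b∈ , _ | v , v∈ , refl = ∈-wordsOver⁻ n l v∈ a∈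

∈-wordsOver⁺ : ∀ n w → (∀ {a} → a ∈ w → a ∈ letters n) → w ∈ wordsOver n (length w)
∈-wordsOver⁺ n [] _ = here refl
∈-wordsOver⁺ n (a ∷ w) ok = ∈-concatMap-intro (λ a → map (a ∷_) (wordsOver n (length w))) (ok (here refl))
  (∈-map⁺ (a ∷_) (∈-wordsOver⁺ n w (ok ∘ there)))

wordsOver-unique : ∀ n l → Unique (wordsOver n l)
wordsOver-unique n zero = [] ∷ []
wordsOver-unique n (suc l) = unique-concatMap _ first (letters n) (letters-unique n)
  (λ {a} _ → UP.map⁺ LP.∷-injectiveʳ (wordsOver-unique n l))
  (λ {a} _ w∈ → case ∈-map⁻ (a ∷_) w∈ of λ { (_ , _ , refl) → refl })
  where
  first : Word → ℕ
  first [] = 0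
  first (a ∷ _) = a

private
  cutAt : ℕ → Word → ℕ → List (List Word)
  cutAt k w i = map (take (suc i) w ∷_) (cuts k (drop (suc i) w))

∈-cuts⁻ : ∀ k w {T} → T ∈ cuts k w → concat T ≡ w × length T ≡ k × All NonEmpty T
∈-cuts⁻ zero [] (here refl) = refl , refl , []
∈-cuts⁻ (suc k) w T∈ with ∈-concatMap-elim (cutAt k w) {upTo (length w)} T∈
... | i , i∈ , T∈′ with ∈-map⁻ (take (suc i) w ∷_) T∈′
...   | T , T∈″ , refl with ∈-cuts⁻ k (drop (suc i) w) T∈″
...     | eq , len , ne = trans (cong (take (suc i) w ++_) eq) (LP.take++drop≡id (suc i) w) , cong suc len , take-nonEmpty w (∈-upTo⁻ i∈) ∷ ne
  where
  take-nonEmpty : ∀ w → i < length w → NonEmpty (take (suc i) w)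
  take-nonEmpty (_ ∷ _) _ ()

take-length : ∀ {X : Set} (u v : List X) → take (length u) (u ++ v) ≡ u
take-length [] v = refl
take-length (x ∷ u) v = cong (x ∷_) (take-length u v)

drop-length : ∀ {X : Set} (u v : List X) → drop (length u) (u ++ v) ≡ v
drop-length [] v = refl
drop-length (x ∷ u) v = drop-length u v

∈-cuts⁺ : ∀ T → All NonEmpty T → T ∈ cuts (length T) (concat T)
∈-cuts⁺ [] _ = here refl
∈-cuts⁺ ([] ∷ T) (ne ∷ _) = ⊥-elim (ne refl)
∈-cuts⁺ ((a ∷ u) ∷ T) (_ ∷ ne) = ∈-concatMap-intro (cutAt (length T) (a ∷ u ++ concat T))
  (∈-upTo⁺ (s≤s (ℕP.≤-trans (ℕP.m≤m+n (length u) (length (concat T))) (ℕP.≤-reflexive (sym (LP.length-++ u))))))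
  (subst (λ x → ((a ∷ u) ∷ T) ∈ map ((a ∷ take (length u) (u ++ concat T)) ∷_) (cuts (length T) x)) (sym (drop-length u (concat T)))
    (subst (λ x → ((a ∷ u) ∷ T) ∈ map ((a ∷ x) ∷_) (cuts (length T) (concat T))) (sym (take-length u (concat T))) (∈-map⁺ ((a ∷ u) ∷_) (∈-cuts⁺ T ne))))

cuts-unique : ∀ k w → Unique (cuts k w)
cuts-unique zero [] = [] ∷ []
cuts-unique zero (_ ∷ _) = []
cuts-unique (suc k) w = unique-concatMap (cutAt k w) firstLength (upTo (length w)) (UP.upTo⁺ (length w))
  (λ {i} _ → UP.map⁺ LP.∷-injectiveʳ (cuts-unique k (drop (suc i) w)))
  (λ {i} i∈ T∈ → case ∈-map⁻ (take (suc i) w ∷_) T∈ of λ { (_ , _ , refl) →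
    -- Position `i` cuts off a first piece of `suc i` letters, whence the predecessor in
    -- `firstLength`.
    cong ℕ.pred (trans (LP.length-take (suc i) w) (ℕP.m≤n⇒m⊓n≡m (∈-upTo⁻ i∈))) })
  where
  firstLength : List Word → ℕ
  firstLength [] = 0
  firstLength (u ∷ _) = ℕ.pred (length u)

isSortable : ℕ → ℕ → List Word → Bool
isSortable r n T = isRPerm r n (concat T) ∧ disjointComps n T ∧ twoStackSortable n T

-- The tuples counted by `countTSS` before a weight is prescribed; the test of the weight becomes a
-- summand in `Sum-∧`.
sortables : ℕ → ℕ → ℕ → List (List Word)
sortables r n k = L.filterᵇ (isSortable r n) (concatMap (cuts k) (wordsOver n (n * r)))

sortables-unique : ∀ r n k → Unique (sortables r n k)
sortables-unique r n k = UP.filter⁺ _ (unique-concatMap (cuts k) concat (wordsOver n (n * r)) (wordsOver-unique n (n * r))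
  (λ {w} _ → cuts-unique k w) (λ {w} _ T∈ → proj₁ (∈-cuts⁻ k w T∈)))

record Valid (r n k : ℕ) (T : List Word) : Set where
  field
    weak     : Weak r n T
    nonEmpty : All NonEmpty T
    size     : length T ≡ k

all-sound : ∀ {X : Set} (p : X → Bool) xs → all p xs ≡ true → ∀ {x} → x ∈ xs → p x ≡ true
all-sound p (x ∷ xs) eq (here refl) = proj₁ (∧-true eq)
all-sound p (x ∷ xs) eq (there x∈) = all-sound p xs (proj₂ (∧-true {p x} eq)) x∈

all-complete : ∀ {X : Set} (p : X → Bool) xs → (∀ {x} → x ∈ xs → p x ≡ true) → all p xs ≡ true
all-complete p [] _ = refl
all-complete p (x ∷ xs) ok = cong₂ _∧_ (ok (here refl)) (all-complete p xs (ok ∘ there))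

containing : ℕ → List Word → ℕ
containing a T = length (L.filterᵇ (λ c → 1 ≤ᵇ occ a c) T)

private
  containing-∷ : ∀ a w T → containing a (w ∷ T) ≡ (if 1 ≤ᵇ occ a w then 1 else 0) + containing a T
  containing-∷ a w T with 1 ≤ᵇ occ a w
  ... | true = refl
  ... | false = refl

  occurs : ∀ {a} w → a ∈ w → (1 ≤ᵇ occ a w) ≡ true
  occurs w a∈ = ≤⇒≤ᵇ-true (occ-∈ w a∈)

containing-∈ : ∀ {a} T → a ∈ concat T → 1 ≤ containing a T
containing-∈ {a} (w ∷ T) a∈ = ℕP.≤-trans ([ inHead , inTail ]′ (∈-++⁻ w a∈)) (ℕP.≤-reflexive (sym (containing-∷ a w T)))
  where
  inHead : a ∈ w → 1 ≤ (if 1 ≤ᵇ occ a w then 1 else 0) + containing a T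
  inHead a∈w = subst (λ t → 1 ≤ (if t then 1 else 0) + containing a T) (sym (occurs w a∈w)) (s≤s z≤n)
  inTail : a ∈ concat T → 1 ≤ (if 1 ≤ᵇ occ a w then 1 else 0) + containing a T
  inTail a∈T = ℕP.≤-trans (containing-∈ T a∈T) (ℕP.m≤n+m _ _)

containing-∉ : ∀ {a} T → a ∉ concat T → containing a T ≡ 0
containing-∉ [] _ = refl
containing-∉ {a} (w ∷ T) a∉ = trans (containing-∷ a w T) (cong₂ (λ x y → (if 1 ≤ᵇ x then 1 else 0) + y)
  (occ-∉ w (a∉ ∘ ∈-++⁺ˡ)) (containing-∉ T (a∉ ∘ ∈-++⁺ʳ w)))

-- A letter common to the first word and to a later one would be counted in two components.
separated⇒Good : ∀ T → Pat (concat T) → (∀ {a} → a ∈ concat T → containing a T ≤ 1) → Good T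
separated⇒Good [] _ _ = tt
separated⇒Good (w ∷ T) pat once = Pat-⊆ (⊆-left w (concat T)) pat , disj ,
  separated⇒Good T (Pat-⊆ (⊆-right w (concat T)) pat)
    (λ {a} a∈ → ℕP.≤-trans (ℕP.m≤n+m _ _) (ℕP.≤-trans (ℕP.≤-reflexive (sym (containing-∷ a w T))) (once (∈-++⁺ʳ w a∈))))
  where
  disj : Disj w (concat T)
  disj {a} a∈w a∈T = ℕP.<⇒≱ (s≤s (containing-∈ T a∈T)) (subst (_≤ 1)
    (trans (containing-∷ a w T) (cong (λ t → (if t then 1 else 0) + containing a T) (occurs w a∈w))) (once (∈-++⁺ˡ a∈w)))

Good⇒separated : ∀ T → Good T → ∀ a → containing a T ≤ 1
Good⇒separated [] _ _ = z≤n
Good⇒separated (w ∷ T) (_ , d , g) a with 0 ℕ.<? occ a w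
... | yes a∈ = ℕP.≤-reflexive (trans (containing-∷ a w T) (cong₂ (λ t n → (if t then 1 else 0) + n)
        (≤⇒≤ᵇ-true a∈) (containing-∉ T (d (occ-pos w a∈)))))
... | no a∉ = ℕP.≤-trans (ℕP.≤-reflexive (trans (containing-∷ a w T)
        (cong (λ x → (if 1 ≤ᵇ x then 1 else 0) + containing a T) (ℕP.n≤0⇒n≡0 (ℕP.≮⇒≥ a∉))))) (Good⇒separated T g a)

-- Counts the letters of a word by their value. With `r` copies of each letter it gives the length
-- `n * r`, so every valid tuple is met by the enumeration of words.
length-occ : ∀ n w → (∀ {a} → a ∈ w → a ∈ letters n) → Sum (upTo n) (λ i → + occ (suc i) w) ≡ + length w
length-occ n [] _ = Sum-0 (upTo n)
length-occ n (zero ∷ w) ok = case proj₁ (∈-letters⁻ {n} (ok (here refl))) of λ ()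
length-occ n (suc b ∷ w) ok = trans (Sum-+ (upTo n) (λ i → δ b i) (λ i → + occ (suc i) w))
  (cong₂ _+ℤ_ one (length-occ n w (ok ∘ there)))
  where
  δ : ℕ → ℕ → ℤ
  δ b i = + (if b ≡ᵇ i then 1 else 0)
  δ≡ : ∀ i → δ b i ≡ δℕ b i *ℤ + 1
  δ≡ i with b ≡ᵇ i
  ... | true = refl
  ... | false = refl
  one : Sum (upTo n) (δ b) ≡ + 1
  one = trans (Sum-cong (upTo n) δ≡) (Sum-δℕ n b (λ _ → + 1) (proj₂ (∈-letters⁻ (ok (here refl)))))

Sum-const : ∀ {X : Set} (xs : List X) c → Sum xs (λ _ → + c) ≡ + (length xs * c)
Sum-const [] c = refl
Sum-const (x ∷ xs) c = cong (+ c +ℤ_) (Sum-const xs c)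

does-true : ∀ {P : Set} (d : Dec P) → does d ≡ true → P
does-true (yes p) _ = p

true-does : ∀ {P : Set} (d : Dec P) → P → does d ≡ true
true-does (yes _) _ = refl
true-does (no ¬p) p = ⊥-elim (¬p p)

∈-sortables⁻ : ∀ {r n k T} → T ∈ sortables r n k → Valid r n k T
∈-sortables⁻ {r} {n} {k} {T} T∈ = record
  { weak = record
    { range = ∈-letters⁻ ∘ inLetters
    ; count = λ l u → ≡ᵇ-true (all-sound (λ m → occ m (concat T) ≡ᵇ r) (letters n) (proj₁ rperm) (∈-letters⁺ l u))
    ; good = separated⇒Good T (patternOK-sound (concat T) (proj₂ rperm))
        (λ a∈ → ≤ᵇ-true (all-sound (λ m → containing m T ≤ᵇ 1) (letters n) (proj₁ rest) (inLetters a∈)))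
    ; sorted = does-true (LP.≡-dec ℕ._≟_ (stackSort (concatMap stackSort T)) (letters n)) (proj₂ rest) }
  ; nonEmpty = proj₂ (proj₂ cut)
  ; size = proj₁ (proj₂ cut) }
  where
  candidates = concatMap (cuts k) (wordsOver n (n * r))
  filtered = ∈-filter⁻ _ {xs = candidates} T∈
  check : isSortable r n T ≡ true
  check = Equivalence.to T-≡ (proj₂ filtered)
  rperm = ∧-true (proj₁ (∧-true {isRPerm r n (concat T)} check))
  rest = ∧-true {disjointComps n T} (proj₂ (∧-true {isRPerm r n (concat T)} check))
  word = ∈-concatMap-elim (cuts k) {wordsOver n (n * r)} (proj₁ filtered)
  cut = ∈-cuts⁻ k (proj₁ word) (proj₂ (proj₂ word))
  inLetters : ∀ {a} → a ∈ concat T → a ∈ letters n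
  inLetters a∈ = ∈-wordsOver⁻ n (n * r) (proj₁ (proj₂ word)) (subst (_ ∈_) (proj₁ cut) a∈)

∈-sortables⁺ : ∀ {r n k T} → Valid r n k T → T ∈ sortables r n k
∈-sortables⁺ {r} {n} {k} {T} v = ∈-filter⁺ _ candidate (Equivalence.from T-≡ check)
  where
  open Valid v
  open Weak weak
  inLetters : ∀ {a} → a ∈ concat T → a ∈ letters n
  inLetters a∈ = ∈-letters⁺ (proj₁ (range a∈)) (proj₂ (range a∈))
  length≡ : length (concat T) ≡ n * r
  length≡ = ℤP.+-injective (trans (sym (length-occ n (concat T) inLetters)) (trans
    (Sum-cong-∈ (upTo n) (λ i∈ → cong +_ (count (s≤s z≤n) (∈-upTo⁻ i∈))))
    (trans (Sum-const (upTo n) r) (cong (λ l → + (l * r)) (LP.length-upTo n)))))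
  candidate : T ∈ concatMap (cuts k) (wordsOver n (n * r))
  candidate = ∈-concatMap-intro (cuts k)
    (subst (λ l → concat T ∈ wordsOver n l) length≡ (∈-wordsOver⁺ n (concat T) inLetters))
    (subst (λ l → T ∈ cuts l (concat T)) size (∈-cuts⁺ T nonEmpty))
  check : isSortable r n T ≡ true
  check = cong₂ _∧_
    (cong₂ _∧_
      (all-complete (λ m → occ m (concat T) ≡ᵇ r) (letters n)
        (λ {a} a∈ → trans (cong (_≡ᵇ r) (count (proj₁ (∈-letters⁻ a∈)) (proj₂ (∈-letters⁻ a∈)))) (≡ᵇ-refl r)))
      (patternOK-complete (concat T) (Good-Pat T good)))
    (cong₂ _∧_
      (all-complete (λ m → containing m T ≤ᵇ 1) (letters n) (λ {a} _ → ≤⇒≤ᵇ-true (Good⇒separated T good a)))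
      (true-does (LP.≡-dec ℕ._≟_ (stackSort (concatMap stackSort T)) (letters n)) sorted))

-- Bijections between finite lists, and the decomposition of a tuple at its largest letter

Sum-↭ : ∀ {X : Set} {xs ys : List X} (f : X → ℤ) → xs ↭ ys → Sum xs f ≡ Sum ys f
Sum-↭ f Perm.refl = refl
Sum-↭ f (Perm.prep x p) = cong (f x +ℤ_) (Sum-↭ f p)
Sum-↭ f (Perm.swap {xs} {ys} x y p) = trans (cong (λ s → f x +ℤ (f y +ℤ s)) (Sum-↭ f p))
  (trans (sym (ℤP.+-assoc (f x) (f y) (Sum ys f))) (trans (cong (_+ℤ Sum ys f) (ℤP.+-comm (f x) (f y))) (ℤP.+-assoc (f y) (f x) (Sum ys f))))
Sum-↭ f (Perm.trans p q) = trans (Sum-↭ f p) (Sum-↭ f q)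

-- `map to xs` and `ys` are lists without repetition and with the same elements, hence permutations
-- of each other.
Sum-bijection : ∀ {X Y : Set} (xs : List X) (ys : List Y) (to : X → Y) (from : Y → X) (f : Y → ℤ) →
  Unique xs → Unique ys → (∀ {x} → x ∈ xs → to x ∈ ys × from (to x) ≡ x) → (∀ {y} → y ∈ ys → from y ∈ xs × to (from y) ≡ y) →
  Sum ys f ≡ Sum xs (f ∘ to)
Sum-bijection xs ys to from f uxs uys left right = trans
  (Sum-↭ f (∼bag⇒↭ (unique∧set⇒bag uys (unique-map to from xs uxs (proj₂ ∘ left)) (mk⇔
    (λ y∈ → subst (_∈ map to xs) (proj₂ (right y∈)) (∈-map⁺ to (proj₁ (right y∈))))
    (λ y∈ → case ∈-map⁻ to y∈ of λ { (x , x∈ , refl) → proj₁ (left x∈) })))))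
  (Sum-map xs to f)

tagged : ∀ {X Y : Set} → List X → (X → List Y) → List (X × Y)
tagged xs f = concatMap (λ x → map (x ,_) (f x)) xs

module _ {X Y : Set} (xs : List X) (f : X → List Y) where

  tagged-unique : Unique xs → (∀ {x} → x ∈ xs → Unique (f x)) → Unique (tagged xs f)
  tagged-unique uxs uf = unique-concatMap (λ x → map (x ,_) (f x)) proj₁ xs uxs
    (λ x∈ → UP.map⁺ (λ { refl → refl }) (uf x∈))
    (λ {x} _ y∈ → case ∈-map⁻ (x ,_) y∈ of λ { (_ , _ , refl) → refl })

  ∈-tagged⁺ : ∀ {x y} → x ∈ xs → y ∈ f x → (x , y) ∈ tagged xs f
  ∈-tagged⁺ {x} x∈ y∈ = ∈-concatMap-intro (λ x → map (x ,_) (f x)) x∈ (∈-map⁺ (x ,_) y∈)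

  ∈-tagged⁻ : ∀ {x y} → (x , y) ∈ tagged xs f → x ∈ xs × y ∈ f x
  ∈-tagged⁻ p∈ with ∈-concatMap-elim (λ x → map (x ,_) (f x)) {xs} p∈
  ... | x , x∈ , p∈′ with ∈-map⁻ (x ,_) p∈′
  ...   | y , y∈ , refl = x∈ , y∈

  Sum-tagged : ∀ (g : X × Y → ℤ) → Sum (tagged xs f) g ≡ Sum xs (λ x → Sum (f x) (λ y → g (x , y)))
  Sum-tagged g = trans (Sum-concatMap xs (λ x → map (x ,_) (f x)) g) (Sum-cong xs (λ x → Sum-map (f x) (x ,_) g))

locate : ℕ → List Word → List Word × Word × List Word
-- Not reached when `m` occurs in the tuple.
locate m [] = [] , [] , []
locate m (w ∷ T) = if 1 ≤ᵇ occ m w then [] , w , T else (let (A , α , B) = locate m T in w ∷ A , α , B)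

locate-insert : ∀ m A α B → m ∉ concat A → m ∈ α → locate m (A ++ α ∷ B) ≡ (A , α , B)
locate-insert m [] α B _ m∈ rewrite ≤⇒≤ᵇ-true (occ-∈ α m∈) = refl
locate-insert m (w ∷ A) α B m∉ m∈ rewrite occ-∉ w (m∉ ∘ ∈-++⁺ˡ) | locate-insert m A α B (m∉ ∘ ∈-++⁺ʳ w) m∈ = refl

locate-correct : ∀ m T → m ∈ concat T → let (A , α , B) = locate m T in T ≡ A ++ α ∷ B × m ∈ α
locate-correct m (w ∷ T) m∈ with 0 ℕ.<? occ m w
... | yes pos rewrite ≤⇒≤ᵇ-true pos = refl , occ-pos w pos
... | no ¬pos rewrite ℕP.n≤0⇒n≡0 (ℕP.≮⇒≥ ¬pos) with ∈-++⁻ w m∈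
...   | inj₁ m∈w = ⊥-elim (¬pos (occ-∈ w m∈w))
...   | inj₂ m∈T = cong (w ∷_) (proj₁ (locate-correct m T m∈T)) , proj₂ (locate-correct m T m∈T)

-- Undoes `dropEmpty` once it is known which factors were nonempty. The clause for an exhausted list
-- is not reached when `ws` has `countTrue S` words.
fill : ∀ {k} → Vec Bool k → List Word → List Word
fill [] ws = []
fill (false ∷ S) ws = [] ∷ fill S ws
fill (true ∷ S) [] = [] ∷ fill S []
fill (true ∷ S) (w ∷ ws) = w ∷ fill S ws

length-fill : ∀ {k} (S : Vec Bool k) ws → length (fill S ws) ≡ k
length-fill [] ws = refl
length-fill (false ∷ S) ws = cong suc (length-fill S ws)
length-fill (true ∷ S) [] = cong suc (length-fill S [])
length-fill (true ∷ S) (w ∷ ws) = cong suc (length-fill S ws)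

dropEmpty-fill : ∀ {k} (S : Vec Bool k) ws → All NonEmpty ws → length ws ≡ countTrue S → dropEmpty (fill S ws) ≡ ws
dropEmpty-fill [] [] _ _ = refl
dropEmpty-fill (false ∷ S) ws ne len = dropEmpty-fill S ws ne len
dropEmpty-fill (true ∷ S) ([] ∷ ws) (ne ∷ _) len = ⊥-elim (ne refl)
dropEmpty-fill (true ∷ S) (w@(_ ∷ _) ∷ ws) (_ ∷ ne) len = cong (w ∷_) (dropEmpty-fill S ws ne (ℕP.suc-injective len))

occupancy-fill : ∀ {k} (S : Vec Bool k) ws → All NonEmpty ws → length ws ≡ countTrue S → occupancy k (fill S ws) ≡ S
occupancy-fill [] ws _ _ = refl
occupancy-fill (false ∷ S) ws ne len = cong (false ∷_) (occupancy-fill S ws ne len)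
occupancy-fill (true ∷ S) ([] ∷ ws) (ne ∷ _) len = ⊥-elim (ne refl)
occupancy-fill (true ∷ S) (w@(_ ∷ _) ∷ ws) (_ ∷ ne) len = cong (true ∷_) (occupancy-fill S ws ne (ℕP.suc-injective len))

fill-occupancy : ∀ k ws → length ws ≡ k → fill (occupancy k ws) (dropEmpty ws) ≡ ws
fill-occupancy zero [] _ = refl
fill-occupancy (suc k) ([] ∷ ws) len = cong ([] ∷_) (fill-occupancy k ws (ℕP.suc-injective len))
fill-occupancy (suc k) (w@(_ ∷ _) ∷ ws) len = cong (w ∷_) (fill-occupancy k ws (ℕP.suc-injective len))

length-dropEmpty : ∀ k ws → length ws ≡ k → length (dropEmpty ws) ≡ countTrue (occupancy k ws)
length-dropEmpty zero [] _ = refl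
length-dropEmpty (suc k) ([] ∷ ws) len = length-dropEmpty k ws (ℕP.suc-injective len)
length-dropEmpty (suc k) ((_ ∷ _) ∷ ws) len = cong suc (length-dropEmpty k ws (ℕP.suc-injective len))

dropEmpty-nonEmpty : ∀ ws → All NonEmpty (dropEmpty ws)
dropEmpty-nonEmpty [] = []
dropEmpty-nonEmpty ([] ∷ ws) = dropEmpty-nonEmpty ws
dropEmpty-nonEmpty ((_ ∷ _) ∷ ws) = (λ ()) ∷ dropEmpty-nonEmpty ws

∈-allBool : ∀ {k} (S : Vec Bool k) → S ∈ allBool k
∈-allBool [] = here refl
∈-allBool (b ∷ S) = ∈-concatMap-intro (λ v → (true ∷ v) ∷ (false ∷ v) ∷ []) (∈-allBool S) (by b)
  where
  by : ∀ b → b ∷ S ∈ (true ∷ S) ∷ (false ∷ S) ∷ []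
  by true = here refl
  by false = there (here refl)

allBool-unique : ∀ k → Unique (allBool k)
allBool-unique zero = [] ∷ []
allBool-unique (suc k) = unique-concatMap _ V.tail (allBool k) (allBool-unique k)
  (λ _ → ((λ ()) ∷ []) ∷ [] ∷ []) (λ { _ (here refl) → refl ; _ (there (here refl)) → refl })

∈⇒NonEmpty : ∀ {m} {w : Word} → m ∈ w → NonEmpty w
∈⇒NonEmpty () refl

map-nonEmpty : ∀ {f : ℕ → ℕ} {T} → All NonEmpty T → All NonEmpty (map (map f) T)
map-nonEmpty ne = AllP.map⁺ (All.map (λ { {[]} n _ → n refl ; {_ ∷ _} _ () }) ne)

module Decomposition (r : ℕ) where

  -- (i , p , S , L , R): i components precede the one containing the largest letter, p letters
  -- and the tuple L make up those components and the nonempty factors of that one, S tells which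
  -- of its r + 1 factors are nonempty, and R is the standardised rest.
  Data : Set
  Data = ℕ × ℕ × Vec Bool (suc r) × List Word × List Word

  -- Of `suc k` components, `i` precede the one with the largest letter and `k ∸ i` follow it; the
  -- former are joined in `L` by the nonempty factors. The largest letter is `suc n`, so `n ∸ p`
  -- letters remain for `R`.
  subtuples : ∀ n k i p → Vec Bool (suc r) → List (List Word × List Word)
  subtuples n k i p S = tagged (sortables r p (i + countTrue S)) (λ _ → sortables r (n ∸ p) (k ∸ i))

  patterns : ∀ n k i p → List (Vec Bool (suc r) × List Word × List Word)
  patterns n k i p = tagged (allBool (suc r)) (subtuples n k i p)

  letterSplits : ∀ n k i → List (ℕ × Vec Bool (suc r) × List Word × List Word)
  letterSplits n k i = tagged (upTo (suc n)) (patterns n k i)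

  parts : ℕ → ℕ → List Data
  parts n k = tagged (upTo (suc k)) (letterSplits n k)

  build : ℕ → Data → List Word
  build n (i , p , S , L , R) = take i L ++ join (suc n) (fill S (drop i L)) ∷ shift p R

  assemble : ℕ → List Word × Word × List Word → Data
  assemble m (A , α , B) = let βs = splitBy m α ; p = sortedLength (A ++ βs) in
    length A , p , occupancy (suc r) βs , A ++ dropEmpty βs , unshift p B

  decompose : ℕ → List Word → Data
  decompose n T = assemble (suc n) (locate (suc n) T)

  parts-unique : ∀ n k → Unique (parts n k)
  parts-unique n k = tagged-unique (upTo (suc k)) (letterSplits n k) (UP.upTo⁺ (suc k)) λ {i} _ →
    tagged-unique (upTo (suc n)) (patterns n k i) (UP.upTo⁺ (suc n)) λ {p} _ →
    tagged-unique (allBool (suc r)) (subtuples n k i p) (allBool-unique (suc r)) λ {S} _ →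
    tagged-unique (sortables r p (i + countTrue S)) (λ _ → sortables r (n ∸ p) (k ∸ i))
      (sortables-unique r p (i + countTrue S)) (λ _ → sortables-unique r (n ∸ p) (k ∸ i))

  record IsPart (n k i p : ℕ) (S : Vec Bool (suc r)) (L R : List Word) : Set where
    field
      i≤k    : i ≤ k
      p≤n    : p ≤ n
      validL : Valid r p (i + countTrue S) L
      validR : Valid r (n ∸ p) (k ∸ i) R

  ∈-parts⁻ : ∀ {n k i p S L R} → (i , p , S , L , R) ∈ parts n k → IsPart n k i p S L R
  ∈-parts⁻ {n} {k} {i} {p} {S} d∈ with ∈-tagged⁻ (upTo (suc k)) (letterSplits n k) d∈
  ... | i∈ , d∈₁ with ∈-tagged⁻ (upTo (suc n)) (patterns n k i) d∈₁
  ... | p∈ , d∈₂ with ∈-tagged⁻ (allBool (suc r)) (subtuples n k i p) d∈₂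
  ... | S∈ , d∈₃ with ∈-tagged⁻ (sortables r p (i + countTrue S)) (λ _ → sortables r (n ∸ p) (k ∸ i)) d∈₃
  ... | L∈ , R∈ = record
    { i≤k = ℕP.≤-pred (∈-upTo⁻ i∈) ; p≤n = ℕP.≤-pred (∈-upTo⁻ p∈) ; validL = ∈-sortables⁻ L∈ ; validR = ∈-sortables⁻ R∈ }

  ∈-parts⁺ : ∀ {n k i p S L R} → IsPart n k i p S L R → (i , p , S , L , R) ∈ parts n k
  ∈-parts⁺ {n} {k} {i} {p} {S} d = ∈-tagged⁺ (upTo (suc k)) (letterSplits n k) (∈-upTo⁺ (s≤s i≤k))
    (∈-tagged⁺ (upTo (suc n)) (patterns n k i) (∈-upTo⁺ (s≤s p≤n))
    (∈-tagged⁺ (allBool (suc r)) (subtuples n k i p) (∈-allBool S)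
    (∈-tagged⁺ (sortables r p (i + countTrue S)) (λ _ → sortables r (n ∸ p) (k ∸ i)) (∈-sortables⁺ validL) (∈-sortables⁺ validR))))
    where open IsPart d

  module _ (1≤r : 1 ≤ r) where

    private
      -- With `1 ≤ r` the largest letter occurs, which gives the two factors that `stackSort-join`
      -- and `descType-join` ask for.
      atLeastTwo : ∀ (βs : List Word) → length βs ≡ suc r → ∃[ b ] ∃[ c ] ∃[ bs ] βs ≡ b ∷ c ∷ bs
      atLeastTwo (b ∷ []) len = case subst (1 ≤_) (sym (ℕP.suc-injective len)) 1≤r of λ ()
      atLeastTwo (b ∷ c ∷ bs) _ = b , c , bs , refl

    module Build {n k i p S L R} (part : IsPart n k i p S L R) where
      open IsPart part
      open Valid

      m : ℕ
      m = suc n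
      A = take i L
      ws = drop i L
      βs = fill S ws

      private
        i≤L : i ≤ length L
        i≤L = ℕP.≤-trans (ℕP.m≤m+n i (countTrue S)) (ℕP.≤-reflexive (sym (size validL)))

        length-A : length A ≡ i
        length-A = trans (LP.length-take i L) (ℕP.m≤n⇒m⊓n≡m i≤L)

        length-ws : length ws ≡ countTrue S
        length-ws = trans (LP.length-drop i L) (trans (cong (_∸ i) (size validL)) (ℕP.m+n∸m≡n i (countTrue S)))

        ne-ws : All NonEmpty ws
        ne-ws = AllP.drop⁺ i (nonEmpty validL)

        A++ws : A ++ dropEmpty βs ≡ L
        A++ws = trans (cong (A ++_) (dropEmpty-fill S ws ne-ws length-ws)) (LP.take++drop≡id i L)

        weakA : Weak r p (A ++ βs)
        weakA = Weak-dropEmpty⁻ A βs (subst (Weak r p) (sym A++ws) (weak validL))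

        shape = atLeastTwo βs (length-fill S ws)
        b = proj₁ shape
        c = proj₁ (proj₂ shape)
        bs = proj₁ (proj₂ (proj₂ shape))
        βs≡ : βs ≡ b ∷ c ∷ bs
        βs≡ = proj₂ (proj₂ (proj₂ shape))

        p+q : p + (n ∸ p) ≡ n
        p+q = ℕP.m+[n∸m]≡n p≤n

        weakT : Weak r m (A ++ join m βs ∷ shift p R)
        weakT = subst (λ βs → Weak r m (A ++ join m βs ∷ shift p R)) (sym βs≡)
          (subst (λ x → Weak r (suc x) (A ++ join (suc x) (b ∷ c ∷ bs) ∷ shift p R)) p+q
            (weak-insert A b c bs R (trans (cong length (sym βs≡)) (length-fill S ws))
              (subst (λ βs → Weak r p (A ++ βs)) βs≡ weakA) (weak validR)))

        m∈join : m ∈ join m βs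
        m∈join = subst (λ βs → m ∈ join m βs) (sym βs≡) (∈-++⁺ʳ b (here refl))

        m∉left : m ∉ concat (A ++ βs)
        m∉left m∈ = ℕP.<⇒≱ (s≤s p≤n) (proj₂ (Weak.range weakA m∈))

      valid : Valid r m (suc k) (build n (i , p , S , L , R))
      valid = record
        { weak = weakT
        ; nonEmpty = AllP.++⁺ (AllP.take⁺ i (nonEmpty validL)) (∈⇒NonEmpty m∈join ∷ map-nonEmpty (nonEmpty validR))
        ; size = begin
            length (A ++ join m βs ∷ shift p R)      ≡⟨ LP.length-++ A ⟩
            length A + suc (length (shift p R))      ≡⟨ cong₂ (λ x y → x + suc y) length-A (trans (LP.length-map _ R) (size validR)) ⟩
            i + suc (k ∸ i)                          ≡⟨ ℕP.+-suc i (k ∸ i) ⟩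
            suc (i + (k ∸ i))                        ≡⟨ cong suc (ℕP.m+[n∸m]≡n i≤k) ⟩
            suc k                                    ∎ }
        where open ≡-Reasoning

      decompose-build : decompose n (build n (i , p , S , L , R)) ≡ (i , p , S , L , R)
      decompose-build = trans (cong (assemble m) (locate-insert m A (join m βs) (shift p R) (m∉left ∘ ∈-concat-++⁺ˡ A) m∈join))
        (trans (cong reassemble split) reassembled)
        where
        -- The list of factors is made a variable, so that `split` can replace all its occurrences
        -- at once.
        reassemble : List Word → Data
        reassemble γs = length A , sortedLength (A ++ γs) , occupancy (suc r) γs , A ++ dropEmpty γs ,
          unshift (sortedLength (A ++ γs)) (shift p R)
        split : splitBy m (join m βs) ≡ βs
        split = splitBy-join m βs (λ eq → case trans (sym (length-fill S ws)) (cong length eq) of λ ()) (m∉left ∘ ∈-concat-++⁺ʳ A)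
        sorted-p : sortedLength (A ++ βs) ≡ p
        sorted-p = trans (cong length (Weak.sorted weakA)) (length-letters p)
        reassembled : reassemble βs ≡ (i , p , S , L , R)
        reassembled = cong₂ _,_ length-A (cong₂ _,_ sorted-p (cong₂ _,_ (occupancy-fill S ws ne-ws length-ws)
          (cong₂ _,_ A++ws (trans (cong (λ x → unshift x (shift p R)) sorted-p) (unshift-shift p R)))))

      weight : weightVec r (build n (i , p , S , L , R)) ≡ indicator S ⊕ (weightVec r L ⊕ weightVec r R)
      weight = begin
        weightVec r (A ++ join m βs ∷ shift p R)
          ≡⟨ cong (λ γs → weightVec r (A ++ join m γs ∷ shift p R)) βs≡ ⟩
        weightVec r (A ++ join m (b ∷ c ∷ bs) ∷ shift p R)
          ≡⟨ weightVec-insert r m A b c bs p R (subst (λ γs → ∀ {a} → a ∈ concat γs → a < m) βs≡ <m)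
               (subst Good βs≡ (proj₁ (proj₂ (Good-++⁻ A (Weak.good weakA))))) ⟩
        indicator (occupancy (suc r) (b ∷ c ∷ bs)) ⊕ (weightVec r (A ++ dropEmpty (b ∷ c ∷ bs)) ⊕ weightVec r R)
          ≡⟨ cong (λ γs → indicator (occupancy (suc r) γs) ⊕ (weightVec r (A ++ dropEmpty γs) ⊕ weightVec r R)) βs≡ ⟨
        indicator (occupancy (suc r) βs) ⊕ (weightVec r (A ++ dropEmpty βs) ⊕ weightVec r R)
          ≡⟨ cong₂ (λ u v → indicator u ⊕ (weightVec r v ⊕ weightVec r R)) (occupancy-fill S ws ne-ws length-ws) A++ws ⟩
        indicator S ⊕ (weightVec r L ⊕ weightVec r R) ∎
        where
        open ≡-Reasoning
        <m : ∀ {a} → a ∈ concat βs → a < m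
        <m a∈ = s≤s (ℕP.≤-trans (proj₂ (Weak.range weakA (∈-concat-++⁺ʳ A a∈))) p≤n)

    module Decompose {n k} (T : List Word) (v : Valid r (suc n) (suc k) T) where
      open Valid v

      private
        m : ℕ
        m = suc n
        located = locate m T
        A = proj₁ located
        α = proj₁ (proj₂ located)
        B = proj₂ (proj₂ located)
        βs = splitBy m α
        p = sortedLength (A ++ βs)

        m∈T : m ∈ concat T
        m∈T = occ-pos (concat T) (subst (1 ≤_) (sym (Weak.count weak (s≤s z≤n) ℕP.≤-refl)) 1≤r)

        T≡ : T ≡ A ++ α ∷ B
        T≡ = proj₁ (locate-correct m T m∈T)

        m∉A : m ∉ concat A
        m∉A m∈ = proj₂ (proj₂ (Good-++⁻ A (subst Good T≡ (Weak.good weak)))) m∈ (∈-++⁺ˡ (proj₂ (locate-correct m T m∈T)))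

        m∉B : m ∉ concat B
        m∉B m∈ = proj₁ (proj₂ (proj₁ (proj₂ (Good-++⁻ A (subst Good T≡ (Weak.good weak)))))) (proj₂ (locate-correct m T m∈T)) m∈

        length-βs : length βs ≡ suc r
        length-βs = trans (length-splitBy m α) (cong suc (trans (sym (occ-insert m A α B m∉A m∉B))
          (trans (cong (occ m ∘ concat) (sym T≡)) (Weak.count weak (s≤s z≤n) ℕP.≤-refl))))

        shape = atLeastTwo βs length-βs
        b = proj₁ shape
        c = proj₁ (proj₂ shape)
        bs = proj₁ (proj₂ (proj₂ shape))
        βs≡ : βs ≡ b ∷ c ∷ bs
        βs≡ = proj₂ (proj₂ (proj₂ shape))

        Removed : List Word → Set
        Removed γs = let p = sortedLength (A ++ γs) in
          length γs ≡ suc r × p ≤ n × Weak r p (A ++ γs) × Weak r (n ∸ p) (unshift p B) × shift p (unshift p B) ≡ B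

        removed : Removed βs
        removed = subst Removed (sym βs≡) (weak-remove A b c bs B
          (subst (λ γs → m ∉ concat γs) βs≡ (splitBy-∌ m α))
          (subst (λ γs → Weak r m (A ++ join m γs ∷ B)) βs≡
            (subst (λ γ → Weak r m (A ++ γ ∷ B)) (sym (join-splitBy m α)) (subst (Weak r m) T≡ weak))))

        nonEmptyAB : All NonEmpty (A ++ α ∷ B)
        nonEmptyAB = subst (All NonEmpty) T≡ nonEmpty

        sizes : length A + length B ≡ k
        sizes = ℕP.suc-injective (trans (sym (ℕP.+-suc (length A) (length B)))
          (trans (sym (LP.length-++ A)) (trans (cong length (sym T≡)) size)))

        unshift-nonEmpty : All NonEmpty (unshift p B)
        unshift-nonEmpty = map-nonEmpty (All.tail (AllP.++⁻ʳ A nonEmptyAB))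

      isPart : IsPart n k (length A) p (occupancy (suc r) βs) (A ++ dropEmpty βs) (unshift p B)
      isPart = record
        { i≤k = subst (length A ≤_) sizes (ℕP.m≤m+n (length A) (length B))
        ; p≤n = proj₁ (proj₂ removed)
        ; validL = record
          { weak = Weak-dropEmpty⁺ A βs (proj₁ (proj₂ (proj₂ removed)))
          ; nonEmpty = AllP.++⁺ (AllP.++⁻ˡ A nonEmptyAB) (dropEmpty-nonEmpty βs)
          ; size = trans (LP.length-++ A) (cong (_+_ (length A)) (length-dropEmpty (suc r) βs length-βs)) }
        ; validR = record
          { weak = proj₁ (proj₂ (proj₂ (proj₂ removed)))
          ; nonEmpty = unshift-nonEmpty
          ; size = trans (LP.length-map _ B) (trans (sym (ℕP.m+n∸m≡n (length A) (length B))) (cong (_∸ length A) sizes)) } }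

      build-decompose : build n (decompose n T) ≡ T
      build-decompose = begin
        take (length A) (A ++ dropEmpty βs) ++ join m (fill (occupancy (suc r) βs) (drop (length A) (A ++ dropEmpty βs))) ∷ shift p (unshift p B)
          ≡⟨ cong₂ _++_ (take-length A (dropEmpty βs)) (cong₂ _∷_ component (proj₂ (proj₂ (proj₂ (proj₂ removed))))) ⟩
        A ++ α ∷ B
          ≡⟨ T≡ ⟨
        T ∎
        where
        open ≡-Reasoning
        component : join m (fill (occupancy (suc r) βs) (drop (length A) (A ++ dropEmpty βs))) ≡ α
        component = trans (cong (λ x → join m (fill (occupancy (suc r) βs) x)) (drop-length A (dropEmpty βs)))
          (trans (cong (join m) (fill-occupancy (suc r) βs length-βs)) (join-splitBy m α))

    Sum-sortables : ∀ n k (f : List Word → ℤ) → Sum (sortables r (suc n) (suc k)) f ≡ Sum (parts n k) (f ∘ build n)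
    Sum-sortables n k f = Sum-bijection (parts n k) (sortables r (suc n) (suc k)) (build n) (decompose n) f
      (parts-unique n k) (sortables-unique r (suc n) (suc k))
      (λ d∈ → let part = ∈-parts⁻ {n} {k} d∈ in
        ∈-sortables⁺ {n = suc n} {suc k} (Build.valid part) , Build.decompose-build part)
      (λ {T} T∈ → let v = ∈-sortables⁻ {r} {suc n} {suc k} T∈ in
        ∈-parts⁺ {n} {k} (Decompose.isPart T v) , Decompose.build-decompose T v)

-- The functional equation

sum-⊕ : ∀ {n} (u v : Vec ℕ n) → V.sum (u ⊕ v) ≡ V.sum u + V.sum v
sum-⊕ [] [] = refl
sum-⊕ (x ∷ u) (y ∷ v) = trans (cong (_+_ (x + y)) (sum-⊕ u v)) (ℕ+.interchange x y (V.sum u) (V.sum v))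

sum-indicator : ∀ {n} (S : Vec Bool n) → V.sum (indicator S) ≡ countTrue S
sum-indicator [] = refl
sum-indicator (b ∷ S) = cong (_+_ (if b then 1 else 0)) (sum-indicator S)

Sum-∧ : ∀ {X : Set} (P D S W : X → Bool) (xs : List X) →
  + length (L.filterᵇ (λ x → P x ∧ D x ∧ S x ∧ W x) xs) ≡ Sum (L.filterᵇ (λ x → P x ∧ D x ∧ S x) xs) (λ x → [ W x ])
Sum-∧ P D S W [] = refl
Sum-∧ P D S W (x ∷ xs) with P x | D x | S x
... | false | _ | _ = Sum-∧ P D S W xs
... | true | false | _ = Sum-∧ P D S W xs
... | true | true | false = Sum-∧ P D S W xs
... | true | true | true with W x
...   | true = cong (+ 1 +ℤ_) (Sum-∧ P D S W xs)
...   | false = trans (Sum-∧ P D S W xs) (sym (ℤP.+-identityˡ _))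

Sum-pos : ∀ {X : Set} (f : X → ℕ) xs → + sum (map f xs) ≡ Sum xs (λ x → + f x)
Sum-pos f [] = refl
Sum-pos f (x ∷ xs) = cong (+ f x +ℤ_) (Sum-pos f xs)

conv-Sum : ∀ {M X Y : Set} (splits : M → List (M × M)) m (xs : List X) (ys : List Y) (f : M → X → ℤ) (h : M → Y → ℤ) →
  conv splits m (λ p q → Sum xs (f p) *ℤ Sum ys (h q)) ≡ Sum xs (λ x → Sum ys (λ y → conv splits m (λ p q → f p x *ℤ h q y)))
conv-Sum splits m xs ys f h = begin
  conv splits m (λ p q → Sum xs (f p) *ℤ Sum ys (h q))
    ≡⟨ Sum-cong (splits m) (λ (p , q) → trans (sym (Sum-*ʳ xs (Sum ys (h q)) (f p)))
         (Sum-cong xs (λ x → sym (Sum-*ˡ ys (f p x) (h q))))) ⟩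
  conv splits m (λ p q → Sum xs (λ x → Sum ys (λ y → f p x *ℤ h q y)))
    ≡⟨ Sum-comm (splits m) xs (λ pq x → Sum ys (λ y → f (proj₁ pq) x *ℤ h (proj₂ pq) y)) ⟩
  Sum xs (λ x → conv splits m (λ p q → Sum ys (λ y → f p x *ℤ h q y)))
    ≡⟨ Sum-cong xs (λ x → Sum-comm (splits m) ys (λ pq y → f (proj₁ pq) x *ℤ h (proj₂ pq) y)) ⟩
  Sum xs (λ x → Sum ys (λ y → conv splits m (λ p q → f p x *ℤ h q y))) ∎
  where open ≡-Reasoning

module Recurrence (r : ℕ) (1≤r : 1 ≤ r) where

  open Decomposition r

  private
    W : Set
    W = Vec ℕ (suc r)

    module X = IsSplit (vecIsSplit (suc r))
    module XC = Convolution (vecIsSplit (suc r))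

    convV : W → (W → W → ℤ) → ℤ
    convV = conv splitsV

  g : ℕ → ℕ → W → ℤ
  g n k a = Sum (sortables r n k) (λ T → δV (weightVec r T) a)

  countTSS-g : ∀ n k a → + countTSS r n k a ≡ g n k a
  countTSS-g n k a = Sum-∧ (λ T → isRPerm r n (concat T)) (disjointComps n) (twoStackSortable n)
    (λ T → does (VP.≡-dec ℕ._≟_ (weightVec r T) a)) (concatMap (cuts k) (wordsOver n (n * r)))

  partialG-g : ∀ N k a → partialG r N (k , a) ≡ Sum (upTo (suc N)) (λ n → g n k a)
  partialG-g N k a = trans (Sum-pos (λ n → countTSS r n k a) (upTo (suc N))) (Sum-cong (upTo (suc N)) (λ n → countTSS-g n k a))

  weightVec-[] : weightVec r [] ≡ replicate (suc r) 0
  weightVec-[] = lookup-ext λ i → trans (VP.lookup∘tabulate (λ _ → 0) i) (sym (VP.lookup-replicate i 0))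

  sum-replicate : ∀ n → V.sum (replicate n 0) ≡ 0
  sum-replicate n = IsSplit.ε-deg (vecIsSplit n)

  noComponents : ∀ {n T} → Valid r n 0 T → T ≡ [] × n ≡ 0
  noComponents {zero} {[]} v = refl , refl
  noComponents {suc n} {[]} v = case subst (1 ≤_) (sym (Weak.count (Valid.weak v) (s≤s z≤n) ℕP.≤-refl)) 1≤r of λ ()
  noComponents {T = _ ∷ _} v = case Valid.size v of λ ()

  components≤letters : ∀ {k T} → Valid r 0 (suc k) T → ⊥
  components≤letters {T = []} v = case Valid.size v of λ ()
  components≤letters {T = [] ∷ _} v = All.head (Valid.nonEmpty v) refl
  components≤letters {T = (a ∷ _) ∷ _} v with Weak.range (Valid.weak v) (here refl)
  ... | 1≤a , a≤0 = ℕP.<⇒≱ 1≤a a≤0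

  -- Each letter that does not open a component contributes exactly one descent.
  letters≡ : ∀ n {k T} → Valid r n k T → n ≡ k + V.sum (weightVec r T)
  letters≡ = <-rec _ go
    where
    go : ∀ n → (∀ {n′} → n′ < n → ∀ {k T} → Valid r n′ k T → n′ ≡ k + V.sum (weightVec r T)) →
         ∀ {k T} → Valid r n k T → n ≡ k + V.sum (weightVec r T)
    go n rec {zero} v with noComponents v
    ... | refl , refl = sym (trans (cong V.sum weightVec-[]) (sum-replicate (suc r)))
    go zero rec {suc k} v = ⊥-elim (components≤letters v)
    go (suc n) rec {suc k} {T} v = cong suc (begin
      n
        ≡⟨ ℕP.m+[n∸m]≡n p≤n ⟨
      p + (n ∸ p)
        ≡⟨ cong₂ _+_ (rec (s≤s p≤n) validL) (rec (s≤s (ℕP.m∸n≤m n p)) validR) ⟩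
      ((i + countTrue S) + wL) + ((k ∸ i) + wR)
        ≡⟨ cong (_+ ((k ∸ i) + wR)) (ℕP.+-assoc i _ _) ⟩
      (i + (countTrue S + wL)) + ((k ∸ i) + wR)
        ≡⟨ ℕ+.interchange i _ (k ∸ i) wR ⟩
      (i + (k ∸ i)) + ((countTrue S + wL) + wR)
        ≡⟨ cong₂ _+_ (ℕP.m+[n∸m]≡n i≤k) (ℕP.+-assoc (countTrue S) wL wR) ⟩
      k + (countTrue S + (wL + wR))
        ≡⟨ cong (_+_ k) total ⟨
      k + V.sum (weightVec r T) ∎)
      where
      open ≡-Reasoning
      d = decompose n T
      i = proj₁ d
      p = proj₁ (proj₂ d)
      S = proj₁ (proj₂ (proj₂ d))
      L = proj₁ (proj₂ (proj₂ (proj₂ d)))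
      R = proj₂ (proj₂ (proj₂ (proj₂ d)))
      part : IsPart n k i p S L R
      part = Decompose.isPart 1≤r T v
      open IsPart part
      wL = V.sum (weightVec r L)
      wR = V.sum (weightVec r R)
      total : V.sum (weightVec r T) ≡ countTrue S + (wL + wR)
      total = trans (cong (V.sum ∘ weightVec r) (sym (Decompose.build-decompose 1≤r T v)))
        (trans (cong V.sum (Build.weight 1≤r part))
        (trans (sum-⊕ (indicator S) _) (cong₂ _+_ (sum-indicator S) (sum-⊕ (weightVec r L) (weightVec r R)))))

  -- By `letters≡` a count vanishes unless `n` is `k + V.sum a`; with this factor visible, sums over
  -- the number of letters collapse.
  g-δ : ∀ n k a → g n k a ≡ δℕ (k + V.sum a) n *ℤ g n k a
  g-δ n k a with k + V.sum a ℕ.≟ n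
  ... | yes refl = trans (sym (ℤP.*-identityˡ _)) (cong (_*ℤ g n k a) (sym (Naturals.δ-reflℕ n)))
  ... | no ne = trans (Sum-zero (sortables r n k) zeroTerm) (sym (cong (_*ℤ g n k a) (Naturals.δ-≢ℕ (k + V.sum a) n ne)))
    where
    zeroTerm : ∀ {T} → T ∈ sortables r n k → δV (weightVec r T) a ≡ + 0
    zeroTerm {T} T∈ = δV-≢ {a = weightVec r T} {b = a} (λ { refl → ne (sym (letters≡ n (∈-sortables⁻ {r} {n} {k} T∈))) })

  Sum-g : ∀ N k a (f : ℕ → ℤ) → k + V.sum a < N → Sum (upTo N) (λ n → g n k a *ℤ f n) ≡ g (k + V.sum a) k a *ℤ f (k + V.sum a)
  Sum-g N k a f lt = trans
    (Sum-cong (upTo N) (λ n → trans (cong (_*ℤ f n) (g-δ n k a)) (ℤP.*-assoc (δℕ (k + V.sum a) n) (g n k a) (f n))))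
    (Sum-δℕ N (k + V.sum a) (λ n → g n k a *ℤ f n) lt)

  module _ (G : Series r) (isG : IsG r G) where

    G-g : ∀ k a → G (k , a) ≡ g (k + V.sum a) k a
    G-g k a = begin
      G (k , a)
        ≡⟨ proj₂ (isG (k , a)) N′ (ℕP.m≤m+n N (k + V.sum a)) ⟨
      partialG r N′ (k , a)
        ≡⟨ partialG-g N′ k a ⟩
      Sum (upTo (suc N′)) (λ n → g n k a)
        ≡⟨ Sum-cong (upTo (suc N′)) (λ n → ℤP.*-identityʳ (g n k a)) ⟨
      Sum (upTo (suc N′)) (λ n → g n k a *ℤ + 1)
        ≡⟨ Sum-g (suc N′) k a (λ _ → + 1) (s≤s (ℕP.m≤n+m (k + V.sum a) N)) ⟩
      g (k + V.sum a) k a *ℤ + 1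
        ≡⟨ ℤP.*-identityʳ (g (k + V.sum a) k a) ⟩
      g (k + V.sum a) k a ∎
      where
      open ≡-Reasoning
      N = proj₁ (isG (k , a))
      -- Large enough both for the partial sums to be stable and for the only nonzero summand to be
      -- included.
      N′ = N + (k + V.sum a)

    G-zero : ∀ a → G (0 , a) ≡ oneS (0 , a)
    G-zero a = trans (G-g 0 a) (by (V.sum a) refl)
      where
      by : ∀ n → V.sum a ≡ n → g n 0 a ≡ δV (replicate (suc r) 0) a
      by zero eq = trans (ℤP.+-identityʳ (δV (weightVec r []) a)) (cong (λ w → δV w a) weightVec-[])
      by (suc n) eq = trans
        (Sum-zero (sortables r (suc n) 0) (λ T∈ → case proj₂ (noComponents (∈-sortables⁻ {r} {suc n} {0} T∈)) of λ ()))
        (sym (δV-≢ {a = replicate (suc r) 0} {b = a} λ e → case trans (sym (sum-replicate (suc r))) (trans (cong V.sum e) eq) of λ ()))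

    -- The coefficient of x^a in x^S g_{i+|S|} g_{k-i}.
    term : ∀ k i → Vec Bool (suc r) → W → ℤ
    term k i S a = convV a (λ s e → δV (indicator S) s *ℤ convV e (λ d c → G (i + countTrue S , d) *ℤ G (k ∸ i , c)))

    -- For `n = k + V.sum a` this is the share of `term k i S a` in which the left tuple has `p`
    -- letters.
    sizedTerm : ∀ n k i p → Vec Bool (suc r) → W → ℤ
    sizedTerm n k i p S a = convV a (λ s e → δV (indicator S) s *ℤ convV e (λ d c → g p (i + countTrue S) d *ℤ g (n ∸ p) (k ∸ i) c))

    -- The weight of a rebuilt tuple is a sum of three exponents. By `conv-δδ`, used twice, its
    -- indicator is a convolution of three indicators, and these separate the sum over `L` from the
    -- sum over `R`.
    parts-sizedTerm : ∀ n k i p S a →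
      Sum (sortables r p (i + countTrue S)) (λ L → Sum (sortables r (n ∸ p) (k ∸ i)) (λ R → δV (indicator S ⊕ (weightVec r L ⊕ weightVec r R)) a))
      ≡ sizedTerm n k i p S a
    parts-sizedTerm n k i p S a = sym (begin
      convV a (λ s e → δV (indicator S) s *ℤ convV e (λ d c → Sum Ls (λ L → δL L d) *ℤ Sum Rs (λ R → δL R c)))
        ≡⟨ XC.conv-cong a (λ s e _ → cong (δV (indicator S) s *ℤ_) (trans
             (conv-Sum splitsV e Ls Rs (λ d L → δL L d) (λ c R → δL R c))
             (Sum-cong Ls (λ L → Sum-cong Rs (λ R → X.conv-δδ (weightVec r L) (weightVec r R) e))))) ⟩
      convV a (λ s e → δV (indicator S) s *ℤ Sum Ls (λ L → Sum Rs (λ R → δV (weightVec r L ⊕ weightVec r R) e)))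
        ≡⟨ XC.conv-cong a (λ s e _ → trans (sym (Sum-*ˡ Ls (δV (indicator S) s) (λ L → Sum Rs (λ R → δV (weightVec r L ⊕ weightVec r R) e))))
             (Sum-cong Ls (λ L → sym (Sum-*ˡ Rs (δV (indicator S) s) (λ R → δV (weightVec r L ⊕ weightVec r R) e))))) ⟩
      convV a (λ s e → Sum Ls (λ L → Sum Rs (λ R → δV (indicator S) s *ℤ δV (weightVec r L ⊕ weightVec r R) e)))
        ≡⟨ Sum-comm (splitsV a) Ls (λ se L → Sum Rs (λ R → δV (indicator S) (proj₁ se) *ℤ δV (weightVec r L ⊕ weightVec r R) (proj₂ se))) ⟩
      Sum Ls (λ L → convV a (λ s e → Sum Rs (λ R → δV (indicator S) s *ℤ δV (weightVec r L ⊕ weightVec r R) e)))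
        ≡⟨ Sum-cong Ls (λ L → trans
             (Sum-comm (splitsV a) Rs (λ se R → δV (indicator S) (proj₁ se) *ℤ δV (weightVec r L ⊕ weightVec r R) (proj₂ se)))
             (Sum-cong Rs (λ R → X.conv-δδ (indicator S) (weightVec r L ⊕ weightVec r R) a))) ⟩
      Sum Ls (λ L → Sum Rs (λ R → δV (indicator S ⊕ (weightVec r L ⊕ weightVec r R)) a)) ∎)
      where
      open ≡-Reasoning
      Ls = sortables r p (i + countTrue S)
      Rs = sortables r (n ∸ p) (k ∸ i)
      δL : List Word → W → ℤ
      δL T = δV (weightVec r T)

    g-parts : ∀ n k a → g (suc n) (suc k) a ≡
      Sum (upTo (suc k)) (λ i → Sum (upTo (suc n)) (λ p → Sum (allBool (suc r)) (λ S → sizedTerm n k i p S a)))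
    g-parts n k a = begin
      g (suc n) (suc k) a
        ≡⟨ Sum-sortables 1≤r n k (λ T → δV (weightVec r T) a) ⟩
      Sum (parts n k) (λ d → δV (weightVec r (build n d)) a)
        ≡⟨ Sum-cong-∈ (parts n k) (λ d∈ → cong (λ w → δV w a) (Build.weight 1≤r (∈-parts⁻ {n} {k} d∈))) ⟩
      Sum (parts n k) (λ d → weigh d)
        ≡⟨ Sum-tagged (upTo (suc k)) (letterSplits n k) weigh ⟩
      Sum (upTo (suc k)) (λ i → Sum (letterSplits n k i) (λ d → weigh (i , d)))
        ≡⟨ Sum-cong (upTo (suc k)) (λ i → trans (Sum-tagged (upTo (suc n)) (patterns n k i) (λ d → weigh (i , d)))
           (Sum-cong (upTo (suc n)) (λ p → trans (Sum-tagged (allBool (suc r)) (subtuples n k i p) (λ d → weigh (i , p , d)))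
           (Sum-cong (allBool (suc r)) (λ S → trans
             (Sum-tagged (sortables r p (i + countTrue S)) (λ _ → sortables r (n ∸ p) (k ∸ i)) (λ d → weigh (i , p , S , d)))
             (parts-sizedTerm n k i p S a)))))) ⟩
      Sum (upTo (suc k)) (λ i → Sum (upTo (suc n)) (λ p → Sum (allBool (suc r)) (λ S → sizedTerm n k i p S a))) ∎
      where
      open ≡-Reasoning
      weigh : Data → ℤ
      weigh (i , p , S , L , R) = δV (indicator S ⊕ (weightVec r L ⊕ weightVec r R)) a

    -- For each splitting of `e` into `d` and `c` only `p = j + V.sum d` contributes, and then
    -- `n ∸ p` is the matching `j′ + V.sum c`. Both counts are therefore coefficients of `G`.
    Sum-sizes : ∀ n j j′ e → n ≡ j + (j′ + V.sum e) →
      Sum (upTo (suc n)) (λ p → convV e (λ d c → g p j d *ℤ g (n ∸ p) j′ c)) ≡ convV e (λ d c → G (j , d) *ℤ G (j′ , c))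
    Sum-sizes n j j′ e n≡ = trans
      (Sum-comm (upTo (suc n)) (splitsV e) (λ p dc → g p j (proj₁ dc) *ℤ g (n ∸ p) j′ (proj₂ dc)))
      (XC.conv-cong e (λ d c eq → trans
        (Sum-g (suc n) j d (λ p → g (n ∸ p) j′ c) (s≤s (fits d c eq)))
        (cong₂ _*ℤ_ (sym (G-g j d)) (trans (cong (λ l → g l j′ c) (rest d c eq)) (sym (G-g j′ c))))))
      where
      total : ∀ d c → V.sum d + V.sum c ≡ V.sum e → n ≡ (j + V.sum d) + (j′ + V.sum c)
      total d c eq = trans n≡ (trans (cong (λ x → j + (j′ + x)) (sym eq))
        (trans (cong (_+_ j) (ℕ+.x∙yz≈y∙xz j′ (V.sum d) (V.sum c))) (sym (ℕP.+-assoc j (V.sum d) _))))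
      fits : ∀ d c → V.sum d + V.sum c ≡ V.sum e → j + V.sum d ≤ n
      fits d c eq = ℕP.≤-trans (ℕP.m≤m+n (j + V.sum d) (j′ + V.sum c)) (ℕP.≤-reflexive (sym (total d c eq)))
      rest : ∀ d c → V.sum d + V.sum c ≡ V.sum e → n ∸ (j + V.sum d) ≡ j′ + V.sum c
      rest d c eq = trans (cong (_∸ (j + V.sum d)) (total d c eq)) (ℕP.m+n∸m≡n (j + V.sum d) (j′ + V.sum c))

    -- The hypothesis of `Sum-sizes` on degrees holds when the first part `s` is `indicator S`; for
    -- any other `s` both sides vanish by the factor `δV`.
    Sum-sizedTerm : ∀ k i S a → i ≤ k →
      Sum (upTo (suc (k + V.sum a))) (λ p → sizedTerm (k + V.sum a) k i p S a) ≡ term k i S a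
    Sum-sizedTerm k i S a i≤k = trans
      (Sum-comm (upTo (suc n)) (splitsV a) (λ p se → δV (indicator S) (proj₁ se) *ℤ inner p (proj₂ se)))
      (XC.conv-cong a (λ s e eq → trans (Sum-*ˡ (upTo (suc n)) (δV (indicator S) s) (λ p → inner p e))
        (by s e eq (VP.≡-dec ℕ._≟_ (indicator S) s))))
      where
      open ≡-Reasoning
      n = k + V.sum a
      inner : ℕ → W → ℤ
      inner p e = convV e (λ d c → g p (i + countTrue S) d *ℤ g (n ∸ p) (k ∸ i) c)
      outer : W → ℤ
      outer e = convV e (λ d c → G (i + countTrue S , d) *ℤ G (k ∸ i , c))
      by : ∀ s e → V.sum s + V.sum e ≡ V.sum a → Dec (indicator S ≡ s) →
           δV (indicator S) s *ℤ Sum (upTo (suc n)) (λ p → inner p e) ≡ δV (indicator S) s *ℤ outer e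
      by s e eq (no ne) = trans (cong (_*ℤ Sum (upTo (suc n)) (λ p → inner p e)) (δV-≢ ne)) (sym (cong (_*ℤ outer e) (δV-≢ ne)))
      by _ e eq (yes refl) = cong (δV (indicator S) (indicator S) *ℤ_) (Sum-sizes n (i + countTrue S) (k ∸ i) e (begin
        k + V.sum a                                    ≡⟨ cong₂ _+_ (ℕP.m+[n∸m]≡n i≤k) (trans (cong (_+ V.sum e) (sym (sum-indicator S))) eq) ⟨
        (i + (k ∸ i)) + (countTrue S + V.sum e)        ≡⟨ ℕ+.interchange i (k ∸ i) (countTrue S) (V.sum e) ⟩
        (i + countTrue S) + ((k ∸ i) + V.sum e)        ∎))

    monoS-⊛ : ∀ u (H : Series r) i b → (monoS (0 , u) ⊛ H) (i , b) ≡ convV b (λ s d → δV u s *ℤ H (i , d))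
    monoS-⊛ u H i b = begin
      (monoS (0 , u) ⊛ H) (i , b)
        ≡⟨ MonoProduct.conv-pair r i b (λ p q → monoS (0 , u) p *ℤ H q) ⟩
      conv splitsℕ i (λ i₁ i₂ → convV b (λ s d → monoS (0 , u) (i₁ , s) *ℤ H (i₂ , d)))
        ≡⟨ Sum-cong (splitsℕ i) (λ (i₁ , i₂) → trans
             (Sum-cong (splitsV b) (λ (s , d) → trans (cong (_*ℤ H (i₂ , d)) (δM-pair 0 u i₁ s)) (ℤP.*-assoc (δℕ 0 i₁) (δV u s) (H (i₂ , d)))))
             (Sum-*ˡ (splitsV b) (δℕ 0 i₁) (λ sd → δV u (proj₁ sd) *ℤ H (i₂ , proj₂ sd)))) ⟩
      conv splitsℕ i (λ i₁ i₂ → δℕ 0 i₁ *ℤ convV b (λ s d → δV u s *ℤ H (i₂ , d)))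
        ≡⟨ Naturals.δ-leftℕ i (λ _ i₂ → convV b (λ s d → δV u s *ℤ H (i₂ , d))) ⟩
      convV b (λ s d → δV u s *ℤ H (i , d)) ∎
      where open ≡-Reasoning

    FG-at : ∀ k a → (Fseries r G ⊛ G) (k , a) ≡ Sum (upTo (suc k)) (λ i → Sum (allBool (suc r)) (λ S → term k i S a))
    FG-at k a = begin
      (Fseries r G ⊛ G) (k , a)
        ≡⟨ MonoProduct.conv-pair r k a (λ p q → Fseries r G p *ℤ G q) ⟩
      conv splitsℕ k (λ i i′ → convV a (λ b c → Fseries r G (i , b) *ℤ G (i′ , c)))
        ≡⟨ Sum-map (upTo (suc k)) (λ i → i , k ∸ i) (λ ii → convV a (λ b c → Fseries r G (proj₁ ii , b) *ℤ G (proj₂ ii , c))) ⟩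
      Sum (upTo (suc k)) (λ i → convV a (λ b c → Fseries r G (i , b) *ℤ G (k ∸ i , c)))
        ≡⟨ Sum-cong (upTo (suc k)) perIndex ⟩
      Sum (upTo (suc k)) (λ i → Sum (allBool (suc r)) (λ S → term k i S a)) ∎
      where
      open ≡-Reasoning
      perIndex : ∀ i → convV a (λ b c → Fseries r G (i , b) *ℤ G (k ∸ i , c)) ≡ Sum (allBool (suc r)) (λ S → term k i S a)
      perIndex i = begin
        convV a (λ b c → Fseries r G (i , b) *ℤ G (k ∸ i , c))
          ≡⟨ XC.conv-cong a (λ b c _ → trans (cong (_*ℤ G (k ∸ i , c)) (trans (Fseries-at G (i , b))
               (Sum-cong (allBool (suc r)) (λ S → monoS-⊛ (indicator S) (shiftZ (countTrue S) G) i b))))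
               (sym (Sum-*ʳ (allBool (suc r)) (G (k ∸ i , c)) (λ S → convV b (λ s d → δV (indicator S) s *ℤ G (i + countTrue S , d)))))) ⟩
        convV a (λ b c → Sum (allBool (suc r)) (λ S → convV b (λ s d → δV (indicator S) s *ℤ G (i + countTrue S , d)) *ℤ G (k ∸ i , c)))
          ≡⟨ Sum-comm (splitsV a) (allBool (suc r))
               (λ bc S → convV (proj₁ bc) (λ s d → δV (indicator S) s *ℤ G (i + countTrue S , d)) *ℤ G (k ∸ i , proj₂ bc)) ⟩
        Sum (allBool (suc r)) (λ S → convV a (λ b c → convV b (λ s d → δV (indicator S) s *ℤ G (i + countTrue S , d)) *ℤ G (k ∸ i , c)))
          -- Regroups `(x^S g) g` as `x^S (g g)`, the order in which a decomposed tuple presents its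
          -- weights.
          ≡⟨ Sum-cong (allBool (suc r)) (λ S → XC.at (XC.⊛-assoc (δV (indicator S)) (λ d → G (i + countTrue S , d)) (λ c → G (k ∸ i , c))) a) ⟩
        Sum (allBool (suc r)) (λ S → term k i S a) ∎

    -- A tuple with `suc k` components loses one when its largest letter is removed, which is the
    -- factor `z`. Coefficient `i` of `F` collects the left tuples with `i` preceding components.
    -- The 1 is the empty tuple.
    functional-equation : G ≋ oneS ⊞ zS ⊛ (Fseries r G ⊛ G)
    functional-equation = mk λ
      { (zero , a) → trans (G-zero a) (sym (trans (cong (oneS (zero , a) +ℤ_) (zS-zero (Fseries r G ⊛ G) a)) (ℤP.+-identityʳ _)))
      ; (suc k , a) → sym (trans (ℤP.+-identityˡ _) (trans (zS-suc (Fseries r G ⊛ G) k a) (trans (FG-at k a) (sym (G-suc k a))))) }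
      where
      G-suc : ∀ k a → G (suc k , a) ≡ Sum (upTo (suc k)) (λ i → Sum (allBool (suc r)) (λ S → term k i S a))
      G-suc k a = trans (G-g (suc k) a) (trans (g-parts (k + V.sum a) k a)
        (Sum-cong-∈ (upTo (suc k)) (λ {i} i∈ → trans
          (Sum-comm (upTo (suc (k + V.sum a))) (allBool (suc r)) (λ p S → sizedTerm (k + V.sum a) k i p S a))
          (Sum-cong (allBool (suc r)) (λ S → Sum-sizedTerm k i S a (ℕP.≤-pred (∈-upTo⁻ i∈)))))))

-- The closed forms of `G` and `F` with denominators cleared

theorem3 : (r : ℕ) → 1 ≤ r →
    (y : Fin (suc r) → Series r) →
    (∀ j → constTerm (y j) ≡ + 0) →
    (∀ j → xS j *S Ey y *S Ey y ≈ y j *S (oneS +S y j)) →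
    (c : Series r) →
    c ≈ oneS +S (zS *S Ey y *S Ey y) *S c *S c →
    (G : Series r) → IsG r G →
    (G *S Eyu y c ≈ c *S Ey y)
    × ((zS *S Ey y *S Ey y) *S c *S Fseries r G ≈ Ey y *S (c *S Ey y -S Eyu y c))
theorem3 r 1≤r y yε y-eq c c-eq G isG = at (proj₁ solved) , at (proj₂ solved)
  where
  solved = solution y yε (λ j → mk (y-eq j)) c (mk c-eq) G (Recurrence.functional-equation r 1≤r G isG)
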